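{- There is an absolute constant $C$ such that for every graph $G$ with $n$ nodes that has an even-face embedding in the projective plane, $\operatorname{STAB}(G)$ has an extended formulation of size at most $Cn^2$.
   Context: An embedding of a graph $G$ in a surface is an even-face embedding if every face is an open disk bounded by an even cycle of $G$. $\operatorname{STAB}(G)$ is the convex hull of characteristic vectors of stable sets of $G$. An extended formulation of a polyhedron $P$ is a description $P=\{x\mid\exists y: Ax+By\le b\}$, whose size is the number of inequalities.
   Formalization: STAB(G) and the extended formulation are taken over the rational numbers: the points x, the auxiliary y, the convex weights and the data A, B, b are rational instead of real. -}

module Defs where

open import Data.Nat using (ℕ; zero; suc; _+_; _*_; _≥_)
import Data.Nat as N
open import Data.Nat.Divisibility using (_∣_)
open import Data.Bool using (Bool; true; false; if_then_else_; _∧_)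
open import Data.Fin using (Fin; zero; suc; toℕ)
open import Data.Fin.Subset using (Subset; _∈_; _∉_)
open import Data.List using (List; []; _∷_; _++_; [_]; zip; length)
open import Data.List.Relation.Unary.All using (All)
open import Data.List.Relation.Unary.Unique.Propositional using (Unique)
open import Data.List.Membership.Propositional using () renaming (_∈_ to _∈ₗ_)
open import Data.List.Relation.Unary.Any using (any?)
open import Data.Product using (Σ; ∃; _×_; _,_; proj₁; proj₂)
open import Data.Sum using (_⊎_)
open import Relation.Binary.PropositionalEquality using (_≡_)
open import Relation.Nullary.Decidable using (⌊_⌋; _⊎-dec_; _×-dec_)
open import Data.Rational as Q using (ℚ; 0ℚ; 1ℚ)

record Graph (n : ℕ) : Set where
  field
    adj     : Fin n → Fin n → Bool
    sym     : ∀ i j → adj i j ≡ adj j i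
    irrefl  : ∀ i → adj i i ≡ false
open Graph public

Adj : ∀ {n} → Graph n → Fin n → Fin n → Set
Adj G i j = adj G i j ≡ true

Σℕ : ∀ {k} → (Fin k → ℕ) → ℕ
Σℕ {zero}  f = 0
Σℕ {suc k} f = f zero + Σℕ (λ i → f (suc i))

edgeCount : ∀ {n} → Graph n → ℕ
edgeCount G = Σℕ λ i → Σℕ λ j →
  if ⌊ toℕ i N.<? toℕ j ⌋ ∧ adj G i j then 1 else 0

Connected : ∀ {n} → Graph n → Set
Connected {n} G = (S : Subset n) →
  (∀ i j → Adj G i j → i ∈ S → j ∈ S) →
  (∀ i → i ∈ S) ⊎ (∀ i → i ∉ S)

cycPairs : ∀ {A : Set} → List A → List (A × A)
cycPairs []       = []
cycPairs (x ∷ xs) = zip (x ∷ xs) (xs ++ [ x ])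

IsCycle : ∀ {n} → Graph n → List (Fin n) → Set
IsCycle G w = (length w ≥ 3) × Unique w × All (λ p → Adj G (proj₁ p) (proj₂ p)) (cycPairs w)

IsEvenCycle : ∀ {n} → Graph n → List (Fin n) → Set
IsEvenCycle G w = IsCycle G w × (2 ∣ length w)

usesEdge : ∀ {n} → Fin n → Fin n → List (Fin n) → Bool
usesEdge u v w = ⌊ any? (λ p → ((proj₁ p Data.Fin.≟ u) ×-dec (proj₂ p Data.Fin.≟ v))
                            ⊎-dec ((proj₁ p Data.Fin.≟ v) ×-dec (proj₂ p Data.Fin.≟ u)))
                       (cycPairs w) ⌋

faceCount : ∀ {n} → Fin n → Fin n → List (List (Fin n)) → ℕ
faceCount u v []       = 0
faceCount u v (f ∷ fs) = (if usesEdge u v f then 1 else 0) + faceCount u v fs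

Corner : ∀ {n} → List (List (Fin n)) → Fin n → Fin n → Fin n → Set
Corner F v a b = ∃ λ f → (f ∈ₗ F) × ((a , v) ∈ₗ cycPairs f) × ((v , b) ∈ₗ cycPairs f)

-- Even-face embeddings in the projective plane, combinatorially.
--
-- The embedding is given by its list of faces, each face recorded by its
-- boundary, which must be an even cycle of G.  The surface is the 2-cell
-- complex obtained by gluing a disk along each of these cycles.  It is a
-- closed surface iff every edge lies on exactly two face boundaries and the
-- link of every vertex (its incident edges joined by the corners of the faces
-- at that vertex) is a single cycle, i.e. connected.  It is connected iff G
-- is, and it is the projective plane iff moreover its Euler characteristic
-- V - E + F equals 1 (the closed surfaces with χ = 1 being exactly the
-- projective plane).

record EvenFaceEmbeddingPP {n : ℕ} (G : Graph n) : Set where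
  field
    faces        : List (List (Fin n))
    faces-even   : All (IsEvenCycle G) faces
    edge-twice   : ∀ u v → Adj G u v → faceCount u v faces ≡ 2
    link-conn    : ∀ v (S : Subset n) →
                   (∀ a b → Corner faces v a b → a ∈ S → b ∈ S) →
                   (∀ a b → Corner faces v a b → b ∈ S → a ∈ S) →
                   (∀ u → Adj G v u → u ∈ S) ⊎ (∀ u → Adj G v u → u ∉ S)
    connected    : Connected G
    euler        : n + length faces ≡ edgeCount G + 1

HasEvenFaceEmbeddingPP : ∀ {n} → Graph n → Set
HasEvenFaceEmbeddingPP G = EvenFaceEmbeddingPP G

Σℚ : ∀ {k} → (Fin k → ℚ) → ℚ
Σℚ {zero}  f = 0ℚ
Σℚ {suc k} f = f zero Q.+ Σℚ (λ i → f (suc i))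

Stable : ∀ {n} → Graph n → Subset n → Set
Stable G S = ∀ i j → i ∈ S → j ∈ S → adj G i j ≡ false

χ : ∀ {n} → Subset n → Fin n → ℚ
χ S i = if Data.Vec.lookup S i then 1ℚ else 0ℚ
  where import Data.Vec

InSTAB : ∀ {n} → Graph n → (Fin n → ℚ) → Set
InSTAB {n} G x = Σ ℕ λ k → Σ (Fin k → Subset n) λ S → Σ (Fin k → ℚ) λ λs →
  (∀ j → Stable G (S j)) × (∀ j → 0ℚ Q.≤ λs j) × (Σℚ λs ≡ 1ℚ) ×
  (∀ i → x i ≡ Σℚ (λ j → λs j Q.* χ (S j) i))

record ExtendedFormulation (n : ℕ) (P : (Fin n → ℚ) → Set) : Set where
  field
    m d : ℕ
    A   : Fin m → Fin n → ℚ
    B   : Fin m → Fin d → ℚ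
    b   : Fin m → ℚ
    correct : ∀ x → (P x → Σ (Fin d → ℚ) λ y →
                       ∀ r → Σℚ (λ i → A r i Q.* x i) Q.+ Σℚ (λ j → B r j Q.* y j) Q.≤ b r)
                  × (Σ (Fin d → ℚ) (λ y →
                       ∀ r → Σℚ (λ i → A r i Q.* x i) Q.+ Σℚ (λ j → B r j Q.* y j) Q.≤ b r) → P x)

size : ∀ {n P} → ExtendedFormulation n P → ℕ
size E = ExtendedFormulation.m E

{-# OPTIONS --safe #-}
module Submission where

-- Let k be an integer function on arcs with k(u,v) + k(v,u) = 1 on every edge.
-- If q(v) - p(u) ≤ k(u,v) for integral p and q with q - p in {0,1}, then q - p is
-- the indicator of a stable set.  These are difference constraints, so rounding
-- p and q by a common shift shows that the polytope of all q - p with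
-- q(v) - p(u) ≤ k(u,v) and 0 ≤ q - p ≤ 1 lies in STAB(G).  As |F| ≤ n and |E| ≤ 2n
-- by Euler's formula, it suffices to cover all stable sets by 2|F| such polytopes
-- and to take their disjunctive union.
--
-- Put D = 2k - 1, an antisymmetric function with odd values on edges.  Up to a
-- coboundary, D is determined by its face sums.  For G not bipartite, the two
-- functions k used for a face have D with sum ±2 on this face and 0 on all others.
-- A stable set S lies in the polytope of k as soon as some function with the same
-- face sums vanishes on the edges covered by S and is at most 1 in absolute value
-- elsewhere.  Such a function is found by walking along dual edges not covered by
-- S: either a walk closes up with sum ±2 on one face, or every edge gets an odd
-- value with all face sums 0, which would give a 2-colouring of G.
--
-- The only topological input is the vanishing of the rational first cohomology.
-- Both for the ordinary boundary operator and for its unsigned analogue, χ = 1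
-- makes a homogeneous linear system underdetermined, and orthogonality of
-- boundaries and coboundaries splits its solution.  The unsigned case yields an
-- alternating relation between the faces; together with an orientation of all
-- faces it would give a rotation direction at every vertex that flips along every
-- edge, again a 2-colouring.

open import Defs hiding (sym)
open import Data.Bool as Bool using (Bool; true; false; if_then_else_; _∧_)
import Data.Bool.Properties as Bool
open import Data.Empty using (⊥; ⊥-elim)
open import Data.Fin as Fin
  using (Fin; zero; suc; toℕ; punchIn; combine; remQuot; splitAt; _↑ˡ_; _↑ʳ_)
import Data.Fin.Properties as Fin
open import Data.Fin.Subset as Subset using (Subset)
import Data.Fin.Subset.Properties as Subset
open import Data.Integer hiding (suc; _*_; _≤_)
open import Data.Integer.DivMod
  using (_/ℕ_; _%ℕ_; a≡a%ℕn+[a/ℕn]*n; [n/ℕd]*d≤n; n<s[n/ℕd]*d; n%ℕd<d)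
open import Data.Integer.Properties
open import Data.Integer.Tactic.RingSolver using (solve-∀)
open import Data.List
  using (List; []; _∷_; length; _++_; map; zip; [_]; lookup; allFin; cartesianProduct; tabulate)
open import Data.List.Membership.DecPropositional using () renaming (_∈?_ to member?)
open import Data.List.Membership.Propositional using (_∈_; _∉_; find; lose)
open import Data.List.Membership.Propositional.Properties
  using (∈-lookup; ∈-++⁺ˡ; ∈-++⁺ʳ; ∈-++⁻; ∈-allFin; ∈-map⁺; ∈-map⁻; ∈-cartesianProduct⁺)
open import Data.List.Properties using (length-++; length-map; length-tabulate)
open import Data.List.Relation.Unary.All as All using (All; []; _∷_)
import Data.List.Relation.Unary.All.Properties as All
open import Data.List.Relation.Unary.AllPairs using ([]; _∷_)
open import Data.List.Relation.Unary.Any as Any using (Any; here; there; any?)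
import Data.List.Relation.Unary.Any.Properties as Any
open import Data.List.Relation.Unary.Unique.Propositional using (Unique)
import Data.List.Relation.Unary.Unique.Propositional.Properties as Unique
open import Data.Nat as ℕ using (ℕ; zero; suc; s≤s; z≤n)
import Data.Nat.Coprimality as Coprime
open import Data.Nat.Divisibility using (_∣_; divides)
import Data.Nat.Properties as ℕ
import Data.Nat.Tactic.RingSolver as ℕ-Solver
open import Data.Product using (Σ; ∃; ∃₂; _×_; _,_; proj₁; proj₂; swap)
open import Data.Product.Properties using (≡-dec)
open import Data.Rational as ℚ using (ℚ; mkℚ; 0ℚ; 1ℚ; *≤*)
import Data.Rational.Properties as ℚ
import Data.Rational.Unnormalised as ℚᵘ
open import Data.Rational.Unnormalised using (*≡*)
import Data.Rational.Unnormalised.Properties as ℚᵘ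
open import Data.Sum as Sum using (_⊎_; inj₁; inj₂; [_,_]′)
open import Data.Unit using (tt)
import Data.Vec as Vec
open import Data.Vec.Functional using (insertAt)
open import Data.Vec.Functional.Properties using (insertAt-lookup; insertAt-punchIn)
import Data.Vec.Properties as Vec
open import Function using (_∘_; id)
import Relation.Binary as Bin
open import Relation.Binary.PropositionalEquality hiding ([_])
open import Relation.Nullary using (yes; no; ¬_; ¬?; Dec; _⊎-dec_; _×-dec_)
open import Relation.Nullary.Decidable using (⌊_⌋; decidable-stable; _→-dec_)

open ≡-Reasoning

-- The cohomology is rational while the argument needs parities. A function with zero face sums is
-- only shown to have a positive multiple that is a coboundary; dividing the potential by this
-- multiplier and rounding down gives integers that change along an edge by exactly the original
-- value. Integer vectors indexed by faces, modulo the face sums of antisymmetric functions, form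
-- H²(RP²; ℤ) = ℤ/2: every face is congruent to plus or minus a fixed one, and twice a face is
-- congruent to zero. An odd `D` has even face sums because the faces are even. Half of this vector
-- represents the nontrivial class: were it the face sums of some z, then `D - 2z` would be odd with
-- zero face sums. For this reason the half sums can be moved to any single face, where they become
-- 1 or -1. A bipartite G is treated apart, with a single function k. Points are kept as integer
-- numerators over a common denominator, and the passage to ℚ happens in one place.

-- Finite integer sums and fraction-free linear algebra.

module IntegerSums where

  open import Data.Integer using (_*_; _≤_)

  sum : ∀ {k} → (Fin k → ℤ) → ℤ
  sum {zero}  f = 0ℤ
  sum {suc k} f = f zero + sum (λ i → f (suc i))

  +-swap : ∀ a b c d → a + b + (c + d) ≡ a + c + (b + d)
  +-swap = solve-∀

  sum-cong : ∀ {k} {f g : Fin k → ℤ} → (∀ i → f i ≡ g i) → sum f ≡ sum g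
  sum-cong {zero}  h = refl
  sum-cong {suc k} h = cong₂ _+_ (h zero) (sum-cong (h ∘ suc))

  sum-zero : ∀ {k} (f : Fin k → ℤ) → (∀ i → f i ≡ 0ℤ) → sum f ≡ 0ℤ
  sum-zero {zero}  f h = refl
  sum-zero {suc k} f h = cong₂ _+_ (h zero) (sum-zero (f ∘ suc) (h ∘ suc))

  sum-+ : ∀ {k} (f g : Fin k → ℤ) → sum (λ i → f i + g i) ≡ sum f + sum g
  sum-+ {zero}  f g = refl
  sum-+ {suc k} f g = trans (cong (_+_ (f zero + g zero)) (sum-+ (f ∘ suc) (g ∘ suc)))
                            (+-swap (f zero) (g zero) (sum (f ∘ suc)) (sum (g ∘ suc)))

  sum-*ˡ : ∀ {k} a (f : Fin k → ℤ) → sum (λ i → a * f i) ≡ a * sum f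
  sum-*ˡ {zero}  a f = sym (*-zeroʳ a)
  sum-*ˡ {suc k} a f = trans (cong (_+_ (a * f zero)) (sum-*ˡ a (f ∘ suc))) (sym (*-distribˡ-+ a (f zero) _))

  sum-comm : ∀ {k l} (f : Fin k → Fin l → ℤ) →
    sum (λ i → sum (f i)) ≡ sum (λ j → sum (λ i → f i j))
  sum-comm {zero} {l} f = sym (sum-zero {l} (λ _ → 0ℤ) λ _ → refl)
  sum-comm {suc k} f = trans (cong (_+_ (sum (f zero))) (sum-comm (f ∘ suc)))
                             (sym (sum-+ (f zero) (λ j → sum (λ i → f (suc i) j))))

  sum-remove : ∀ {k} (i : Fin (suc k)) (f : Fin (suc k) → ℤ) → sum f ≡ f i + sum (f ∘ punchIn i)
  sum-remove         zero    f = refl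
  sum-remove {suc k} (suc i) f = trans (cong (_+_ (f zero)) (sum-remove i (f ∘ suc)))
                                       (rot (f zero) (f (suc i)) _)
    where
    rot : ∀ a b c → a + (b + c) ≡ b + (a + c)
    rot = solve-∀

  sum-single : ∀ {k} (f : Fin k → ℤ) i → (∀ j → j ≢ i → f j ≡ 0ℤ) → sum f ≡ f i
  sum-single {suc k} f i h = begin
    sum f                       ≡⟨ sum-remove i f ⟩
    f i + sum (f ∘ punchIn i)   ≡⟨ cong (_+_ (f i)) (sum-zero _ λ j → h _ (Fin.punchInᵢ≢i i j)) ⟩
    f i + 0ℤ                    ≡⟨ +-identityʳ (f i) ⟩
    f i                         ∎

  sum-split : ∀ a {b} (f : Fin (a ℕ.+ b) → ℤ) →
    sum f ≡ sum (λ i → f (i ↑ˡ b)) + sum (λ j → f (a ↑ʳ j))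
  sum-split zero    f = sym (+-identityˡ _)
  sum-split (suc a) f = trans (cong (_+_ (f zero)) (sum-split a (f ∘ suc))) (sym (+-assoc (f zero) _ _))

  i*i≥0 : ∀ i → 0ℤ ≤ i * i
  i*i≥0 (+ n)     = subst (0ℤ ≤_) (pos-* n n) (+≤+ z≤n)
  i*i≥0 (-[1+ n ]) = +≤+ z≤n

  sum≥0 : ∀ {k} (f : Fin k → ℤ) → (∀ i → 0ℤ ≤ f i) → 0ℤ ≤ sum f
  sum≥0 {zero}  f h = ≤-refl
  sum≥0 {suc k} f h = +-mono-≤ (h zero) (sum≥0 (f ∘ suc) (h ∘ suc))

  nonneg-sum≡0 : ∀ {a b} → 0ℤ ≤ a → 0ℤ ≤ b → a + b ≡ 0ℤ → a ≡ 0ℤ × b ≡ 0ℤ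
  nonneg-sum≡0 {a} {b} p q e =
    ≤-antisym (subst (a ≤_) e (subst (_≤ a + b) (+-identityʳ a) (+-monoʳ-≤ a q))) p ,
    ≤-antisym (subst (b ≤_) e (subst (_≤ a + b) (+-identityˡ b) (+-monoˡ-≤ b p))) q

  sum-nonneg≡0 : ∀ {k} (f : Fin k → ℤ) → (∀ i → 0ℤ ≤ f i) → sum f ≡ 0ℤ → ∀ i → f i ≡ 0ℤ
  sum-nonneg≡0 {suc k} f h e with nonneg-sum≡0 (h zero) (sum≥0 (f ∘ suc) (h ∘ suc)) e
  ... | e₀ , e₁ = λ { zero → e₀ ; (suc i) → sum-nonneg≡0 (f ∘ suc) (h ∘ suc) e₁ i }

  lsum : ∀ {A : Set} → (A → ℤ) → List A → ℤ
  lsum f []       = 0ℤ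
  lsum f (x ∷ xs) = f x + lsum f xs

  module _ {A : Set} where

    lsum-cong : ∀ {f g : A → ℤ} xs → (∀ {x} → x ∈ xs → f x ≡ g x) → lsum f xs ≡ lsum g xs
    lsum-cong []       h = refl
    lsum-cong (x ∷ xs) h = cong₂ _+_ (h (here refl)) (lsum-cong xs (h ∘ there))

    lsum-zero : ∀ {f : A → ℤ} xs → (∀ {x} → x ∈ xs → f x ≡ 0ℤ) → lsum f xs ≡ 0ℤ
    lsum-zero []       h = refl
    lsum-zero (x ∷ xs) h = cong₂ _+_ (h (here refl)) (lsum-zero xs (h ∘ there))

    lsum-+ : ∀ (f g : A → ℤ) xs → lsum (λ x → f x + g x) xs ≡ lsum f xs + lsum g xs
    lsum-+ f g []       = refl
    lsum-+ f g (x ∷ xs) = trans (cong (_+_ (f x + g x)) (lsum-+ f g xs))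
                                (+-swap (f x) (g x) (lsum f xs) (lsum g xs))

    lsum-*ˡ : ∀ a (f : A → ℤ) xs → lsum (λ x → a * f x) xs ≡ a * lsum f xs
    lsum-*ˡ a f []       = sym (*-zeroʳ a)
    lsum-*ˡ a f (x ∷ xs) = trans (cong (_+_ (a * f x)) (lsum-*ˡ a f xs)) (sym (*-distribˡ-+ a _ _))

    lsum-sum : ∀ {k} (f : Fin k → A → ℤ) xs →
      lsum (λ x → sum (λ i → f i x)) xs ≡ sum (λ i → lsum (f i) xs)
    lsum-sum f []       = sym (sum-zero (λ i → lsum (f i) []) λ _ → refl)
    lsum-sum f (x ∷ xs) = trans (cong (_+_ (sum (λ i → f i x))) (lsum-sum f xs)) (sym (sum-+ (λ i → f i x) (λ i → lsum (f i) xs)))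

  Nonzero : ∀ {N} → (Fin N → ℤ) → Set
  Nonzero c = ∃ λ i → c i ≢ 0ℤ

  _⊙_ : ∀ {N} → (Fin N → ℤ) → (Fin N → ℤ) → ℤ
  r ⊙ c = sum (λ i → r i * c i)

  opaque

    -- Fraction-free Gaussian elimination: with a nonzero pivot `r j`, every other row is multiplied
    -- by `r j` before a multiple of `r` is subtracted, so the system stays integral in one unknown
    -- fewer. The length `L` is the recursion argument, because the reduced rows are not a sublist.
    eliminate : ∀ {N} (rows : List (Fin N → ℤ)) L → length rows ≡ L → L ℕ.< N →
      ∃ λ c → Nonzero c × All (λ r → r ⊙ c ≡ 0ℤ) rows
    eliminate {suc N} []       _       _ _ = (λ _ → 1ℤ) , (zero , λ ()) , []
    eliminate {suc N} (r ∷ rs) (suc L) e (s≤s l) with Fin.any? (λ j → ¬? (r j ≟ 0ℤ))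
    ... | no all0 with eliminate rs L (ℕ.suc-injective e) (ℕ.m<n⇒m<1+n l)
    ...   | c , nz , h = c , nz , sum-zero _ (λ i → cong (_* c i) (r≡0 i)) ∷ h
      where
      r≡0 : ∀ i → r i ≡ 0ℤ
      r≡0 i with r i ≟ 0ℤ
      ... | yes e = e
      ... | no ¬e = ⊥-elim (all0 (i , ¬e))
    eliminate {suc N} (r ∷ rs) (suc L) e (s≤s l) | yes (j , rj≢0)
      with eliminate (map reduce rs) L (trans (length-map reduce rs) (ℕ.suc-injective e)) l
      where
      reduce : (Fin (suc N) → ℤ) → Fin N → ℤ
      reduce s i = s (punchIn j i) * r j + - (s j * r (punchIn j i))
    ... | c′ , (i , c′i≢0) , h = c , (punchIn j i , nz) , row-r ∷ All.map (λ {s} → row-s s) (All.map⁻ h)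
      where
      r′ : Fin N → ℤ
      r′ = r ∘ punchIn j
      -- Scaling the reduced solution by the pivot allows the pivot row to be solved for coordinate
      -- `j` without division.
      c : Fin (suc N) → ℤ
      c = insertAt (λ i → r j * c′ i) j (- (r′ ⊙ c′))
      expand : ∀ s → s ⊙ c ≡ s j * - (r′ ⊙ c′) + sum (λ i → s (punchIn j i) * (r j * c′ i))
      expand s = trans (sum-remove j (λ i → s i * c i))
        (cong₂ _+_ (cong (s j *_) (insertAt-lookup _ j _))
                   (sum-cong λ i → cong (s (punchIn j i) *_) (insertAt-punchIn _ j _ i)))
      nz : c (punchIn j i) ≢ 0ℤ
      nz e with i*j≡0⇒i≡0∨j≡0 (r j) (trans (sym (insertAt-punchIn _ j _ i)) e)
      ... | inj₁ e₁ = rj≢0 e₁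
      ... | inj₂ e₂ = c′i≢0 e₂
      ring₁ : ∀ a b c → a * (b * c) ≡ b * (a * c)
      ring₁ = solve-∀
      ring₂ : ∀ a b → a * - b + a * b ≡ 0ℤ
      ring₂ = solve-∀
      ring₃ : ∀ s r c t x → (s * r + - (t * x)) * c ≡ s * (r * c) + (- t) * (x * c)
      ring₃ = solve-∀
      ring₄ : ∀ s y z → s * - y + z ≡ z + (- s) * y
      ring₄ = solve-∀
      row-r : r ⊙ c ≡ 0ℤ
      row-r = begin
        r ⊙ c ≡⟨ expand r ⟩
        r j * - (r′ ⊙ c′) + sum (λ i → r′ i * (r j * c′ i))
          ≡⟨ cong (_+_ (r j * - (r′ ⊙ c′))) (trans (sum-cong λ i → ring₁ (r′ i) (r j) (c′ i)) (sum-*ˡ (r j) (λ i → r′ i * c′ i))) ⟩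
        r j * - (r′ ⊙ c′) + r j * (r′ ⊙ c′) ≡⟨ ring₂ (r j) (r′ ⊙ c′) ⟩
        0ℤ ∎
      row-s : ∀ s → sum (λ i → (s (punchIn j i) * r j + - (s j * r′ i)) * c′ i) ≡ 0ℤ → s ⊙ c ≡ 0ℤ
      row-s s e = begin
        s ⊙ c ≡⟨ expand s ⟩
        s j * - (r′ ⊙ c′) + sum (λ i → s (punchIn j i) * (r j * c′ i)) ≡⟨ ring₄ (s j) (r′ ⊙ c′) _ ⟩
        sum (λ i → s (punchIn j i) * (r j * c′ i)) + (- s j) * (r′ ⊙ c′)
          ≡⟨ cong (_+_ (sum (λ i → s (punchIn j i) * (r j * c′ i)))) (sym (sum-*ˡ (- s j) (λ i → r′ i * c′ i))) ⟩
        sum (λ i → s (punchIn j i) * (r j * c′ i)) + sum (λ i → (- s j) * (r′ i * c′ i))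
          ≡⟨ sym (sum-+ (λ i → s (punchIn j i) * (r j * c′ i)) (λ i → (- s j) * (r′ i * c′ i))) ⟩
        sum (λ i → s (punchIn j i) * (r j * c′ i) + (- s j) * (r′ i * c′ i))
          ≡⟨ sum-cong (λ i → sym (ring₃ (s (punchIn j i)) (r j) (c′ i) (s j) (r′ i))) ⟩
        sum (λ i → (s (punchIn j i) * r j + - (s j * r′ i)) * c′ i) ≡⟨ e ⟩
        0ℤ ∎

  underdetermined : ∀ {N} (rows : List (Fin N → ℤ)) → length rows ℕ.< N →
    ∃ λ c → Nonzero c × All (λ r → r ⊙ c ≡ 0ℤ) rows
  underdetermined rows = eliminate rows (length rows) refl

-- Arcs, positions and oriented boundaries of cycles.

module Cycles where

  open import Data.Integer using (_*_; _≤_)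
  open IntegerSums

  module _ {A : Set} where

    zip-proj₁ : ∀ (x : A) xs z → map proj₁ (zip (x ∷ xs) (xs ++ [ z ])) ≡ x ∷ xs
    zip-proj₁ x []       z = refl
    zip-proj₁ x (y ∷ xs) z = cong (_∷_ x) (zip-proj₁ y xs z)

    cycPairs-proj₁ : ∀ (w : List A) → map proj₁ (cycPairs w) ≡ w
    cycPairs-proj₁ []       = refl
    cycPairs-proj₁ (x ∷ xs) = zip-proj₁ x xs x

    length-cycPairs : ∀ (w : List A) → length (cycPairs w) ≡ length w
    length-cycPairs w = trans (sym (length-map proj₁ (cycPairs w))) (cong length (cycPairs-proj₁ w))

    Unique-cycPairs : ∀ {w : List A} → Unique w → Unique (cycPairs w)
    Unique-cycPairs {w} u = Unique.map⁻ (subst Unique (sym (cycPairs-proj₁ w)) u)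

    path-telescope : ∀ (g : A → ℤ) x xs z →
      lsum (λ p → g (proj₁ p) + - g (proj₂ p)) (zip (x ∷ xs) (xs ++ [ z ])) ≡ g x + - g z
    path-telescope g x []       z = +-identityʳ (g x + - g z)
    path-telescope g x (y ∷ xs) z =
      trans (cong (_+_ (g x + - g y)) (path-telescope g y xs z)) (ring (g x) (g y) (g z))
      where
      ring : ∀ a b c → (a + - b) + (b + - c) ≡ a + - c
      ring = solve-∀

    cycle-telescope : ∀ (g : A → ℤ) w → lsum (λ p → g (proj₁ p) + - g (proj₂ p)) (cycPairs w) ≡ 0ℤ
    cycle-telescope g []       = refl
    cycle-telescope g (x ∷ xs) = trans (path-telescope g x xs x) (+-inverseʳ (g x))

  positionFrom : ∀ {n} → ℕ → List (Fin n) → Fin n → ℕ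
  positionFrom k []       u = k
  positionFrom k (x ∷ xs) u = if ⌊ u Fin.≟ x ⌋ then k else positionFrom (suc k) xs u

  positionFrom-here : ∀ {n} k (x : Fin n) xs → positionFrom k (x ∷ xs) x ≡ k
  positionFrom-here k x xs with x Fin.≟ x
  ... | yes _ = refl
  ... | no ¬e = ⊥-elim (¬e refl)

  positionFrom-there : ∀ {n} k (x : Fin n) xs {u} → u ≢ x → positionFrom k (x ∷ xs) u ≡ positionFrom (suc k) xs u
  positionFrom-there k x xs {u} ne with u Fin.≟ x
  ... | yes e = ⊥-elim (ne e)
  ... | no _  = refl

  -- The offset `k` and the end vertex `z` are free so that induction can pass to the tail; for a
  -- cycle they are 0 and the head. The second alternative is the closing arc, which leaves the last
  -- position.
  path-positions : ∀ {n} k (x : Fin n) xs z → Unique (x ∷ xs) →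
    ∀ {u v} → (u , v) ∈ zip (x ∷ xs) (xs ++ [ z ]) → u ∈ x ∷ xs ×
    ((v ∈ xs × positionFrom k (x ∷ xs) v ≡ suc (positionFrom k (x ∷ xs) u)) ⊎
     (v ≡ z × suc (positionFrom k (x ∷ xs) u) ≡ k ℕ.+ length (x ∷ xs)))
  path-positions k x [] z _ (here refl) = here refl , inj₂ (refl , (begin
    suc (positionFrom k (x ∷ []) x) ≡⟨ cong suc (positionFrom-here k x []) ⟩
    suc k                      ≡⟨ ℕ.+-comm 1 k ⟩
    k ℕ.+ 1                    ∎))
  path-positions k x (y ∷ xs) z (x∉ ∷ _) (here refl) = here refl , inj₁ (here refl , (begin
    positionFrom k (x ∷ y ∷ xs) y       ≡⟨ positionFrom-there k x (y ∷ xs) (λ e → All.lookup x∉ (here refl) (sym e)) ⟩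
    positionFrom (suc k) (y ∷ xs) y     ≡⟨ positionFrom-here (suc k) y xs ⟩
    suc k                          ≡⟨ cong suc (sym (positionFrom-here k x (y ∷ xs))) ⟩
    suc (positionFrom k (x ∷ y ∷ xs) x) ∎))
  path-positions k x (y ∷ xs) z (x∉ ∷ uq) {u} {v} (there p) with path-positions (suc k) y xs z uq p
  ... | u∈ , r = there u∈ , [ (λ (v∈ , e) → inj₁ (there v∈ , trans (later (there v∈)) (trans e (cong suc (sym (later u∈)))))) ,
                              (λ (e₁ , e₂) → inj₂ (e₁ , trans (cong suc (later u∈)) (trans e₂ (sym (ℕ.+-suc k _))))) ]′ r
    where
    later : ∀ {t} → t ∈ y ∷ xs → positionFrom k (x ∷ y ∷ xs) t ≡ positionFrom (suc k) (y ∷ xs) t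
    later t∈ = positionFrom-there k x (y ∷ xs) (λ e → All.lookup x∉ t∈ (sym e))

  position : ∀ {n} → List (Fin n) → Fin n → ℕ
  position = positionFrom 0

  cycle-positions : ∀ {n} {w : List (Fin n)} → Unique w → ∀ {u v} → (u , v) ∈ cycPairs w →
    position w v ≡ suc (position w u) ⊎ (position w v ≡ 0 × suc (position w u) ≡ length w)
  cycle-positions {w = x ∷ xs} uq p with path-positions 0 x xs x uq p
  ... | _ , inj₁ (_ , e)       = inj₁ e
  ... | _ , inj₂ (refl , e)    = inj₂ (positionFrom-here 0 x xs , e)

  -- Each arc advances the position by one, cyclically, so going forth and back would force a length
  -- of at most 2.
  no-digon : ∀ {n} {w : List (Fin n)} → Unique w → 3 ℕ.≤ length w →
    ∀ {u v} → (u , v) ∈ cycPairs w → (v , u) ∈ cycPairs w → ⊥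
  no-digon {w = w} uq l {u} {v} p q with cycle-positions uq p | cycle-positions uq q
  ... | inj₁ e         | inj₁ e′         = ℕ.<-irrefl (trans e′ (cong suc e)) (ℕ.m≤n+m (suc (position w u)) 1)
  ... | inj₁ e         | inj₂ (e₁ , e₂)  = ℕ.<-irrefl (trans (sym (cong suc (trans e (cong suc e₁)))) e₂) l
  ... | inj₂ (e₁ , e₂) | inj₁ e          = ℕ.<-irrefl (trans (sym (cong suc (trans e (cong suc e₁)))) e₂) l
  ... | inj₂ (e₁ , e₂) | inj₂ (e₁′ , _)  = ℕ.<-irrefl (trans (sym (cong suc e₁′)) e₂) (ℕ.≤-trans (s≤s (s≤s z≤n)) l)

  sgn : ℕ → ℤ
  sgn zero    = 1ℤ
  sgn (suc k) = - sgn k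

  sgn-even : ∀ {k} → 2 ∣ k → sgn k ≡ 1ℤ
  sgn-even (divides q refl) = even q
    where
    even : ∀ q → sgn (q ℕ.* 2) ≡ 1ℤ
    even zero    = refl
    even (suc q) = trans (neg-involutive (sgn (q ℕ.* 2))) (even q)

  sgn² : ∀ k → sgn k * sgn k ≡ 1ℤ
  sgn² zero    = refl
  sgn² (suc k) = trans (ring (sgn k)) (sgn² k)
    where
    ring : ∀ a → (- a) * (- a) ≡ a * a
    ring = solve-∀

  -- Inside the cycle the position grows by one; at the closing arc it drops from an odd number to
  -- 0, and this is where the even length enters.
  alternating : ∀ {n} {w : List (Fin n)} → Unique w → 2 ∣ length w → ∀ {u v} → (u , v) ∈ cycPairs w →
    sgn (position w v) ≡ - sgn (position w u)
  alternating uq ev p with cycle-positions uq p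
  ... | inj₁ e         = cong sgn e
  ... | inj₂ (e₁ , e₂) = trans (cong sgn e₁) (sym (trans (cong sgn e₂) (sgn-even ev)))

  δ : ∀ {n} → Fin n → Fin n → ℤ
  δ u v = if ⌊ u Fin.≟ v ⌋ then 1ℤ else 0ℤ

  δ-refl : ∀ {n} (u : Fin n) → δ u u ≡ 1ℤ
  δ-refl u with u Fin.≟ u
  ... | yes _ = refl
  ... | no ¬e = ⊥-elim (¬e refl)

  δ-≢ : ∀ {n} {u v : Fin n} → u ≢ v → δ u v ≡ 0ℤ
  δ-≢ {u = u} {v} ne with u Fin.≟ v
  ... | yes e = ⊥-elim (ne e)
  ... | no _  = refl

  sum-δ : ∀ {n} (u : Fin n) (f : Fin n → ℤ) → sum (λ v → δ u v * f v) ≡ f u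
  sum-δ u f = trans (sum-single _ u λ j ne → cong (_* f j) (δ-≢ (ne ∘ sym)))
                    (trans (cong (_* f u) (δ-refl u)) (*-identityˡ (f u)))

  δ² : ∀ {n} → Fin n × Fin n → Fin n → Fin n → ℤ
  δ² p u v = δ (proj₁ p) u * δ (proj₂ p) v

  δ²-refl : ∀ {n} (u v : Fin n) → δ² (u , v) u v ≡ 1ℤ
  δ²-refl u v = cong₂ _*_ (δ-refl u) (δ-refl v)

  δ²-≢ : ∀ {n} {p : Fin n × Fin n} {u v} → p ≢ (u , v) → δ² p u v ≡ 0ℤ
  δ²-≢ {p = a , b} {u} {v} ne with a Fin.≟ u
  ... | no a≢u   = refl
  ... | yes refl = trans (*-identityˡ (δ b v)) (δ-≢ λ { refl → ne refl })

  dsum : ∀ {n} → (Fin n → Fin n → ℤ) → ℤ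
  dsum f = sum λ u → sum λ v → f u v

  dsum-δ² : ∀ {n} p (g : Fin n → Fin n → ℤ) → dsum (λ u v → δ² p u v * g u v) ≡ g (proj₁ p) (proj₂ p)
  dsum-δ² (a , b) g = trans (sum-cong inner) (sum-δ a (λ u → g u b))
    where
    inner : ∀ u → sum (λ v → δ² (a , b) u v * g u v) ≡ δ a u * g u b
    inner u = trans (sum-cong λ v → *-assoc (δ a u) (δ b v) (g u v))
             (trans (sum-*ˡ (δ a u) (λ v → δ b v * g u v)) (cong (_*_ (δ a u)) (sum-δ b (g u))))

  traversals : ∀ {n} → List (Fin n) → Fin n → Fin n → ℤ
  traversals w u v = lsum (λ p → δ² p u v) (cycPairs w)

  module _ {n : ℕ} where

    lsum-δ²-∉ : ∀ {u v : Fin n} xs → (u , v) ∉ xs → lsum (λ p → δ² p u v) xs ≡ 0ℤ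
    lsum-δ²-∉ xs ∉ = lsum-zero xs λ {p} p∈ → δ²-≢ {p = p} λ { refl → ∉ p∈ }

    lsum-δ²-∈ : ∀ {u v : Fin n} {xs} → Unique xs → (u , v) ∈ xs → lsum (λ p → δ² p u v) xs ≡ 1ℤ
    lsum-δ²-∈ {u} {v} {_ ∷ xs} (x∉ ∷ _) (here refl) =
      cong₂ _+_ (δ²-refl u v) (lsum-δ²-∉ xs λ p → All.lookup x∉ p refl)
    lsum-δ²-∈ {u} {v} (x∉ ∷ uq) (there p) =
      cong₂ _+_ (δ²-≢ (All.lookup x∉ p)) (lsum-δ²-∈ uq p)

    -- Carries pairings over all ordered pairs of vertices, the setting of orthogonality, to sums
    -- along one cycle, where telescoping applies.
    dsum-traversals : ∀ w (g : Fin n → Fin n → ℤ) →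
      dsum (λ u v → traversals w u v * g u v) ≡ lsum (λ p → g (proj₁ p) (proj₂ p)) (cycPairs w)
    dsum-traversals w g = go (cycPairs w)
      where
      go : ∀ xs → dsum (λ u v → lsum (λ p → δ² p u v) xs * g u v) ≡ lsum (λ p → g (proj₁ p) (proj₂ p)) xs
      go []       = sum-zero {n} _ λ u → sum-zero {n} _ λ v → refl
      go (p ∷ xs) = begin
        dsum (λ u v → (δ² p u v + lsum (λ p → δ² p u v) xs) * g u v)
          ≡⟨ sum-cong (λ u → trans (sum-cong λ v → *-distribʳ-+ (g u v) (δ² p u v) _)
                                   (sum-+ (λ v → δ² p u v * g u v) _)) ⟩
        sum (λ u → sum (λ v → δ² p u v * g u v) + sum (λ v → lsum (λ p → δ² p u v) xs * g u v))
          ≡⟨ sum-+ (λ u → sum (λ v → δ² p u v * g u v)) _ ⟩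
        dsum (λ u v → δ² p u v * g u v) + dsum (λ u v → lsum (λ p → δ² p u v) xs * g u v)
          ≡⟨ cong₂ _+_ (dsum-δ² p g) (go xs) ⟩
        g (proj₁ p) (proj₂ p) + lsum (λ p → g (proj₁ p) (proj₂ p)) xs ∎

    Uses : List (Fin n) → Fin n → Fin n → Set
    Uses w u v = (u , v) ∈ cycPairs w ⊎ (v , u) ∈ cycPairs w

    _∈?_ : ∀ (p : Fin n × Fin n) xs → Dec (p ∈ xs)
    p ∈? xs = any? (≡-dec Fin._≟_ Fin._≟_ p) xs

    Uses? : ∀ w u v → Dec (Uses w u v)
    Uses? w u v = ((u , v) ∈? cycPairs w) ⊎-dec ((v , u) ∈? cycPairs w)

    usesEdge-true : ∀ u v w → Uses w u v → usesEdge u v w ≡ true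
    usesEdge-true u v w h with any? (λ p → ((proj₁ p Fin.≟ u) ×-dec (proj₂ p Fin.≟ v))
                              ⊎-dec ((proj₁ p Fin.≟ v) ×-dec (proj₂ p Fin.≟ u)))
                         (cycPairs w)
    ... | yes _ = refl
    ... | no ¬p = ⊥-elim (¬p ([ (λ q → lose q (inj₁ (refl , refl))) , (λ q → lose q (inj₂ (refl , refl))) ]′ h))

    usesEdge-false : ∀ u v w → ¬ Uses w u v → usesEdge u v w ≡ false
    usesEdge-false u v w h with any? (λ p → ((proj₁ p Fin.≟ u) ×-dec (proj₂ p Fin.≟ v))
                              ⊎-dec ((proj₁ p Fin.≟ v) ×-dec (proj₂ p Fin.≟ u)))
                         (cycPairs w)
    ... | no _ = refl
    ... | yes a with find a
    ...   | _ , q , inj₁ (refl , refl) = ⊥-elim (h (inj₁ q))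
    ...   | _ , q , inj₂ (refl , refl) = ⊥-elim (h (inj₂ q))

    opaque

      ∂ : List (Fin n) → Fin n → Fin n → ℤ
      ∂ w u v = traversals w u v + - traversals w v u

      ∂-def : ∀ w u v → ∂ w u v ≡ traversals w u v + - traversals w v u
      ∂-def w u v = refl

    ∂-antisym : ∀ w u v → ∂ w v u ≡ - ∂ w u v
    ∂-antisym w u v = trans (∂-def w v u) (trans (ring (traversals w u v) (traversals w v u)) (cong -_ (sym (∂-def w u v))))
      where
      ring : ∀ a b → b + - a ≡ - (a + - b)
      ring = solve-∀

    ∂-unused : ∀ {w u v} → ¬ Uses w u v → ∂ w u v ≡ 0ℤ
    ∂-unused {w} {u} {v} h = trans (∂-def w u v)
      (cong₂ (λ a b → a + - b) (lsum-δ²-∉ (cycPairs w) (h ∘ inj₁)) (lsum-δ²-∉ (cycPairs w) (h ∘ inj₂)))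

    module _ {w : List (Fin n)} (uq : Unique w) (l : 3 ℕ.≤ length w) where

      ∂-forward : ∀ {u v} → (u , v) ∈ cycPairs w → ∂ w u v ≡ 1ℤ
      ∂-forward {u} {v} p = trans (∂-def w u v)
        (cong₂ (λ a b → a + - b) (lsum-δ²-∈ (Unique-cycPairs uq) p) (lsum-δ²-∉ (cycPairs w) (no-digon uq l p)))

      ∂-backward : ∀ {u v} → (v , u) ∈ cycPairs w → ∂ w u v ≡ -1ℤ
      ∂-backward {u} {v} p = trans (∂-antisym w v u) (cong -_ (∂-forward p))

-- Subsets, edge lists and the handshake identity.

module FiniteGraphs where

  open import Data.Integer using (_*_; _≤_)
  open IntegerSums
  open Cycles

  module _ {n : ℕ} {P : Fin n → Set} (P? : ∀ i → Dec (P i)) where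

    -- `Connected` and `link-conn` speak about bit vectors, so a decidable predicate is converted
    -- before it can be propagated.
    subset : Subset n
    subset = Vec.tabulate (λ i → ⌊ P? i ⌋)

    subset⁺ : ∀ {i} → P i → i Subset.∈ subset
    subset⁺ {i} p = Vec.lookup⇒[]= i subset (trans (Vec.lookup∘tabulate (λ i → ⌊ P? i ⌋) i) true!)
      where
      true! : ⌊ P? i ⌋ ≡ true
      true! with P? i
      ... | yes _ = refl
      ... | no ¬p = ⊥-elim (¬p p)

    subset⁻ : ∀ {i} → i Subset.∈ subset → P i
    subset⁻ {i} i∈ with P? i | trans (sym (Vec.lookup∘tabulate (λ i → ⌊ P? i ⌋) i)) (Vec.[]=⇒lookup i∈)
    ... | yes p | _ = p

  -- Made for sums over faces at a fixed edge, where only the two incident faces contribute.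
  sum-pair : ∀ {k} (f : Fin k → ℤ) {i j} → i ≢ j → (∀ l → l ≢ i → l ≢ j → f l ≡ 0ℤ) → sum f ≡ f i + f j
  sum-pair f {i} {j} i≢j h = begin
    sum f                                     ≡⟨ sum-cong split ⟩
    sum (λ l → δ i l * f l + δ j l * f l)     ≡⟨ sum-+ (λ l → δ i l * f l) (λ l → δ j l * f l) ⟩
    sum (λ l → δ i l * f l) + sum (λ l → δ j l * f l) ≡⟨ cong₂ _+_ (sum-δ i f) (sum-δ j f) ⟩
    f i + f j                                 ∎
    where
    split : ∀ l → f l ≡ δ i l * f l + δ j l * f l
    split l with i Fin.≟ l | j Fin.≟ l
    ... | yes refl | yes refl = ⊥-elim (i≢j refl)
    ... | yes refl | no _     = sym (trans (+-identityʳ (1ℤ * f l)) (*-identityˡ (f l)))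
    ... | no _     | yes refl = sym (trans (+-identityˡ (1ℤ * f l)) (*-identityˡ (f l)))
    ... | no a     | no b     = h l (a ∘ sym) (b ∘ sym)

  module _ {A : Set} where

    collect : ∀ {k} → (Fin k → List A) → List A
    collect {zero}  f = []
    collect {suc k} f = f zero ++ collect (f ∘ suc)

    length-collect : ∀ {k} (f : Fin k → List A) → length (collect f) ≡ Σℕ (length ∘ f)
    length-collect {zero}  f = refl
    length-collect {suc k} f = trans (length-++ (f zero)) (cong (length (f zero) ℕ.+_) (length-collect (f ∘ suc)))

    ∈-collect⁺ : ∀ {k} (f : Fin k → List A) i {x} → x ∈ f i → x ∈ collect f
    ∈-collect⁺ f zero    p = ∈-++⁺ˡ p
    ∈-collect⁺ f (suc i) p = ∈-++⁺ʳ (f zero) (∈-collect⁺ (f ∘ suc) i p)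

    ∈-collect⁻ : ∀ {k} (f : Fin k → List A) {x} → x ∈ collect f → ∃ λ i → x ∈ f i
    ∈-collect⁻ {suc k} f p with ∈-++⁻ (f zero) p
    ... | inj₁ q = zero , q
    ... | inj₂ q with ∈-collect⁻ (f ∘ suc) q
    ...   | i , r = suc i , r

  Σℕ-cong : ∀ {k} {f g : Fin k → ℕ} → (∀ i → f i ≡ g i) → Σℕ f ≡ Σℕ g
  Σℕ-cong {zero}  h = refl
  Σℕ-cong {suc k} h = cong₂ ℕ._+_ (h zero) (Σℕ-cong (h ∘ suc))

  sum-Σℕ : ∀ {k} (f : Fin k → ℕ) → sum (λ i → + f i) ≡ + Σℕ f
  sum-Σℕ {zero}  f = refl
  sum-Σℕ {suc k} f = trans (cong (_+_ (+ f zero)) (sum-Σℕ (f ∘ suc))) (sym (pos-+ (f zero) _))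

  module Edges {n : ℕ} (G : Graph n) where

    upEdge : Fin n → Fin n → Bool
    upEdge i j = ⌊ toℕ i ℕ.<? toℕ j ⌋ ∧ adj G i j

    edgesAt : Fin n → Fin n → List (Fin n × Fin n)
    edgesAt i j = if upEdge i j then [ i , j ] else []

    -- One direction per edge, so that the number of edge equations can be compared with Euler's
    -- formula.
    edges : List (Fin n × Fin n)
    edges = collect λ i → collect (edgesAt i)

    length-edges : length edges ≡ edgeCount G
    length-edges = trans (length-collect (λ i → collect (edgesAt i)))
      (Σℕ-cong λ i → trans (length-collect (edgesAt i)) (Σℕ-cong λ j → one (upEdge i j)))
      where
      one : ∀ b {x : Fin n × Fin n} → length (if b then [ x ] else []) ≡ (if b then 1 else 0)
      one true  = refl
      one false = refl

    upEdge⁺ : ∀ {i j} → toℕ i ℕ.< toℕ j → Adj G i j → upEdge i j ≡ true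
    upEdge⁺ {i} {j} l a with toℕ i ℕ.<? toℕ j
    ... | yes _ = a
    ... | no ¬l = ⊥-elim (¬l l)

    edges⁺ : ∀ {i j} → toℕ i ℕ.< toℕ j → Adj G i j → (i , j) ∈ edges
    edges⁺ {i} {j} l a = ∈-collect⁺ (λ i → collect (edgesAt i)) i (∈-collect⁺ (edgesAt i) j single)
      where
      single : (i , j) ∈ edgesAt i j
      single rewrite upEdge⁺ l a = here refl

    edges⁻ : ∀ {i j} → (i , j) ∈ edges → Adj G i j
    edges⁻ p with ∈-collect⁻ (λ i → collect (edgesAt i)) p
    ... | i , q with ∈-collect⁻ (edgesAt i) q
    ...   | j , r with toℕ i ℕ.<? toℕ j | adj G i j in eq | r
    ...     | yes _ | true | here refl = eq

    adj-sym : ∀ {i j} → Adj G i j → Adj G j i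
    adj-sym {i} {j} a = trans (Graph.sym G j i) a

    adj-order : ∀ {i j} → Adj G i j → (toℕ i ℕ.< toℕ j) ⊎ (toℕ j ℕ.< toℕ i)
    adj-order {i} {j} a with ℕ.<-cmp (toℕ i) (toℕ j)
    ... | Bin.tri< l _ _ = inj₁ l
    ... | Bin.tri> _ _ l = inj₂ l
    ... | Bin.tri≈ _ e _ with Fin.toℕ-injective e
    ...   | refl with trans (sym a) (irrefl G i)
    ...     | ()

    bit : Bool → ℤ
    bit b = if b then 1ℤ else 0ℤ

    adj-upEdge : ∀ i j → bit (adj G i j) ≡ bit (upEdge i j) + bit (upEdge j i)
    adj-upEdge i j with adj G i j in e | adj G j i in e′ | toℕ i ℕ.<? toℕ j | toℕ j ℕ.<? toℕ i
    ... | false | false | yes _ | yes _ = refl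
    ... | false | false | yes _ | no _  = refl
    ... | false | false | no _  | yes _ = refl
    ... | false | false | no _  | no _  = refl
    ... | true  | true  | yes l | yes m = ⊥-elim (ℕ.<-asym l m)
    ... | true  | true  | yes _ | no _  = refl
    ... | true  | true  | no _  | yes _ = refl
    ... | true  | true  | no a  | no b  = ⊥-elim ([ a , b ]′ (adj-order e))
    ... | true  | false | _ | _ with trans (sym e) (trans (Graph.sym G i j) e′)
    ...   | ()
    adj-upEdge i j | false | true | _ | _ with trans (sym e) (trans (Graph.sym G i j) e′)
    ...   | ()

    handshake : dsum (λ i j → bit (adj G i j)) ≡ + 2 * + edgeCount G
    handshake = begin
      dsum (λ i j → bit (adj G i j))
        ≡⟨ sum-cong (λ i → trans (sum-cong (adj-upEdge i)) (sum-+ (λ j → bit (upEdge i j)) _)) ⟩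
      sum (λ i → sum (λ j → bit (upEdge i j)) + sum (λ j → bit (upEdge j i)))
        ≡⟨ sum-+ (λ i → sum (λ j → bit (upEdge i j))) _ ⟩
      dsum (λ i j → bit (upEdge i j)) + dsum (λ i j → bit (upEdge j i))
        ≡⟨ cong (_+_ (dsum (λ i j → bit (upEdge i j)))) (sum-comm (λ i j → bit (upEdge j i))) ⟩
      dsum (λ i j → bit (upEdge i j)) + dsum (λ i j → bit (upEdge i j))
        ≡⟨ cong (λ t → t + t) total ⟩
      + edgeCount G + + edgeCount G
        ≡⟨ ring (+ edgeCount G) ⟩
      + 2 * + edgeCount G ∎
      where
      ring : ∀ a → a + a ≡ + 2 * a
      ring = solve-∀
      pos-bit : ∀ b → bit b ≡ + (if b then 1 else 0)
      pos-bit true  = refl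
      pos-bit false = refl
      one : Fin n → Fin n → ℕ
      one i j = if upEdge i j then 1 else 0
      total : dsum (λ i j → bit (upEdge i j)) ≡ + edgeCount G
      total = trans (sum-cong λ i → trans (sum-cong λ j → pos-bit (upEdge i j)) (sum-Σℕ (one i)))
                    (sum-Σℕ (λ i → Σℕ (one i)))

-- Incidences of edges and faces, dual connectedness and bounds from Euler's formula.

module Faces where

  open import Data.Integer using (_*_; _≤_)
  open IntegerSums
  open Cycles
  open FiniteGraphs

  faceCount-zero : ∀ {n} {u v : Fin n} fs → faceCount u v fs ≡ 0 → ∀ i → ¬ Uses (lookup fs i) u v
  faceCount-zero {u = u} {v} (f ∷ fs) e i h with usesEdge u v f in eq | i
  ... | false | suc i = faceCount-zero fs e i h
  ... | false | zero with trans (sym (usesEdge-true u v f h)) eq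
  ...   | ()

  faceCount-one : ∀ {n} {u v : Fin n} fs → faceCount u v fs ≡ 1 →
    ∃ λ j → Uses (lookup fs j) u v × (∀ k → k ≢ j → ¬ Uses (lookup fs k) u v)
  faceCount-one {u = u} {v} (f ∷ fs) e with Uses? f u v
  ... | yes h rewrite usesEdge-true u v f h = zero , h , λ
    { zero    ne → ⊥-elim (ne refl)
    ; (suc k) _  → faceCount-zero fs (ℕ.suc-injective e) k }
  ... | no ¬h rewrite usesEdge-false u v f ¬h with faceCount-one fs e
  ...   | j , uses , only = suc j , uses , λ { zero _ → ¬h ; (suc k) ne → only k (ne ∘ cong suc) }

  -- Faces are addressed by index, since the list may contain the same boundary twice. The index `j`
  -- is the face that a dual walk enters when it leaves `i` across this edge.
  faceCount-two : ∀ {n} {u v : Fin n} fs → faceCount u v fs ≡ 2 → ∀ i → Uses (lookup fs i) u v →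
    ∃ λ j → i ≢ j × Uses (lookup fs j) u v × (∀ k → k ≢ i → k ≢ j → ¬ Uses (lookup fs k) u v)
  faceCount-two {u = u} {v} (f ∷ fs) e i hi with Uses? f u v
  faceCount-two {u = u} {v} (f ∷ fs) e i hi | yes h rewrite usesEdge-true u v f h with faceCount-one fs (ℕ.suc-injective e) | i
  ... | j , uses , only | zero = suc j , (λ ()) , uses , λ
    { zero    ne _ → ⊥-elim (ne refl)
    ; (suc k) _ ne → only k (ne ∘ cong suc) }
  ... | j , uses , only | suc i′ = zero , (λ ()) , h , λ
    { zero    _ ne → ⊥-elim (ne refl)
    ; (suc k) ne _ → λ hk → ⊥-elim (ne (cong suc (trans (is-j k hk) (sym (is-j i′ hi))))) }
    where
    is-j : ∀ k → Uses (lookup fs k) _ _ → k ≡ j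
    is-j k hk with k Fin.≟ j
    ... | yes e = e
    ... | no ne = ⊥-elim (only k ne hk)
  faceCount-two {u = u} {v} (f ∷ fs) e i hi | no ¬h rewrite usesEdge-false u v f ¬h with i
  ... | zero = ⊥-elim (¬h hi)
  ... | suc i′ with faceCount-two fs e i′ hi
  ...   | j , ne , uses , only = suc j , ne ∘ Fin.suc-injective , uses , λ
    { zero    _ _ → ¬h
    ; (suc k) a b → only k (a ∘ cong suc) (b ∘ cong suc) }

  faceCount-suc : ∀ {n} {u v : Fin n} fs {k} → faceCount u v fs ≡ suc k → ∃ λ i → Uses (lookup fs i) u v
  faceCount-suc {u = u} {v} (f ∷ fs) e with Uses? f u v
  ... | yes h = zero , h
  ... | no ¬h rewrite usesEdge-false u v f ¬h with faceCount-suc fs e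
  ...   | i , h = suc i , h

  sum-faceCount : ∀ {n} (u v : Fin n) fs →
    sum (λ i → + (if usesEdge u v (lookup fs i) then 1 else 0)) ≡ + faceCount u v fs
  sum-faceCount u v []       = refl
  sum-faceCount u v (f ∷ fs) = trans (cong (_+_ (+ (if usesEdge u v f then 1 else 0))) (sum-faceCount u v fs))
                                     (sym (pos-+ (if usesEdge u v f then 1 else 0) _))

  module Embedding {n : ℕ} (G : Graph n) (E : EvenFaceEmbeddingPP G) where

    open EvenFaceEmbeddingPP E
    open Edges G

    F : ℕ
    F = length faces

    face : Fin F → List (Fin n)
    face = lookup faces

    module _ (f : Fin F) where

      private
        evenCycle : IsEvenCycle G (face f)
        evenCycle = All.lookup faces-even (∈-lookup f)

      face-unique : Unique (face f)
      face-unique = proj₁ (proj₂ (proj₁ evenCycle))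

      face-long : 3 ℕ.≤ length (face f)
      face-long = proj₁ (proj₁ evenCycle)

      face-even : 2 ∣ length (face f)
      face-even = proj₂ evenCycle

      face-adj : ∀ {u v} → (u , v) ∈ cycPairs (face f) → Adj G u v
      face-adj = All.lookup (proj₂ (proj₂ (proj₁ evenCycle)))

    U : Fin F → Fin n → Fin n → Set
    U f = Uses (face f)

    U-sym : ∀ {f u v} → U f u v → U f v u
    U-sym = Sum.swap

    U-adj : ∀ {f u v} → U f u v → Adj G u v
    U-adj {f} = [ face-adj f , (λ p → adj-sym (face-adj f p)) ]′

    ∂ᶠ : Fin F → Fin n → Fin n → ℤ
    ∂ᶠ f = ∂ (face f)

    ∂ᶠ-forward : ∀ {f u v} → (u , v) ∈ cycPairs (face f) → ∂ᶠ f u v ≡ 1ℤ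
    ∂ᶠ-forward {f} = ∂-forward (face-unique f) (face-long f)

    ∂ᶠ-backward : ∀ {f u v} → (v , u) ∈ cycPairs (face f) → ∂ᶠ f u v ≡ -1ℤ
    ∂ᶠ-backward {f} = ∂-backward (face-unique f) (face-long f)

    opaque

      ∂ᶠ-unit : ∀ {f u v} → U f u v → ∂ᶠ f u v ≡ 1ℤ ⊎ ∂ᶠ f u v ≡ -1ℤ
      ∂ᶠ-unit = Sum.map ∂ᶠ-forward ∂ᶠ-backward

    ∂ᶠ-unused : ∀ {f u v} → ¬ U f u v → ∂ᶠ f u v ≡ 0ℤ
    ∂ᶠ-unused {f} = ∂-unused {w = face f}

    opaque

      other-face : ∀ {u v} f → U f u v →
        ∃ λ g → f ≢ g × U g u v × (∀ k → k ≢ f → k ≢ g → ¬ U k u v)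
      other-face {u} {v} f uses = faceCount-two faces (edge-twice u v (U-adj {f} uses)) f uses

      some-face : ∀ {u v} → Adj G u v → ∃ λ f → U f u v
      some-face {u} {v} a = faceCount-suc faces (edge-twice u v a)

      first-edge : ∀ f → ∃₂ λ u v → (u , v) ∈ cycPairs (face f)
      first-edge f with face f | face-long f
      ... | _ ∷ []    | s≤s ()
      ... | x ∷ y ∷ _ | _ = x , y , here refl

      everywhere-or-nowhere : {P : Fin n → Set} (P? : ∀ i → Dec (P i)) →
        (∀ {i j} → Adj G i j → P i → P j) → (∀ i → P i) ⊎ (∀ i → ¬ P i)
      everywhere-or-nowhere P? closed = Sum.map (λ h i → subset⁻ P? (h i)) (λ h i p → h i (subset⁺ P? p))
        (connected (subset P?) λ i j a i∈ → subset⁺ P? (closed a (subset⁻ P? i∈)))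

      around-vertex : ∀ v {P : Fin n → Set} (P? : ∀ i → Dec (P i)) →
        (∀ f {a b} → (a , v) ∈ cycPairs (face f) → (v , b) ∈ cycPairs (face f) → (P a → P b) × (P b → P a)) →
        (∀ u → Adj G v u → P u) ⊎ (∀ u → Adj G v u → ¬ P u)
      around-vertex v {P} P? closed =
        Sum.map (λ h u a → subset⁻ P? (h u a)) (λ h u a p → h u a (subset⁺ P? p))
          (link-conn v (subset P?)
            (λ a b c p → subset⁺ P? (proj₁ (corner c) (subset⁻ P? p)))
            (λ a b c p → subset⁺ P? (proj₂ (corner c) (subset⁻ P? p))))
        where
        corner : ∀ {a b} → Corner faces v a b → (P a → P b) × (P b → P a)
        corner (f , f∈ , p , q) with Any.index f∈ | Any.lookup-index f∈
        ... | i | refl = closed i p q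

      -- Connectedness of the dual graph. At a vertex, the edges lying on some face in `T` are
      -- closed under passing a corner, so by the connected link they are all or none; this property
      -- of the vertex then spreads along the edges of G.
      all-or-no-faces : {T : Fin F → Set} (T? : ∀ f → Dec (T f)) →
        (∀ {f g u v} → U f u v → U g u v → T f → T g) → (∀ f → T f) ⊎ (∀ f → ¬ T f)
      all-or-no-faces {T} T? shared = Sum.map all none (everywhere-or-nowhere Q? Q-closed)
        where
        P : Fin n → Fin n → Set
        P v u = ∃ λ f → U f v u × T f
        P? : ∀ v u → Dec (P v u)
        P? v u = Fin.any? λ f → Uses? (face f) v u ×-dec T? f
        Q : Fin n → Set
        Q v = ∃ λ u → P v u
        Q? : ∀ v → Dec (Q v)
        Q? v = Fin.any? (P? v)
        spread : ∀ {v} → Q v → ∀ u → Adj G v u → P v u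
        spread {v} (u , f , uses , t) = [ id , (λ no → ⊥-elim (no u (U-adj {f} uses) (f , uses , t))) ]′
          (around-vertex v (P? v)
            (λ g p q → (λ (h , uses , t) → g , inj₁ q , shared {h} {g} uses (inj₂ p) t) ,
                       (λ (h , uses , t) → g , inj₂ p , shared {h} {g} uses (inj₁ q) t)))
        Q-closed : ∀ {i j} → Adj G i j → Q i → Q j
        Q-closed {i} {j} a q with spread q j a
        ... | g , uses , t = i , g , U-sym {g} uses , t
        all : (∀ v → Q v) → ∀ f → T f
        all h f with first-edge f
        ... | u , v , p with spread (h u) v (face-adj f p)
        ...   | g , uses , t = shared {g} {f} uses (inj₁ p) t
        none : (∀ v → ¬ Q v) → ∀ f → ¬ T f
        none h f t with first-edge f
        ... | u , v , p = h u (v , f , inj₁ p , t)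

    face-length≥4 : ∀ f → 4 ℕ.≤ length (face f)
    face-length≥4 f with length (face f) | face-long f | face-even f
    ... | _ | s≤s (s≤s (s≤s (z≤n {suc k}))) | _ = s≤s (s≤s (s≤s (s≤s z≤n)))
    ... | _ | s≤s (s≤s (s≤s (z≤n {zero}))) | divides (suc zero) ()
    ... | _ | s≤s (s≤s (s≤s (z≤n {zero}))) | divides (suc (suc _)) ()

    traversalsᶠ : Fin n → Fin n → ℤ
    traversalsᶠ u v = sum λ f → traversals (face f) u v

    traversed-twice : ∀ u v → traversalsᶠ u v + traversalsᶠ v u ≡ + 2 * bit (adj G u v)
    traversed-twice u v = begin
      traversalsᶠ u v + traversalsᶠ v u
        ≡⟨ sym (sum-+ (λ f → traversals (face f) u v) _) ⟩
      sum (λ f → traversals (face f) u v + traversals (face f) v u)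
        ≡⟨ sum-cong (λ f → once f) ⟩
      sum (λ f → + (if usesEdge u v (face f) then 1 else 0))
        ≡⟨ sum-faceCount u v faces ⟩
      + faceCount u v faces
        ≡⟨ count ⟩
      + 2 * bit (adj G u v) ∎
      where
      once : ∀ f → traversals (face f) u v + traversals (face f) v u ≡ + (if usesEdge u v (face f) then 1 else 0)
      once f with Uses? (face f) u v
      ... | yes h rewrite usesEdge-true u v (face f) h with h
      ...   | inj₁ p = cong₂ _+_ (lsum-δ²-∈ (Unique-cycPairs (face-unique f)) p)
                                 (lsum-δ²-∉ (cycPairs (face f)) (no-digon (face-unique f) (face-long f) p))
      ...   | inj₂ p = cong₂ _+_ (lsum-δ²-∉ (cycPairs (face f)) (no-digon (face-unique f) (face-long f) p))
                                 (lsum-δ²-∈ (Unique-cycPairs (face-unique f)) p)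
      once f | no ¬h rewrite usesEdge-false u v (face f) ¬h =
        cong₂ _+_ (lsum-δ²-∉ (cycPairs (face f)) (¬h ∘ inj₁)) (lsum-δ²-∉ (cycPairs (face f)) (¬h ∘ inj₂))
      no-face : ∀ fs → (∀ i → ¬ Uses (lookup fs i) u v) → faceCount u v fs ≡ 0
      no-face []       h = refl
      no-face (f ∷ fs) h rewrite usesEdge-false u v f (h zero) = no-face fs (h ∘ suc)
      count : + faceCount u v faces ≡ + 2 * bit (adj G u v)
      count with adj G u v in eq
      ... | true  = cong +_ (edge-twice u v eq)
      ... | false = cong +_ (no-face faces λ f h → absurd (trans (sym eq) (U-adj {f} h)))
        where
        absurd : false ≡ true → ⊥
        absurd ()

    -- Double counting of incidences. A traversal sees an edge in one direction only, so both sides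
    -- are doubled and the sum is symmetrised before `edge-twice` applies.
    sum-face-lengths : sum (λ f → + length (face f)) ≡ + 2 * + edgeCount G
    sum-face-lengths = *-cancelˡ-≡ (+ 2) _ _ (begin
      + 2 * sum (λ f → + length (face f))
        ≡⟨ cong (_*_ (+ 2)) (trans (sum-cong (λ f → sym (by-arcs f))) swap-sums) ⟩
      + 2 * dsum traversalsᶠ
        ≡⟨ ring (dsum traversalsᶠ) ⟩
      dsum traversalsᶠ + dsum traversalsᶠ
        ≡⟨ cong (_+_ (dsum traversalsᶠ)) (sum-comm traversalsᶠ) ⟩
      dsum traversalsᶠ + dsum (λ u v → traversalsᶠ v u)
        ≡⟨ sym (trans (sum-cong λ u → sum-+ (traversalsᶠ u) _) (sum-+ (λ u → sum (traversalsᶠ u)) _)) ⟩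
      dsum (λ u v → traversalsᶠ u v + traversalsᶠ v u)
        ≡⟨ sum-cong (λ u → trans (sum-cong (traversed-twice u)) (sum-*ˡ (+ 2) (λ v → bit (adj G u v)))) ⟩
      sum (λ u → + 2 * sum (λ v → bit (adj G u v)))
        ≡⟨ trans (sum-*ˡ (+ 2) (λ u → sum (λ v → bit (adj G u v)))) (cong (_*_ (+ 2)) handshake) ⟩
      + 2 * (+ 2 * + edgeCount G) ∎)
      where
      ring : ∀ a → + 2 * a ≡ a + a
      ring = solve-∀
      lsum-1 : ∀ {A : Set} (xs : List A) → lsum (λ _ → 1ℤ) xs ≡ + length xs
      lsum-1 []       = refl
      lsum-1 (x ∷ xs) = cong (_+_ 1ℤ) (lsum-1 xs)
      by-arcs : ∀ f → dsum (traversals (face f)) ≡ + length (face f)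
      by-arcs f = begin
        dsum (traversals (face f))
          ≡⟨ sum-cong (λ u → sum-cong λ v → sym (*-identityʳ (traversals (face f) u v))) ⟩
        dsum (λ u v → traversals (face f) u v * 1ℤ)
          ≡⟨ dsum-traversals (face f) (λ _ _ → 1ℤ) ⟩
        lsum (λ _ → 1ℤ) (cycPairs (face f))
          ≡⟨ lsum-1 (cycPairs (face f)) ⟩
        + length (cycPairs (face f))
          ≡⟨ cong +_ (length-cycPairs (face f)) ⟩
        + length (face f) ∎
      swap-sums : sum (λ f → dsum (traversals (face f))) ≡ dsum traversalsᶠ
      swap-sums = trans (sum-comm (λ f u → sum (traversals (face f) u)))
                        (sum-cong λ u → sum-comm (λ f → traversals (face f) u))

    4F≤2E : 4 ℕ.* F ℕ.≤ 2 ℕ.* edgeCount G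
    4F≤2E = drop‿+≤+ (subst₂ _≤_ (at-least-4 {F} {λ _ → + 4} (λ _ → refl)) (trans sum-face-lengths (sym (pos-* 2 (edgeCount G))))
                       (sum-mono λ f → +≤+ (face-length≥4 f)))
      where
      sum-mono : ∀ {k} {f g : Fin k → ℤ} → (∀ i → f i ≤ g i) → sum f ≤ sum g
      sum-mono {zero}  h = ≤-refl
      sum-mono {suc k} h = +-mono-≤ (h zero) (sum-mono (h ∘ suc))
      at-least-4 : ∀ {k} {f : Fin k → ℤ} → (∀ i → f i ≡ + 4) → sum f ≡ + (4 ℕ.* k)
      at-least-4 {zero}  h = refl
      at-least-4 {suc k} h = trans (cong₂ _+_ (h zero) (at-least-4 (h ∘ suc))) (cong +_ (sym (ℕ.*-suc 4 k)))

    -- Faces are even and of length at least 3, hence at least 4, so 2|F| ≤ |E| ≤ |E| + 1 = n + |F|.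
    F≤n : F ℕ.≤ n
    F≤n = ℕ.+-cancelʳ-≤ F F n (ℕ.≤-trans (ℕ.*-cancelˡ-≤ 2 double) (ℕ.≤-trans (ℕ.m≤m+n _ 1) (ℕ.≤-reflexive (sym euler))))
      where
      double : 2 ℕ.* (F ℕ.+ F) ℕ.≤ 2 ℕ.* edgeCount G
      double = ℕ.≤-trans (ℕ.≤-reflexive (ring F)) 4F≤2E
        where
        ring : ∀ a → 2 ℕ.* (a ℕ.+ a) ≡ 4 ℕ.* a
        ring a = trans (cong (2 ℕ.*_) (cong (a ℕ.+_) (sym (ℕ.+-identityʳ a)))) (sym (ℕ.*-assoc 2 2 a))

    E≤2n : edgeCount G ℕ.≤ 2 ℕ.* n
    E≤2n = ℕ.≤-trans (ℕ.m≤m+n _ 1) (ℕ.≤-trans (ℕ.≤-reflexive (sym euler))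
             (ℕ.≤-trans (ℕ.+-monoʳ-≤ n F≤n) (ℕ.≤-reflexive (cong (n ℕ.+_) (sym (ℕ.+-identityʳ n))))))

-- Signed boundary and coboundary operators and their orthogonality.

module FaceSpaces where

  open import Data.Integer using (_*_; _≤_)
  open IntegerSums
  open Cycles
  open FiniteGraphs
  open Faces

  module Blocks (F n : ℕ) where

    -- Vectors in three blocks: face coefficients, vertex values and one scalar, which are the
    -- unknowns of the linear system below.
    join³ : (Fin F → ℤ) → (Fin n → ℤ) → ℤ → Fin (F ℕ.+ (n ℕ.+ 1)) → ℤ
    join³ a b e i = [ a , (λ j → [ b , (λ _ → e) ]′ (splitAt n j)) ]′ (splitAt F i)

    part₁ : (Fin (F ℕ.+ (n ℕ.+ 1)) → ℤ) → Fin F → ℤ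
    part₁ z f = z (f ↑ˡ (n ℕ.+ 1))

    part₂ : (Fin (F ℕ.+ (n ℕ.+ 1)) → ℤ) → Fin n → ℤ
    part₂ z v = z (F ↑ʳ (v ↑ˡ 1))

    part₃ : (Fin (F ℕ.+ (n ℕ.+ 1)) → ℤ) → ℤ
    part₃ z = z (F ↑ʳ (n ↑ʳ zero))

    join³-⊙ : ∀ a b e z → join³ a b e ⊙ z ≡ a ⊙ part₁ z + (b ⊙ part₂ z + e * part₃ z)
    join³-⊙ a b e z = begin
      sum g ≡⟨ sum-split F {n ℕ.+ 1} g ⟩
      sum {F} (λ f → g (f ↑ˡ (n ℕ.+ 1))) + sum (λ j → g (F ↑ʳ j))
        ≡⟨ cong₂ _+_ (sum-cong first)
                     (trans (sum-split n (λ j → g (F ↑ʳ j))) (cong₂ _+_ (sum-cong second) third)) ⟩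
      a ⊙ part₁ z + (b ⊙ part₂ z + e * part₃ z) ∎
      where
      g : Fin (F ℕ.+ (n ℕ.+ 1)) → ℤ
      g i = join³ a b e i * z i
      first : ∀ f → g (f ↑ˡ (n ℕ.+ 1)) ≡ a f * part₁ z f
      first f rewrite Fin.splitAt-↑ˡ F f (n ℕ.+ 1) = refl
      second : ∀ v → g (F ↑ʳ (v ↑ˡ 1)) ≡ b v * part₂ z v
      second v rewrite Fin.splitAt-↑ʳ F (n ℕ.+ 1) (v ↑ˡ 1) | Fin.splitAt-↑ˡ n v 1 = refl
      third : g (F ↑ʳ (n ↑ʳ zero)) + 0ℤ ≡ e * part₃ z
      third rewrite Fin.splitAt-↑ʳ F (n ℕ.+ 1) (n ↑ʳ zero) | Fin.splitAt-↑ʳ n 1 zero = +-identityʳ _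

    nonzero-parts : ∀ {z} → Nonzero z → Nonzero (part₁ z) ⊎ Nonzero (part₂ z) ⊎ part₃ z ≢ 0ℤ
    nonzero-parts {z} (i , ne) with splitAt F i in eq
    ... | inj₁ f = inj₁ (f , subst (λ i → z i ≢ 0ℤ) (sym (Fin.splitAt⁻¹-↑ˡ eq)) ne)
    ... | inj₂ j with splitAt n j in eq′
    ...   | inj₁ v = inj₂ (inj₁ (v , subst (λ j → z (F ↑ʳ j) ≢ 0ℤ) (sym (Fin.splitAt⁻¹-↑ˡ eq′)) ne′))
      where
      ne′ = subst (λ i → z i ≢ 0ℤ) (sym (Fin.splitAt⁻¹-↑ʳ eq)) ne
    ...   | inj₂ zero = inj₂ (inj₂ (subst (λ j → z (F ↑ʳ j) ≢ 0ℤ) (sym (Fin.splitAt⁻¹-↑ʳ eq′)) ne′))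
      where
      ne′ = subst (λ i → z i ≢ 0ℤ) (sym (Fin.splitAt⁻¹-↑ʳ eq)) ne

  square≡0 : ∀ a → a * a ≡ 0ℤ → a ≡ 0ℤ
  square≡0 a e = [ id , id ]′ (i*j≡0⇒i≡0∨j≡0 a e)

  module Duality {n : ℕ} (G : Graph n) (E : EvenFaceEmbeddingPP G) where

    open EvenFaceEmbeddingPP E
    open Edges G
    open Embedding G E

    open Blocks F n

    -- τ = -1 gives the ordinary boundary and coboundary operators (with β = 1);
    -- τ = 1 gives the unsigned incidence operator x ↦ x u + x v and, with β
    -- alternating along every face, the alternating face vectors.  The extra
    -- equation l ⊙ x + l₀ * t ≡ 0 is there to exclude trivial solutions.
    module Signed (τ : ℤ) (τ²≡1 : τ * τ ≡ 1ℤ)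
      (β : Fin F → Fin n → ℤ)
      (β-flip : ∀ f {u v} → (u , v) ∈ cycPairs (face f) → β f v ≡ - (τ * β f u))
      (d : Fin n → Fin n → ℤ)
      (d-sym : ∀ u v → d v u ≡ τ * d u v)
      (d-closed : ∀ f → lsum (λ p → β f (proj₁ p) * d (proj₁ p) (proj₂ p)) (cycPairs (face f)) ≡ 0ℤ)
      (l : Fin n → ℤ) (l₀ : ℤ)
      where

      coboundary : (Fin n → ℤ) → Fin n → Fin n → ℤ
      coboundary x u v = x v + τ * x u

      boundary : (Fin F → ℤ) → Fin n → Fin n → ℤ
      boundary c u v = sum λ f → (β f u * ∂ᶠ f u v) * c f

      rowOf : Fin n × Fin n → Fin (F ℕ.+ (n ℕ.+ 1)) → ℤ
      rowOf (u , v) = join³ (λ f → β f u * ∂ᶠ f u v) (λ w → δ v w + τ * δ u w) (d u v)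

      rows : List (Fin (F ℕ.+ (n ℕ.+ 1)) → ℤ)
      rows = join³ (λ _ → 0ℤ) l l₀ ∷ map rowOf edges

      length-rows : length rows ℕ.< F ℕ.+ (n ℕ.+ 1)
      length-rows = ℕ.≤-reflexive (begin
        suc (suc (length (map rowOf edges))) ≡⟨ cong (λ k → suc (suc k)) (trans (length-map rowOf edges) length-edges) ⟩
        suc (suc (edgeCount G))              ≡⟨ cong suc (ℕ.+-comm 1 (edgeCount G)) ⟩
        suc (edgeCount G ℕ.+ 1)              ≡⟨ cong suc (sym euler) ⟩
        suc (n ℕ.+ F)                        ≡⟨ cong suc (ℕ.+-comm n F) ⟩
        suc (F ℕ.+ n)                        ≡⟨ sym (ℕ.+-suc F n) ⟩
        F ℕ.+ suc n                          ≡⟨ cong (F ℕ.+_) (ℕ.+-comm 1 n) ⟩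
        F ℕ.+ (n ℕ.+ 1)                      ∎)

      rowOf-⊙ : ∀ u v z → rowOf (u , v) ⊙ z ≡
        boundary (part₁ z) u v + (coboundary (part₂ z) u v + part₃ z * d u v)
      rowOf-⊙ u v z = trans (join³-⊙ (λ f → β f u * ∂ᶠ f u v) (λ w → δ v w + τ * δ u w) (d u v) z)
        (cong (_+_ (boundary (part₁ z) u v)) (cong₂ _+_ (begin
          sum (λ w → (δ v w + τ * δ u w) * part₂ z w)
            ≡⟨ sum-cong (λ w → ring (δ v w) τ (δ u w) (part₂ z w)) ⟩
          sum (λ w → δ v w * part₂ z w + τ * (δ u w * part₂ z w))
            ≡⟨ sum-+ (λ w → δ v w * part₂ z w) (λ w → τ * (δ u w * part₂ z w)) ⟩
          sum (λ w → δ v w * part₂ z w) + sum (λ w → τ * (δ u w * part₂ z w))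
            ≡⟨ cong₂ _+_ (sum-δ v (part₂ z)) (trans (sum-*ˡ τ (λ w → δ u w * part₂ z w)) (cong (_*_ τ) (sum-δ u (part₂ z)))) ⟩
          coboundary (part₂ z) u v ∎) (*-comm (d u v) (part₃ z))))
        where
        ring : ∀ a t b x → (a + t * b) * x ≡ a * x + t * (b * x)
        ring = solve-∀

      -- Reversing an arc multiplies `β` by - τ and `∂` by -1, so boundaries have the same symmetry
      -- type τ as coboundaries and `d`. Hence one equation per undirected edge determines both
      -- directions.
      boundary-sym : ∀ c u v → boundary c v u ≡ τ * boundary c u v
      boundary-sym c u v = trans (sum-cong λ f → trans (cong (_* c f) (face-sym f)) (*-assoc τ (β f u * ∂ᶠ f u v) (c f)))
                                 (sum-*ˡ τ (λ f → (β f u * ∂ᶠ f u v) * c f))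
        where
        ring₁ : ∀ t b e → (- (t * b)) * (- e) ≡ t * (b * e)
        ring₁ = solve-∀
        ring₂ : ∀ t b e → t * ((- (t * b)) * (- e)) ≡ (t * t) * (b * e)
        ring₂ = solve-∀
        face-sym : ∀ f → β f v * ∂ᶠ f v u ≡ τ * (β f u * ∂ᶠ f u v)
        face-sym f with Uses? (face f) u v
        ... | yes (inj₁ p) = trans (cong₂ _*_ (β-flip f p) (∂-antisym (face f) u v)) (ring₁ τ (β f u) (∂ᶠ f u v))
        ... | yes (inj₂ p) = sym (begin
          τ * (β f u * ∂ᶠ f u v)                ≡⟨ cong (_*_ τ) (cong₂ _*_ (β-flip f p) (∂-antisym (face f) v u)) ⟩
          τ * ((- (τ * β f v)) * (- ∂ᶠ f v u))  ≡⟨ ring₂ τ (β f v) (∂ᶠ f v u) ⟩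
          (τ * τ) * (β f v * ∂ᶠ f v u)          ≡⟨ cong (_* (β f v * ∂ᶠ f v u)) τ²≡1 ⟩
          1ℤ * (β f v * ∂ᶠ f v u)               ≡⟨ *-identityˡ (β f v * ∂ᶠ f v u) ⟩
          β f v * ∂ᶠ f v u                      ∎)
        ... | no h = trans (cong (_*_ (β f v)) (∂ᶠ-unused {f} (h ∘ U-sym {f})))
                    (trans (*-zeroʳ (β f v))
                           (sym (trans (cong (λ e → τ * (β f u * e)) (∂ᶠ-unused {f} h))
                                       (trans (cong (_*_ τ) (*-zeroʳ (β f u))) (*-zeroʳ τ)))))

      -- By symmetry the backward half of the boundary repeats the forward half. Along the face, the
      -- weight `β` turns the coboundary into differences of `τ * (β f u * x u)`, which telescope;
      -- the multiple of `d` vanishes by `d-closed`.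
      orthogonal : ∀ x t f → let b = λ u v → coboundary x u v + t * d u v in
        dsum (λ u v → (β f u * ∂ᶠ f u v) * b u v) ≡ 0ℤ
      orthogonal x t f = begin
        dsum (λ u v → (β f u * ∂ᶠ f u v) * b u v)
          ≡⟨ sum-cong (λ u → trans (sum-cong λ v → trans (cong (λ e → (β f u * e) * b u v) (∂-def (face f) u v)) (ring₁ (β f u) (T u v) (T v u) (b u v)))
                                   (sum-+ (λ v → T u v * h u v) (λ v → -1ℤ * (T v u * h u v)))) ⟩
        sum (λ u → sum (λ v → T u v * h u v) + sum (λ v → -1ℤ * (T v u * h u v)))
          ≡⟨ sum-+ (λ u → sum (λ v → T u v * h u v)) (λ u → sum (λ v → -1ℤ * (T v u * h u v))) ⟩
        dsum (λ u v → T u v * h u v) + dsum (λ u v → -1ℤ * (T v u * h u v))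
          ≡⟨ cong₂ _+_ (dsum-traversals (face f) h) back ⟩
        lsum (λ p → h (proj₁ p) (proj₂ p)) C + lsum (λ p → -1ℤ * h (proj₂ p) (proj₁ p)) C
          ≡⟨ cong (_+_ (lsum (λ p → h (proj₁ p) (proj₂ p)) C)) (lsum-cong C reverse) ⟩
        lsum (λ p → h (proj₁ p) (proj₂ p)) C + lsum (λ p → h (proj₁ p) (proj₂ p)) C
          ≡⟨ cong₂ _+_ closed closed ⟩
        0ℤ ∎
        where
        C : List (Fin n × Fin n)
        C = cycPairs (face f)
        T : Fin n → Fin n → ℤ
        T = traversals (face f)
        b h : Fin n → Fin n → ℤ
        b u v = coboundary x u v + t * d u v
        h u v = β f u * b u v
        ring₁ : ∀ a p q b → (a * (p + - q)) * b ≡ p * (a * b) + -1ℤ * (q * (a * b))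
        ring₁ = solve-∀
        ring₂ : ∀ q a → -1ℤ * (q * a) ≡ q * (-1ℤ * a)
        ring₂ = solve-∀
        ring₃ : ∀ t a p q s d → -1ℤ * ((- (t * a)) * ((q + t * p) + s * (t * d))) ≡ (t * t) * (a * (p + s * d)) + a * (t * q)
        ring₃ = solve-∀
        ring₄ : ∀ a p t q s d → 1ℤ * (a * (p + s * d)) + a * (t * q) ≡ a * ((p + t * q) + s * d)
        ring₄ = solve-∀
        ring₅ : ∀ t a p q s d → a * ((p + t * q) + s * d) ≡ (t * (a * q) + 1ℤ * (a * p)) + s * (a * d)
        ring₅ = solve-∀
        ring₆ : ∀ t a p q e → (t * (a * q) + (t * t) * (a * p)) + e ≡ (t * (a * q) + - (t * ((- (t * a)) * p))) + e
        ring₆ = solve-∀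
        back : dsum (λ u v → -1ℤ * (T v u * h u v)) ≡ lsum (λ p → -1ℤ * h (proj₂ p) (proj₁ p)) C
        back = trans (sum-cong λ u → sum-cong λ v → ring₂ (T v u) (h u v))
              (trans (sum-comm (λ u v → T v u * (-1ℤ * h u v)))
                     (dsum-traversals (face f) (λ u v → -1ℤ * h v u)))
        reverse : ∀ {p} → p ∈ C → -1ℤ * h (proj₂ p) (proj₁ p) ≡ h (proj₁ p) (proj₂ p)
        reverse {u , v} p = begin
          -1ℤ * (β f v * (x u + τ * x v + t * d v u))
            ≡⟨ cong₂ (λ a e → -1ℤ * (a * (x u + τ * x v + t * e))) (β-flip f p) (d-sym u v) ⟩
          -1ℤ * ((- (τ * β f u)) * (x u + τ * x v + t * (τ * d u v)))
            ≡⟨ ring₃ τ (β f u) (x v) (x u) t (d u v) ⟩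
          (τ * τ) * (β f u * (x v + t * d u v)) + β f u * (τ * x u)
            ≡⟨ cong (λ s → s * (β f u * (x v + t * d u v)) + β f u * (τ * x u)) τ²≡1 ⟩
          1ℤ * (β f u * (x v + t * d u v)) + β f u * (τ * x u)
            ≡⟨ ring₄ (β f u) (x v) τ (x u) t (d u v) ⟩
          h u v ∎
        g : Fin n → ℤ
        g u = τ * (β f u * x u)
        telescoping : ∀ {p} → p ∈ C → h (proj₁ p) (proj₂ p) ≡
          (g (proj₁ p) + - g (proj₂ p)) + t * (β f (proj₁ p) * d (proj₁ p) (proj₂ p))
        telescoping {u , v} p = begin
          β f u * (x v + τ * x u + t * d u v)
            ≡⟨ ring₅ τ (β f u) (x v) (x u) t (d u v) ⟩
          (τ * (β f u * x u) + 1ℤ * (β f u * x v)) + t * (β f u * d u v)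
            ≡⟨ cong (λ s → (τ * (β f u * x u) + s * (β f u * x v)) + t * (β f u * d u v)) (sym τ²≡1) ⟩
          (τ * (β f u * x u) + (τ * τ) * (β f u * x v)) + t * (β f u * d u v)
            ≡⟨ ring₆ τ (β f u) (x v) (x u) (t * (β f u * d u v)) ⟩
          (τ * (β f u * x u) + - (τ * ((- (τ * β f u)) * x v))) + t * (β f u * d u v)
            ≡⟨ cong (λ s → (τ * (β f u * x u) + - (τ * (s * x v))) + t * (β f u * d u v)) (sym (β-flip f p)) ⟩
          (g u + - g v) + t * (β f u * d u v) ∎
        closed : lsum (λ p → h (proj₁ p) (proj₂ p)) C ≡ 0ℤ
        closed = begin
          lsum (λ p → h (proj₁ p) (proj₂ p)) C
            ≡⟨ lsum-cong C telescoping ⟩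
          lsum (λ p → (g (proj₁ p) + - g (proj₂ p)) + t * (β f (proj₁ p) * d (proj₁ p) (proj₂ p))) C
            ≡⟨ lsum-+ (λ p → g (proj₁ p) + - g (proj₂ p)) (λ p → t * (β f (proj₁ p) * d (proj₁ p) (proj₂ p))) C ⟩
          lsum (λ p → g (proj₁ p) + - g (proj₂ p)) C + lsum (λ p → t * (β f (proj₁ p) * d (proj₁ p) (proj₂ p))) C
            ≡⟨ cong₂ _+_ (cycle-telescope g (face f))
                         (trans (lsum-*ˡ t (λ p → β f (proj₁ p) * d (proj₁ p) (proj₂ p)) C)
                                (trans (cong (_*_ t) (d-closed f)) (*-zeroʳ t))) ⟩
          0ℤ ∎

      record Solution : Set where
        field
          c : Fin F → ℤ
          x : Fin n → ℤ
          t : ℤ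
          nonzero : Nonzero c ⊎ Nonzero x ⊎ t ≢ 0ℤ
          boundary≡0 : ∀ u v → boundary c u v ≡ 0ℤ
          coboundary≡0 : ∀ {u v} → Adj G u v → coboundary x u v + t * d u v ≡ 0ℤ
          extra : l ⊙ x + l₀ * t ≡ 0ℤ

      opaque

        -- The Euler characteristic leaves one more unknown than there are
        -- equations; the boundary part of a solution is orthogonal to itself.
        solution : Solution
        solution with underdetermined rows length-rows
        ... | z , nz , e₀ ∷ es = record
          { c = c ; x = x ; t = t
          ; nonzero = nonzero-parts nz
          ; boundary≡0 = y≡0
          ; coboundary≡0 = λ {u} {v} a → trans (sym (+-identityˡ (b u v))) (trans (cong (_+ b u v) (sym (y≡0 u v))) (equation a))
          ; extra = trans (sym (trans (cong (_+ (l ⊙ x + l₀ * t)) (sum-zero (λ f → 0ℤ * c f) λ _ → refl)) (+-identityˡ (l ⊙ x + l₀ * t))))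
                          (trans (sym (join³-⊙ (λ _ → 0ℤ) l l₀ z)) e₀)
          }
          where
          c : Fin F → ℤ
          c = part₁ z
          x : Fin n → ℤ
          x = part₂ z
          t : ℤ
          t = part₃ z
          b y : Fin n → Fin n → ℤ
          b u v = coboundary x u v + t * d u v
          y = boundary c
          up : ∀ {u v} → (u , v) ∈ edges → y u v + b u v ≡ 0ℤ
          up {u} {v} p = trans (sym (rowOf-⊙ u v z)) (All.lookup (All.map⁻ es) p)
          ring₁ : ∀ t q p s d → (q + t * p) + s * (t * d) ≡ (t * (1ℤ * p + s * d)) + 1ℤ * q
          ring₁ = solve-∀
          ring₂ : ∀ t p q s d → (t * (1ℤ * p + s * d)) + (t * t) * q ≡ t * ((p + t * q) + s * d)
          ring₂ = solve-∀
          b-sym : ∀ u v → b v u ≡ τ * b u v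
          b-sym u v = begin
            x u + τ * x v + t * d v u                         ≡⟨ cong (λ e → x u + τ * x v + t * e) (d-sym u v) ⟩
            x u + τ * x v + t * (τ * d u v)                   ≡⟨ ring₁ τ (x u) (x v) t (d u v) ⟩
            τ * (1ℤ * x v + t * d u v) + 1ℤ * x u             ≡⟨ cong (λ s → τ * (1ℤ * x v + t * d u v) + s * x u) (sym τ²≡1) ⟩
            τ * (1ℤ * x v + t * d u v) + (τ * τ) * x u        ≡⟨ ring₂ τ (x v) (x u) t (d u v) ⟩
            τ * b u v                                         ∎
          equation : ∀ {u v} → Adj G u v → y u v + b u v ≡ 0ℤ
          equation {u} {v} a with adj-order a
          ... | inj₁ l = up (edges⁺ l a)
          ... | inj₂ l = begin
            y u v + b u v           ≡⟨ cong₂ _+_ (boundary-sym c v u) (b-sym v u) ⟩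
            τ * y v u + τ * b v u   ≡⟨ sym (*-distribˡ-+ τ (y v u) (b v u)) ⟩
            τ * (y v u + b v u)     ≡⟨ cong (_*_ τ) (up (edges⁺ l (adj-sym a))) ⟩
            τ * 0ℤ                  ≡⟨ *-zeroʳ τ ⟩
            0ℤ                      ∎
          -- On an edge the equation gives y = - b. On a non-edge no equation is available, but y
          -- vanishes because no face uses the pair. With y orthogonal to b, the sum of the squares
          -- of y is zero.
          y*b : ∀ u v → y u v * y u v ≡ -1ℤ * (y u v * b u v)
          y*b u v with adj G u v in eq
          ... | true  = trans (cong (_*_ (y u v)) (negate (y u v) (b u v) (equation eq))) (ring (y u v) (b u v))
            where
            ring : ∀ a b → a * - b ≡ -1ℤ * (a * b)
            ring = solve-∀
            negate : ∀ a b → a + b ≡ 0ℤ → a ≡ - b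
            negate a b e = trans (ring′ a b) (trans (cong (_+ - b) e) (+-identityˡ (- b)))
              where
              ring′ : ∀ a b → a ≡ (a + b) + - b
              ring′ = solve-∀
          ... | false = trans (cong (_* y u v) none) (sym (cong (λ s → -1ℤ * (s * b u v)) none))
            where
            absurd : true ≡ false → ⊥
            absurd ()
            none : y u v ≡ 0ℤ
            none = sum-zero _ λ f → cong (_* c f) (trans (cong (_*_ (β f u))
                     (∂ᶠ-unused {f} λ h → absurd (trans (sym (U-adj {f} h)) eq))) (*-zeroʳ (β f u)))
          ring₃ : ∀ a c b → (a * c) * b ≡ c * (a * b)
          ring₃ = solve-∀
          y⊥b : dsum (λ u v → y u v * b u v) ≡ 0ℤ
          y⊥b = begin
            dsum (λ u v → y u v * b u v)
              ≡⟨ sum-cong (λ u → sum-cong λ v → trans (*-comm (y u v) (b u v))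
                   (trans (sym (sum-*ˡ (b u v) (λ f → (β f u * ∂ᶠ f u v) * c f)))
                          (sum-cong λ f → trans (*-comm (b u v) ((β f u * ∂ᶠ f u v) * c f)) (ring₃ (β f u * ∂ᶠ f u v) (c f) (b u v))))) ⟩
            dsum (λ u v → sum (λ f → c f * ((β f u * ∂ᶠ f u v) * b u v)))
              ≡⟨ sum-cong (λ u → sum-comm (λ v f → c f * ((β f u * ∂ᶠ f u v) * b u v))) ⟩
            sum (λ u → sum (λ f → sum (λ v → c f * ((β f u * ∂ᶠ f u v) * b u v))))
              ≡⟨ sum-comm (λ u f → sum (λ v → c f * ((β f u * ∂ᶠ f u v) * b u v))) ⟩
            sum (λ f → dsum (λ u v → c f * ((β f u * ∂ᶠ f u v) * b u v)))
              ≡⟨ sum-cong (λ f → trans (sum-cong λ u → sum-*ˡ (c f) (λ v → (β f u * ∂ᶠ f u v) * b u v))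
                                 (trans (sum-*ˡ (c f) (λ u → sum (λ v → (β f u * ∂ᶠ f u v) * b u v)))
                                 (trans (cong (_*_ (c f)) (orthogonal x t f)) (*-zeroʳ (c f))))) ⟩
            sum {F} (λ _ → 0ℤ)
              ≡⟨ sum-zero {F} (λ _ → 0ℤ) (λ _ → refl) ⟩
            0ℤ ∎
          y² : dsum (λ u v → y u v * y u v) ≡ 0ℤ
          y² = begin
            dsum (λ u v → y u v * y u v)
              ≡⟨ sum-cong (λ u → trans (sum-cong (y*b u)) (sum-*ˡ -1ℤ (λ v → y u v * b u v))) ⟩
            sum (λ u → -1ℤ * sum (λ v → y u v * b u v))
              ≡⟨ sum-*ˡ -1ℤ (λ u → sum (λ v → y u v * b u v)) ⟩
            -1ℤ * dsum (λ u v → y u v * b u v)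
              ≡⟨ cong (_*_ -1ℤ) y⊥b ⟩
            0ℤ ∎
          y≡0 : ∀ u v → y u v ≡ 0ℤ
          y≡0 u v = square≡0 (y u v)
            (sum-nonneg≡0 (λ v → y u v * y u v) (λ v → i*i≥0 (y u v))
              (sum-nonneg≡0 (λ u → sum (λ v → y u v * y u v)) (λ u → sum≥0 _ λ v → i*i≥0 (y u v)) y² u) v)

-- Parity and integer division.

module ParityAndFloor where

  open import Data.Integer using (_*_; _≤_)
  open IntegerSums

  Even Odd : ℤ → Set
  Even a = ∃ λ k → a ≡ + 2 * k
  Odd a = ∃ λ k → a ≡ 1ℤ + + 2 * k

  opaque

    parity : ∀ a → Even a ⊎ Odd a
    parity a with a %ℕ 2 | n%ℕd<d a 2 | a≡a%ℕn+[a/ℕn]*n a 2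
    ... | 0           | _             | e = inj₁ (a /ℕ 2 , trans e (trans (+-identityˡ _) (*-comm (a /ℕ 2) (+ 2))))
    ... | 1           | _             | e = inj₂ (a /ℕ 2 , trans e (cong (_+_ 1ℤ) (*-comm (a /ℕ 2) (+ 2))))
    ... | suc (suc _) | s≤s (s≤s ())  | _

  even-odd : ∀ {a} → Even a → Odd a → ⊥
  even-odd (k , e) (l , e′) = 2∤1 (k + - l) (trans (ring k l) (trans (cong (_+ - (+ 2 * l)) (trans (sym e) e′)) (ring′ l)))
    where
    ring : ∀ k l → + 2 * (k + - l) ≡ + 2 * k + - (+ 2 * l)
    ring = solve-∀
    ring′ : ∀ l → 1ℤ + + 2 * l + - (+ 2 * l) ≡ 1ℤ
    ring′ = solve-∀
    2∤1 : ∀ m → + 2 * m ≡ 1ℤ → ⊥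
    2∤1 m e with ∣ m ∣ | trans (sym (abs-* (+ 2) m)) (cong ∣_∣ e)
    ... | zero  | ()
    ... | suc k | e′ = ℕ.1+n≢0 (ℕ.suc-injective (trans (sym (cong suc (ℕ.+-suc k (k ℕ.+ 0)))) e′))

  even? : ∀ a → Dec (Even a)
  even? a with parity a
  ... | inj₁ e = yes e
  ... | inj₂ o = no λ e → even-odd e o

  odd+odd : ∀ {a b} → Odd a → Odd b → Even (a + b)
  odd+odd (k , refl) (l , refl) = 1ℤ + k + l , ring k l
    where
    ring : ∀ k l → 1ℤ + + 2 * k + (1ℤ + + 2 * l) ≡ + 2 * (1ℤ + k + l)
    ring = solve-∀

  even+odd : ∀ {a b} → Even a → Odd b → Odd (a + b)
  even+odd (k , refl) (l , refl) = k + l , ring k l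
    where
    ring : ∀ k l → + 2 * k + (1ℤ + + 2 * l) ≡ 1ℤ + + 2 * (k + l)
    ring = solve-∀

  even+even : ∀ {a b} → Even a → Even b → Even (a + b)
  even+even (k , refl) (l , refl) = k + l , sym (*-distribˡ-+ (+ 2) k l)

  i<1+j⇒i≤j : ∀ {i j} → i < 1ℤ + j → i ≤ j
  i<1+j⇒i≤j {i} {j} l = subst₂ _≤_ (ring i) (ring j) (+-monoʳ-≤ -1ℤ (i<j⇒suc[i]≤j l))
    where
    ring : ∀ i → -1ℤ + (1ℤ + i) ≡ i
    ring = solve-∀

  module Floor (t : ℕ) {{_ : ℕ.NonZero t}} where

    -- The integer part of a / t, for a numerator over the fixed denominator t.
    floor : ℤ → ℤ
    floor a = a /ℕ t

    instance
      t>0 : Positive (+ t)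
      t>0 = positive (+<+ (ℕ.>-nonZero⁻¹ t))

    floor-≤ : ∀ {a q} → a < (1ℤ + q) * + t → floor a ≤ q
    floor-≤ {a} {q} l = i<1+j⇒i≤j (*-cancelʳ-<-nonNeg {floor a} {1ℤ + q} (+ t) (≤-<-trans ([n/ℕd]*d≤n a t) l))

    floor-≥ : ∀ {a q} → q * + t ≤ a → q ≤ floor a
    floor-≥ {a} {q} l = i<1+j⇒i≤j (*-cancelʳ-<-nonNeg {q} {1ℤ + floor a} (+ t) (≤-<-trans l (n<s[n/ℕd]*d a t)))

    floor-mono : ∀ {a b} → a ≤ b → floor a ≤ floor b
    floor-mono {a} l = floor-≥ (≤-trans ([n/ℕd]*d≤n a t) l)

    floor-shift : ∀ a q → floor (a + q * + t) ≡ floor a + q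
    floor-shift a q = ≤-antisym
      (floor-≤ (subst (a + q * + t <_) (ring (floor a) q (+ t)) (+-monoˡ-< (q * + t) (n<s[n/ℕd]*d a t))))
      (floor-≥ (subst (_≤ a + q * + t) (sym (*-distribʳ-+ (+ t) (floor a) q)) (+-monoˡ-≤ (q * + t) ([n/ℕd]*d≤n a t))))
      where
      ring : ∀ f q t → (1ℤ + f) * t + q * t ≡ (1ℤ + (f + q)) * t
      ring = solve-∀

-- Non-orientability and the vanishing of the rational first cohomology.

module Orientations where

  open import Data.Integer using (_*_; _≤_)
  open IntegerSums
  open Cycles
  open FiniteGraphs
  open Faces
  open FaceSpaces
  open ParityAndFloor

  Bipartition : ∀ {n} → Graph n → (Fin n → Set) → Set
  Bipartition G P = ∀ {u v} → Adj G u v → (P u → ¬ P v) × (¬ P u → P v)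

  NonBipartite : ∀ {n} → Graph n → Set₁
  NonBipartite {n} G = ∀ {P : Fin n → Set} → (∀ v → Dec (P v)) → ¬ Bipartition G P

  _*-≢0_ : ∀ {a b} → a ≢ 0ℤ → b ≢ 0ℤ → a * b ≢ 0ℤ
  _*-≢0_ {a} a≢0 b≢0 e = [ a≢0 , b≢0 ]′ (i*j≡0⇒i≡0∨j≡0 a e)

  _-≢0 : ∀ {a} → a ≢ 0ℤ → - a ≢ 0ℤ
  _-≢0 {a} h e = h (trans (sym (neg-involutive a)) (cong -_ e))

  sum≡0⇒≡- : ∀ {a b} → a + b ≡ 0ℤ → b ≡ - a
  sum≡0⇒≡- {a} {b} e = trans (ring a b) (trans (cong (_+_ (- a)) e) (+-identityʳ (- a)))
    where
    ring : ∀ a b → b ≡ - a + (a + b)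
    ring = solve-∀

  positive-neg : ∀ {a} → a ≢ 0ℤ → ¬ (0ℤ < a) → 0ℤ < - a
  positive-neg {+ zero}   ne _ = ⊥-elim (ne refl)
  positive-neg {+ suc n}  _ h  = ⊥-elim (h (+<+ (s≤s z≤n)))
  positive-neg { -[1+ n ]} _ _ = +<+ (s≤s z≤n)

  ¬positive-neg : ∀ {a} → 0ℤ < a → ¬ (0ℤ < - a)
  ¬positive-neg {+ suc n} _ ()
  ¬positive-neg {+ zero}  _ (+<+ ())

  -- At an edge the second face has the opposite term in each of two relations, so its product
  -- equals that of the first face. The traversal sign `d` enters squared, which makes the result
  -- independent of how the face is oriented.
  paired-products : ∀ a d p q {x y x′ y′} → x ≡ (a * d) * p → y ≡ (1ℤ * d) * q →
    x′ ≡ - x → y′ ≡ - y → d * d ≡ 1ℤ → x * y + x′ * y′ ≡ + 2 * (a * (p * q))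
  paired-products a d p q refl refl refl refl d² =
    trans (ring a d p q) (trans (cong (_* (+ 2 * (a * (p * q)))) d²) (*-identityˡ (+ 2 * (a * (p * q)))))
    where
    ring : ∀ a d p q → ((a * d) * p) * ((1ℤ * d) * q) + (- ((a * d) * p)) * (- ((1ℤ * d) * q))
      ≡ (d * d) * (+ 2 * (a * (p * q)))
    ring = solve-∀

  module NonBipartiteEmbedding {n : ℕ} (G : Graph n) (E : EvenFaceEmbeddingPP G) (nb : NonBipartite G) where

    open EvenFaceEmbeddingPP E
    open Edges G
    open Embedding G E
    open Duality G E

    opaque

      -- On the boundary of `f` this is the 2-colouring that the even length provides; off the
      -- boundary the value is still a unit.
      α : Fin F → Fin n → ℤ
      α f u = sgn (position (face f) u)

      α-flip : ∀ f {u v} → (u , v) ∈ cycPairs (face f) → α f v ≡ - α f u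
      α-flip f = alternating (face-unique f) (face-even f)

      α-unit : ∀ f u → α f u * α f u ≡ 1ℤ
      α-unit f u = sgn² (position (face f) u)

    α-≢0 : ∀ f u → α f u ≢ 0ℤ
    α-≢0 f u e with trans (sym (α-unit f u)) (cong (_* α f u) e)
    ... | ()

    opaque

      α-U : ∀ f {u v} → U f u v → α f v ≡ - α f u
      α-U f (inj₁ p) = α-flip f p
      α-U f (inj₂ p) = trans (sym (neg-involutive _)) (cong -_ (sym (α-flip f p)))

      ∂ᶠ² : ∀ f {u v} → U f u v → ∂ᶠ f u v * ∂ᶠ f u v ≡ 1ℤ
      ∂ᶠ² f h with ∂ᶠ-unit {f} h
      ... | inj₁ e = cong₂ _*_ e e
      ... | inj₂ e = cong₂ _*_ e e

      ∂ᶠ-≢0 : ∀ f {u v} → U f u v → ∂ᶠ f u v ≢ 0ℤ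
      ∂ᶠ-≢0 f {u} {v} h e with trans (sym (∂ᶠ² f h)) (cong (_* ∂ᶠ f u v) e)
      ... | ()

    one : Fin F → Fin n → ℤ
    one _ _ = 1ℤ

    one-≢0 : ∀ f u → one f u ≢ 0ℤ
    one-≢0 _ _ ()

    module Relation (β : Fin F → Fin n → ℤ) (β-≢0 : ∀ f u → β f u ≢ 0ℤ)
      (c : Fin F → ℤ) (relation : ∀ u v → sum (λ f → (β f u * ∂ᶠ f u v) * c f) ≡ 0ℤ) where

      opaque

        term : Fin n → Fin n → Fin F → ℤ
        term u v f = (β f u * ∂ᶠ f u v) * c f

        term-def : ∀ u v f → term u v f ≡ (β f u * ∂ᶠ f u v) * c f
        term-def u v f = refl

      term-unused : ∀ {u v} f → ¬ U f u v → term u v f ≡ 0ℤ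
      term-unused {u} {v} f h = trans (term-def u v f)
        (cong (_* c f) (trans (cong (_*_ (β f u)) (∂ᶠ-unused {f} h)) (*-zeroʳ (β f u))))

      opposite : ∀ {u v f g} → f ≢ g → (∀ k → k ≢ f → k ≢ g → ¬ U k u v) → term u v g ≡ - term u v f
      opposite {u} {v} {f} {g} ne only = sum≡0⇒≡- {term u v f} {term u v g}
        (trans (sym (sum-pair (term u v) ne λ k a b → term-unused k (only k a b)))
               (trans (sum-cong (term-def u v)) (relation u v)))

      -- The relation has only two terms at an edge; they are opposite, and the factors in front of
      -- the coefficients are nonzero. By dual connectedness the coefficients therefore vanish
      -- everywhere or nowhere.
      nonzero-shared : ∀ {f g u v} → U f u v → U g u v → c f ≢ 0ℤ → c g ≢ 0ℤ
      nonzero-shared {f} {g} {u} {v} hf hg ne e with f Fin.≟ g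
      ... | yes refl = ne e
      ... | no f≢g with other-face f hf
      ...   | g′ , f≢g′ , _ , only with g Fin.≟ g′
      ...     | no g≢g′ = only g (f≢g ∘ sym) g≢g′ hg
      ...     | yes refl = _-≢0 {term u v f} term≢0
        (trans (sym (opposite f≢g only)) (trans (term-def u v g)
          (trans (cong (_*_ (β g u * ∂ᶠ g u v)) e) (*-zeroʳ (β g u * ∂ᶠ g u v)))))
        where
        term≢0 : term u v f ≢ 0ℤ
        term≢0 e = _*-≢0_ {β f u * ∂ᶠ f u v} (_*-≢0_ {β f u} (β-≢0 f u) (∂ᶠ-≢0 f hf)) ne (trans (sym (term-def u v f)) e)

      opaque

        all-or-none : (∀ f → c f ≢ 0ℤ) ⊎ (∀ f → c f ≡ 0ℤ)
        all-or-none = Sum.map₂ (λ h f → decidable-stable (c f ≟ 0ℤ) (h f))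
          (all-or-no-faces {T = λ f → c f ≢ 0ℤ} (λ f → ¬? (c f ≟ 0ℤ)) (λ {f} {g} → nonzero-shared {f} {g}))

    private
      module Alternating = Signed 1ℤ refl α
        (λ f p → trans (α-flip f p) (cong -_ (sym (*-identityˡ _))))
        (λ _ _ → 0ℤ) (λ _ _ → refl)
        (λ f → lsum-zero (cycPairs (face f)) λ {p} _ → *-zeroʳ (α f (proj₁ p)))
        -- The extra equation reads t = 0; with `d` zero the scalar would otherwise be
        -- unconstrained.
        (λ _ → 0ℤ) 1ℤ

    opaque

      -- In a nonzero solution of the unsigned system the vertex part satisfies x v = - x u on
      -- edges. If it were not zero, it would be nonzero everywhere and its sign would 2-colour the
      -- graph. So the face part is nonzero, and then nowhere zero.
      alternating-relation : ∃ λ (c : Fin F → ℤ) → (∀ f → c f ≢ 0ℤ) × (∀ u v → sum (λ f → (α f u * ∂ᶠ f u v) * c f) ≡ 0ℤ)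
      alternating-relation = c , nowhere-zero , boundary≡0
        where
        open Alternating.Solution Alternating.solution
        t≡0 : t ≡ 0ℤ
        t≡0 = trans (sym (*-identityˡ t)) (trans (sym (+-identityˡ (1ℤ * t)))
                (trans (cong (_+ 1ℤ * t) (sym (sum-zero (λ v → 0ℤ * x v) λ _ → refl))) extra))
        opposite : ∀ {u v} → Adj G u v → x v ≡ - x u
        opposite {u} {v} a = sum≡0⇒≡- {x u} (trans (ring (x u) (x v) t) (coboundary≡0 a))
          where
          ring : ∀ a b t → a + b ≡ b + 1ℤ * a + t * 0ℤ
          ring = solve-∀
        nowhere-zero-x : (∀ v → x v ≢ 0ℤ) → ⊥
        nowhere-zero-x ne = nb {P = λ v → 0ℤ < x v} (λ v → 0ℤ <? x v) λ {u} {v} a →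
          (λ p q → ¬positive-neg p (subst (0ℤ <_) (opposite a) q)) ,
          (λ h → subst (0ℤ <_) (sym (opposite a)) (positive-neg (ne u) h))
        x≡0 : ∀ v → x v ≡ 0ℤ
        x≡0 v = decidable-stable (x v ≟ 0ℤ) ([ ⊥-elim ∘ nowhere-zero-x , (λ h → h v) ]′
          (everywhere-or-nowhere {P = λ v → x v ≢ 0ℤ} (λ v → ¬? (x v ≟ 0ℤ))
            (λ {i} a ne e → _-≢0 {x i} ne (trans (sym (opposite a)) e))))
        nowhere-zero : ∀ f → c f ≢ 0ℤ
        nowhere-zero with Relation.all-or-none α α-≢0 c boundary≡0 | nonzero
        ... | inj₁ h | _                    = h
        ... | inj₂ h | inj₁ (f , ne)        = ⊥-elim (ne (h f))
        ... | inj₂ _ | inj₂ (inj₁ (v , ne)) = ⊥-elim (ne (x≡0 v))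
        ... | inj₂ _ | inj₂ (inj₂ ne)       = ⊥-elim (ne t≡0)

    opaque

      -- An alternating and an orienting relation between the faces together
      -- determine a rotation direction at every vertex, which changes along edges.
      no-orientation : ∀ (c : Fin F → ℤ) → (∀ u v → sum (λ f → (1ℤ * ∂ᶠ f u v) * c f) ≡ 0ℤ) → ∀ f → c f ≡ 0ℤ
      no-orientation c relation with Relation.all-or-none one one-≢0 c relation | alternating-relation
      ... | inj₂ zeros   | _ = zeros
      ... | inj₁ nonzero | c′ , nonzero′ , relation′ = ⊥-elim (nb {P = Q} Q? bipartition)
        where
        module R = Relation one one-≢0 c relation
        module A = Relation α α-≢0 c′ relation′
        -- The two faces at the edge contribute equally, so the value is
        -- `2 * (α f v * (c′ f * c f))` for either of them. Consecutive edges at v share a face,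
        -- which makes ψ v u the same for all neighbours u; exchanging v and u flips the sign of
        -- `α`.
        ψ : Fin n → Fin n → ℤ
        ψ v u = sum λ f → A.term v u f * R.term v u f
        ψ-pair : ∀ {v u} f g → U f v u → f ≢ g → (∀ k → k ≢ f → k ≢ g → ¬ U k v u) →
          ψ v u ≡ + 2 * (α f v * (c′ f * c f))
        ψ-pair {v} {u} f g h f≢g only = trans
          (sum-pair (λ f → A.term v u f * R.term v u f) f≢g
            (λ k a b → cong (_* R.term v u k) (A.term-unused k (only k a b))))
          (paired-products (α f v) (∂ᶠ f v u) (c′ f) (c f)
            {A.term v u f} {R.term v u f} {A.term v u g} {R.term v u g}
            (A.term-def v u f) (R.term-def v u f) (A.opposite f≢g only) (R.opposite f≢g only) (∂ᶠ² f h))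
        ψ-value : ∀ {f v u} → U f v u → ψ v u ≡ + 2 * (α f v * (c′ f * c f))
        ψ-value {f} h with other-face f h
        ... | g , f≢g , _ , only = ψ-pair f g h f≢g only
        ψ-flip : ∀ {v u} → Adj G v u → ψ u v ≡ - ψ v u
        ψ-flip {v} {u} a with some-face a
        ... | f , h = begin
          ψ u v                              ≡⟨ ψ-value {f} (U-sym {f} h) ⟩
          + 2 * (α f u * (c′ f * c f))       ≡⟨ cong (λ s → + 2 * (s * (c′ f * c f))) (α-U f h) ⟩
          + 2 * (- α f v * (c′ f * c f))     ≡⟨ ring (α f v) (c′ f * c f) ⟩
          - (+ 2 * (α f v * (c′ f * c f)))   ≡⟨ cong -_ (sym (ψ-value {f} h)) ⟩
          - ψ v u                            ∎
          where
          ring : ∀ a b → + 2 * (- a * b) ≡ - (+ 2 * (a * b))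
          ring = solve-∀
        ψ-≢0 : ∀ {v u} → Adj G v u → ψ v u ≢ 0ℤ
        ψ-≢0 {v} a e with some-face a
        ... | f , h = _*-≢0_ {+ 2} (λ ()) (_*-≢0_ {α f v} (α-≢0 f v) (_*-≢0_ {c′ f} (nonzero′ f) (nonzero f)))
                        (trans (sym (ψ-value {f} h)) e)
        ψ-corner : ∀ f {v a b} → (a , v) ∈ cycPairs (face f) → (v , b) ∈ cycPairs (face f) → ψ v a ≡ ψ v b
        ψ-corner f {v} p q = trans (ψ-value {f} {v} (inj₂ p)) (sym (ψ-value {f} {v} (inj₁ q)))
        one-direction : ∀ v → (∀ u → Adj G v u → 0ℤ < ψ v u) ⊎ (∀ u → Adj G v u → ¬ (0ℤ < ψ v u))
        one-direction v = around-vertex v (λ u → 0ℤ <? ψ v u) λ f p q →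
          subst (0ℤ <_) (ψ-corner f p q) , subst (0ℤ <_) (sym (ψ-corner f p q))
        Q : Fin n → Set
        Q v = ∃ λ u → Adj G v u × 0ℤ < ψ v u
        Q? : ∀ v → Dec (Q v)
        Q? v = Fin.any? λ u → (adj G v u Bool.≟ true) ×-dec (0ℤ <? ψ v u)
        bipartition : Bipartition G Q
        bipartition {u} {v} a = first , second
          where
          first : Q u → ¬ Q v
          first (w , b , p) (w′ , b′ , p′) =
            [ (λ h → [ (λ h′ → ¬positive-neg (h v a) (subst (0ℤ <_) (ψ-flip a) (h′ u (adj-sym a)))) ,
                       (λ h′ → h′ w′ b′ p′) ]′ (one-direction v)) ,
              (λ h → h w b p) ]′ (one-direction u)
          second : ¬ Q u → Q v
          second h = u , adj-sym a ,
            subst (0ℤ <_) (sym (ψ-flip a)) (positive-neg (ψ-≢0 a) (λ p → h (v , a , p)))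

    faceSum : Fin F → (Fin n → Fin n → ℤ) → ℤ
    faceSum f D = lsum (λ p → D (proj₁ p) (proj₂ p)) (cycPairs (face f))

    Antisymmetric : (Fin n → Fin n → ℤ) → Set
    Antisymmetric D = ∀ u v → D v u ≡ - D u v

    opaque

      a-vertex : Fin n
      a-vertex with Fin.any? {n} (λ v → yes tt)
      ... | yes (v , _) = v
      ... | no h = ⊥-elim (nb {P = λ _ → ⊥} (λ _ → no λ ()) λ {u} _ → ⊥-elim (h (u , tt)))

    opaque

      -- `D` is adjoined to the system as the column of the scalar t. The extra equation pins x to 0
      -- at `a-vertex`, excluding constant potentials; so if t were zero, x would vanish by
      -- connectedness and the face part by `no-orientation`.
      closed⇒coboundary : ∀ D → Antisymmetric D → (∀ f → faceSum f D ≡ 0ℤ) →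
        ∃₂ λ (t : ℤ) (X : Fin n → ℤ) → t ≢ 0ℤ × (∀ {u v} → Adj G u v → t * D u v ≡ X v + - X u)
      closed⇒coboundary D anti closed = t , (λ v → - x v) , t≢0 , λ {u} {v} a →
        trans (sum≡0⇒≡- {x v + -1ℤ * x u} (coboundary≡0 a)) (ring (x v) (x u))
        where
        ring : ∀ a b → - (a + -1ℤ * b) ≡ - a + - (- b)
        ring = solve-∀
        neg-1 : ∀ a → -1ℤ * a ≡ - a
        neg-1 = solve-∀
        module S = Signed -1ℤ refl (λ _ _ → 1ℤ) (λ _ _ → refl) D
          (λ u v → trans (anti u v) (sym (neg-1 (D u v))))
          (λ f → trans (lsum-cong (cycPairs (face f)) λ {p} _ → *-identityˡ (D (proj₁ p) (proj₂ p))) (closed f))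
          (δ a-vertex) 0ℤ
        open S.Solution S.solution
        x₀ : x a-vertex ≡ 0ℤ
        x₀ = trans (sym (sum-δ a-vertex x)) (trans (sym (+-identityʳ _)) extra)
        t≢0 : t ≢ 0ℤ
        t≢0 t≡0 with nonzero
        ... | inj₁ (f , ne)        = ne (no-orientation c boundary≡0 f)
        ... | inj₂ (inj₂ ne)       = ne t≡0
        ... | inj₂ (inj₁ (v , ne)) = ne (constant v)
          where
          spread : ∀ {u v} → Adj G u v → x u ≡ 0ℤ → x v ≡ 0ℤ
          spread {u} {v} a e = trans (ring′ (x v)) (trans
            (cong₂ (λ y t → x v + -1ℤ * y + t * D u v) (sym e) (sym t≡0)) (coboundary≡0 a))
            where
            ring′ : ∀ a → a ≡ a + 0ℤ + 0ℤ
            ring′ = solve-∀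
          constant : ∀ v → x v ≡ 0ℤ
          constant = [ id , (λ h → ⊥-elim (h a-vertex x₀)) ]′
            (everywhere-or-nowhere {P = λ v → x v ≡ 0ℤ} (λ v → x v ≟ 0ℤ) spread)

    opaque

      closed⇒coboundary⁺ : ∀ D → Antisymmetric D → (∀ f → faceSum f D ≡ 0ℤ) →
        ∃₂ λ (t : ℕ) (X : Fin n → ℤ) → (∀ {u v} → Adj G u v → + suc t * D u v ≡ X v + - X u)
      closed⇒coboundary⁺ D anti closed with closed⇒coboundary D anti closed
      ... | + zero   , _ , ne , _ = ⊥-elim (ne refl)
      ... | + suc t  , X , _ , h  = t , X , h
      ... | -[1+ t ] , X , _ , h  = t , (λ v → - X v) , λ {u} {v} a → begin
        + suc t * D u v       ≡⟨ ring₁ (+ suc t) (D u v) ⟩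
        - (-[1+ t ] * D u v)  ≡⟨ cong -_ (h a) ⟩
        - (X v + - X u)       ≡⟨ ring₂ (X v) (X u) ⟩
        - X v + - - X u       ∎
        where
        ring₁ : ∀ t d → t * d ≡ - ((- t) * d)
        ring₁ = solve-∀
        ring₂ : ∀ a b → - (a + - b) ≡ - a + - - b
        ring₂ = solve-∀

    opaque

      -- A potential X grows along an edge by `suc t` times `D u v`, so the integer part of X /
      -- `suc t` grows by exactly the odd number `D u v`. Its parity would be a 2-colouring.
      odd-not-closed : ∀ D → Antisymmetric D → (∀ {u v} → Adj G u v → Odd (D u v)) → ¬ (∀ f → faceSum f D ≡ 0ℤ)
      odd-not-closed D anti odd closed with closed⇒coboundary⁺ D anti closed
      ... | t , X , h = nb {P = λ v → Even (floor (X v))} (λ v → even? (floor (X v))) λ {u} {v} a →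
          (λ e e′ → even-odd e′ (subst Odd (sym (step a)) (even+odd e (odd a)))) ,
          (λ ne → subst Even (sym (step a)) (odd+odd ([ (λ e → ⊥-elim (ne e)) , id ]′ (parity (floor (X u)))) (odd a)))
        where
        open Floor (suc t)
        step : ∀ {u v} → Adj G u v → floor (X v) ≡ floor (X u) + D u v
        step {u} {v} a = trans (cong floor (trans (ring (X v) (X u)) (cong (_+_ (X u)) (trans (sym (h a)) (*-comm (+ suc t) (D u v))))))
                               (floor-shift (X u) (D u v))
          where
          ring : ∀ a b → a ≡ b + (a + - b)
          ring = solve-∀

-- Walks in the dual graph, with tokens on faces.

module TokenWalks where

  open import Data.Integer using (_*_; _≤_)
  open IntegerSums
  open Cycles
  open FiniteGraphs
  open Faces
  open ParityAndFloor
  open Orientations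

  IsUnit : ℤ → Set
  IsUnit a = a ≡ 1ℤ ⊎ a ≡ -1ℤ

  unit-neg : ∀ {a} → IsUnit a → IsUnit (- a)
  unit-neg (inj₁ refl) = inj₂ refl
  unit-neg (inj₂ refl) = inj₁ refl

  unit-* : ∀ {a b} → IsUnit a → IsUnit b → IsUnit (a * b)
  unit-* (inj₁ refl) (inj₁ refl) = inj₁ refl
  unit-* (inj₁ refl) (inj₂ refl) = inj₂ refl
  unit-* (inj₂ refl) (inj₁ refl) = inj₂ refl
  unit-* (inj₂ refl) (inj₂ refl) = inj₁ refl

  unit-² : ∀ {a} → IsUnit a → a * a ≡ 1ℤ
  unit-² (inj₁ refl) = refl
  unit-² (inj₂ refl) = refl

  unit-odd : ∀ {a} → IsUnit a → Odd a
  unit-odd (inj₁ refl) = 0ℤ , refl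
  unit-odd (inj₂ refl) = -1ℤ , refl

  unit+unit : ∀ {a b} → IsUnit a → IsUnit b → a + b ≡ 0ℤ ⊎ a + b ≡ + 2 * a
  unit+unit (inj₁ refl) (inj₁ refl) = inj₂ refl
  unit+unit (inj₁ refl) (inj₂ refl) = inj₁ refl
  unit+unit (inj₂ refl) (inj₁ refl) = inj₁ refl
  unit+unit (inj₂ refl) (inj₂ refl) = inj₂ refl

  lsum-odd : ∀ {A : Set} (h : A → ℤ) xs → Odd (lsum h xs) → ∃ λ x → x ∈ xs × Odd (h x)
  lsum-odd h []       o = ⊥-elim (even-odd (0ℤ , refl) o)
  lsum-odd h (x ∷ xs) o with parity (h x)
  ... | inj₂ o′ = x , here refl , o′
  ... | inj₁ e with parity (lsum h xs)
  ...   | inj₁ e′ = ⊥-elim (even-odd (even+even e e′) o)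
  ...   | inj₂ o′ with lsum-odd h xs o′
  ...     | y , y∈ , oy = y , there y∈ , oy

  module _ {A : Set} where

    without : ∀ {x : A} (xs : List A) → x ∈ xs → List A
    without (_ ∷ xs) (here _)  = xs
    without (y ∷ xs) (there p) = y ∷ without xs p

    length-without : ∀ {x : A} xs (p : x ∈ xs) → length xs ≡ suc (length (without xs p))
    length-without (_ ∷ xs) (here _)  = refl
    length-without (_ ∷ xs) (there p) = cong suc (length-without xs p)

    ∈-without : ∀ {x y : A} xs (p : x ∈ xs) → y ≢ x → y ∈ xs → y ∈ without xs p
    ∈-without (_ ∷ xs) (here refl) ne (here refl) = ⊥-elim (ne refl)
    ∈-without (_ ∷ xs) (here refl) ne (there q)   = q
    ∈-without (_ ∷ xs) (there p)   ne (here e)    = here e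
    ∈-without (_ ∷ xs) (there p)   ne (there q)   = there (∈-without xs p ne q)

  module FaceSums {n : ℕ} (G : Graph n) (E : EvenFaceEmbeddingPP G) (nb : NonBipartite G) where

    open EvenFaceEmbeddingPP E
    open Edges G
    open Embedding G E
    open NonBipartiteEmbedding G E nb public

    arc : Fin n → Fin n → Fin n → Fin n → ℤ
    arc u v i j = δ² (i , j) u v + - δ² (i , j) v u

    arc-antisym : ∀ u v → Antisymmetric (arc u v)
    arc-antisym u v i j = ring (δ i u) (δ j v) (δ i v) (δ j u)
      where
      ring : ∀ a b c d → d * c + - (b * a) ≡ - (a * b + - (c * d))
      ring = solve-∀

    arc-cases : ∀ {u v} → u ≢ v → ∀ i j →
      ((i , j) ≡ (u , v) × arc u v i j ≡ 1ℤ) ⊎ ((i , j) ≡ (v , u) × arc u v i j ≡ -1ℤ) ⊎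
      ((i , j) ≢ (u , v) × arc u v i j ≡ 0ℤ)
    arc-cases {u} {v} ne i j with ≡-dec Fin._≟_ Fin._≟_ (i , j) (u , v) | ≡-dec Fin._≟_ Fin._≟_ (i , j) (v , u)
    ... | yes refl | yes refl = ⊥-elim (ne refl)
    ... | yes refl | no ne′   = inj₁ (refl , cong₂ (λ a b → a + - b) (δ²-refl u v) (δ²-≢ ne′))
    ... | no ne′   | yes refl = inj₂ (inj₁ (refl , cong₂ (λ a b → a + - b) (δ²-≢ ne′) (δ²-refl v u)))
    ... | no ne′   | no ne″   = inj₂ (inj₂ (ne′ , cong₂ (λ a b → a + - b) (δ²-≢ ne′) (δ²-≢ ne″)))

    faceSum-+ : ∀ f D D′ → faceSum f (λ u v → D u v + D′ u v) ≡ faceSum f D + faceSum f D′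
    faceSum-+ f D D′ = lsum-+ (λ p → D (proj₁ p) (proj₂ p)) (λ p → D′ (proj₁ p) (proj₂ p)) (cycPairs (face f))

    faceSum-* : ∀ f a D → faceSum f (λ u v → a * D u v) ≡ a * faceSum f D
    faceSum-* f a D = lsum-*ˡ a (λ p → D (proj₁ p) (proj₂ p)) (cycPairs (face f))

    -- This is the effect of setting a single edge: the sums of its two faces change by a unit each
    -- and all others stay.
    faceSum-arc : ∀ f u v → faceSum f (arc u v) ≡ ∂ᶠ f u v
    faceSum-arc f u v = trans (trans (lsum-+ (λ p → δ² p u v) (λ p → - δ² p v u) (cycPairs (face f)))
      (cong (_+_ (traversals (face f) u v)) (trans
        (lsum-cong (cycPairs (face f)) (λ {p} _ → negate (δ² p v u)))
        (trans (lsum-*ˡ -1ℤ (λ p → δ² p v u) (cycPairs (face f))) (sym (negate (traversals (face f) v u)))))))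
      (sym (∂-def (face f) u v))
      where
      negate : ∀ a → - a ≡ -1ℤ * a
      negate = solve-∀

    faceSum-coboundary : ∀ f X → faceSum f (λ u v → X v + - X u) ≡ 0ℤ
    faceSum-coboundary f X = trans (lsum-cong (cycPairs (face f)) λ {p} _ → ring (X (proj₁ p)) (X (proj₂ p)))
      (trans (lsum-*ˡ -1ℤ (λ p → X (proj₁ p) + - X (proj₂ p)) (cycPairs (face f)))
             (cong (_*_ -1ℤ) (cycle-telescope X (face f))))
      where
      ring : ∀ a b → b + - a ≡ -1ℤ * (a + - b)
      ring = solve-∀

    adj-≢ : ∀ {u v} → Adj G u v → u ≢ v
    adj-≢ {u} a refl with trans (sym a) (irrefl G u)
    ... | ()

    -- A function D with values in {0, ±1}, nonzero only where m is 1, is completed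
    -- one edge at a time.  Setting an edge puts a token ±1 on both of its faces;
    -- face sums of m being even, an odd face always has an edge left along which
    -- its token can be passed on, until it returns to the face of the first one.
    module TokenWalk (m : Fin n → Fin n → ℤ) (m-sym : ∀ u v → m v u ≡ m u v)
      (m-bit : ∀ {u v} → Adj G u v → m u v ≡ 0ℤ ⊎ m u v ≡ 1ℤ)
      (m-even : ∀ f → Even (faceSum f m)) where

      record Partial (D : Fin n → Fin n → ℤ) : Set where
        field
          antisym : Antisymmetric D
          bounded : ∀ {u v} → Adj G u v → D u v ≡ 0ℤ ⊎ (m u v ≡ 1ℤ × IsUnit (D u v))
      open Partial

      Unset : (Fin n → Fin n → ℤ) → Fin n × Fin n → Set
      Unset D (u , v) = Adj G u v × m u v ≡ 1ℤ × D u v ≡ 0ℤ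

      Unset? : ∀ D p → Dec (Unset D p)
      Unset? D (u , v) = (adj G u v Bool.≟ true) ×-dec ((m u v ≟ 1ℤ) ×-dec (D u v ≟ 0ℤ))

      -- The list bounds the arcs still to be set. Every step of the walk removes an entry, so its
      -- length is the termination measure.
      Covers : List (Fin n × Fin n) → (Fin n → Fin n → ℤ) → Set
      Covers L D = ∀ {p} → Unset D p → p ∈ L

      set : (Fin n → Fin n → ℤ) → Fin n → Fin n → ℤ → Fin n → Fin n → ℤ
      set D u v ε i j = D i j + ε * arc u v i j

      set-other : ∀ D u v ε {i j} → arc u v i j ≡ 0ℤ → set D u v ε i j ≡ D i j
      set-other D u v ε {i} {j} e = trans (cong (λ s → D i j + ε * s) e) (trans (cong (_+_ (D i j)) (*-zeroʳ ε)) (+-identityʳ (D i j)))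

      set-same : ∀ D u v ε {i j s} → D i j ≡ 0ℤ → arc u v i j ≡ s → set D u v ε i j ≡ ε * s
      set-same D u v ε e e′ = trans (cong₂ (λ d s → d + ε * s) e e′) (+-identityˡ _)

      faceSum-set : ∀ D u v ε f → faceSum f (set D u v ε) ≡ faceSum f D + ε * ∂ᶠ f u v
      faceSum-set D u v ε f = trans (faceSum-+ f D (λ i j → ε * arc u v i j))
        (cong (_+_ (faceSum f D)) (trans (faceSum-* f ε (arc u v)) (cong (_*_ ε) (faceSum-arc f u v))))

      module _ {D u v ε} (partial : Partial D) (unset : Unset D (u , v)) (unit : IsUnit ε) where

        private
          a : Adj G u v
          a = proj₁ unset
          D≡0 : D u v ≡ 0ℤ
          D≡0 = proj₂ (proj₂ unset)

        set-partial : Partial (set D u v ε)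
        set-partial .antisym i j = trans (cong₂ (λ s t → s + ε * t) (antisym partial i j) (arc-antisym u v i j))
                                         (ring (D i j) ε (arc u v i j))
          where
          ring : ∀ d e r → - d + e * - r ≡ - (d + e * r)
          ring = solve-∀
        set-partial .bounded {i} {j} b with arc-cases (adj-≢ a) i j
        ... | inj₁ (refl , e) = inj₂ (proj₁ (proj₂ unset) , subst IsUnit (sym (set-same D u v ε D≡0 e)) (unit-* unit (inj₁ refl)))
        ... | inj₂ (inj₁ (refl , e)) = inj₂ (trans (m-sym u v) (proj₁ (proj₂ unset)) ,
                subst IsUnit (sym (set-same D u v ε (trans (antisym partial u v) (cong -_ D≡0)) e)) (unit-* unit (inj₂ refl)))
        ... | inj₂ (inj₂ (_ , e)) = Sum.map (trans (set-other D u v ε e))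
                (λ (m≡1 , unit) → m≡1 , subst IsUnit (sym (set-other D u v ε e)) unit) (bounded partial b)

        set-covers : ∀ {L} → Covers L D → (p : (u , v) ∈ L) → Covers (without L p) (set D u v ε)
        set-covers {L} cov p {i , j} (b , m≡1 , e) with arc-cases (adj-≢ a) i j
        ... | inj₁ (refl , e′) = ⊥-elim (nonzero unit (trans (sym (*-identityʳ ε)) (trans (sym (set-same D u v ε D≡0 e′)) e)))
          where
          nonzero : ∀ {a} → IsUnit a → a ≢ 0ℤ
          nonzero (inj₁ refl) ()
          nonzero (inj₂ refl) ()
        ... | inj₂ (inj₁ (refl , e′)) = ∈-without L p (λ { refl → adj-≢ a refl })
                (cov (b , m≡1 , trans (antisym partial u v) (cong -_ D≡0)))
        ... | inj₂ (inj₂ (ne , e′)) = ∈-without L p ne (cov (b , m≡1 , trans (sym (set-other D u v ε e′)) e))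

      data Outcome : Set where
        all-set    : ∀ D → Partial D → (∀ p → ¬ Unset D p) → (∀ f → faceSum f D ≡ 0ℤ) → Outcome
        one-face   : ∀ D → Partial D → ∀ f ε → IsUnit ε → (∀ k → faceSum k D ≡ ε * (+ 2 * δ f k)) → Outcome

      -- On an edge, `m + D` is even when m is 0 and when the edge is set. Its sum over the face is
      -- odd, so some edge with m equal to 1 is unset.
      unset-on-odd-face : ∀ {D g} → Partial D → IsUnit (faceSum g D) →
        ∃₂ λ u v → (u , v) ∈ cycPairs (face g) × Unset D (u , v)
      unset-on-odd-face {D} {g} partial unit with lsum-odd (λ p → m (proj₁ p) (proj₂ p) + D (proj₁ p) (proj₂ p)) (cycPairs (face g))
        (subst Odd (sym (faceSum-+ g m D)) (even+odd (m-even g) (unit-odd unit)))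
      ... | (u , v) , p , odd = u , v , p , face-adj g p , is-unset
        where
        is-unset : m u v ≡ 1ℤ × D u v ≡ 0ℤ
        is-unset with bounded partial (face-adj g p) | m-bit (face-adj g p)
        ... | inj₁ e | inj₂ e′ = e′ , e
        ... | inj₁ e | inj₁ e′ = ⊥-elim (even-odd (0ℤ , cong₂ _+_ e′ e) odd)
        ... | inj₂ (e , unit) | _ = ⊥-elim (even-odd (odd+odd (0ℤ , e) (unit-odd unit)) odd)

      mutual

        -- The state without tokens. An unset edge is given the value 1, which places tokens on its
        -- two distinct faces and starts a chase; if none is left, the walk ends with all face sums
        -- zero.
        balanced : ∀ k L → length L ≡ k → ∀ {D} → Partial D → Covers L D → (∀ f → faceSum f D ≡ 0ℤ) → Outcome
        balanced k L len {D} partial cov zeros with any? (Unset? D) L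
        ... | no none = all-set D partial (λ p unset → none (lose (cov unset) unset)) zeros
        ... | yes some with find some
        ...   | (u , v) , p , unset with k | trans (sym (length-without L p)) len
        ...     | suc k′ | len′ with some-face (proj₁ unset)
        ...       | f , hf with other-face f hf
        ...         | g , f≢g , hg , only =
          chase k′ (without L p) (ℕ.suc-injective len′)
            (set-partial partial unset (inj₁ refl)) (set-covers partial unset (inj₁ refl) cov p)
            f≢g (subst IsUnit (sym (value f)) (∂ᶠ-unit {f} hf)) (subst IsUnit (sym (value g)) (∂ᶠ-unit {g} hg))
            (λ k a b → trans (value k) (∂ᶠ-unused {k} (only k a b)))
          where
          value : ∀ k → faceSum k (set D u v 1ℤ) ≡ ∂ᶠ k u v
          value k = trans (faceSum-set D u v 1ℤ k) (trans (cong (_+ 1ℤ * ∂ᶠ k u v) (zeros k))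
                      (trans (+-identityˡ (1ℤ * ∂ᶠ k u v)) (*-identityˡ (∂ᶠ k u v))))

        -- The token of `f` stays and that of `g` travels. All other faces have sum zero, so a face
        -- entered by the travelling token holds just this one, unless it is `f`: there two units
        -- either cancel or add up to 2 in absolute value.
        chase : ∀ k L → length L ≡ k → ∀ {D f g} → Partial D → Covers L D → f ≢ g →
          IsUnit (faceSum f D) → IsUnit (faceSum g D) → (∀ k → k ≢ f → k ≢ g → faceSum k D ≡ 0ℤ) → Outcome
        chase k L len {D} {f} {g} partial cov f≢g unit-f unit-g zeros with unset-on-odd-face {D} {g} partial unit-g
        ... | u , v , arc∈ , unset with cov unset
        ...   | p with k | trans (sym (length-without L p)) len | other-face g (inj₁ arc∈)
        ...     | suc k′ | len′ | h , g≢h , hh , only = continue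
          where
          -- The face `g` traverses the chosen arc forwards, so this value cancels its token.
          ε : ℤ
          ε = - faceSum g D
          unit-ε : IsUnit ε
          unit-ε = unit-neg unit-g
          D′ : Fin n → Fin n → ℤ
          D′ = set D u v ε
          partial′ : Partial D′
          partial′ = set-partial partial unset unit-ε
          cov′ : Covers (without L p) D′
          cov′ = set-covers partial unset unit-ε cov p
          at-g : faceSum g D′ ≡ 0ℤ
          at-g = trans (faceSum-set D u v ε g) (trans (cong (λ s → faceSum g D + ε * s) (∂ᶠ-forward {g} arc∈)) (ring (faceSum g D)))
            where
            ring : ∀ a → a + (- a) * 1ℤ ≡ 0ℤ
            ring = solve-∀
          untouched : ∀ k → k ≢ g → k ≢ h → faceSum k D′ ≡ faceSum k D
          untouched k a b = trans (faceSum-set D u v ε k) (trans (cong (λ s → faceSum k D + ε * s) (∂ᶠ-unused {k} (only k a b)))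
            (trans (cong (_+_ (faceSum k D)) (*-zeroʳ ε)) (+-identityʳ (faceSum k D))))
          off : ∀ k → k ≢ f → k ≢ h → faceSum k D′ ≡ 0ℤ
          off k k≢f k≢h with k Fin.≟ g
          ... | yes refl = at-g
          ... | no k≢g   = trans (untouched k k≢g k≢h) (zeros k k≢f k≢g)
          continue : Outcome
          continue with h Fin.≟ f
          ... | no h≢f = chase k′ (without L p) (ℕ.suc-injective len′) partial′ cov′ (h≢f ∘ sym)
              (subst IsUnit (sym (untouched f f≢g (h≢f ∘ sym))) unit-f)
              (subst IsUnit (sym (trans (faceSum-set D u v ε h) (trans (cong (_+ ε * ∂ᶠ h u v) (zeros h h≢f (g≢h ∘ sym)))
                (+-identityˡ (ε * ∂ᶠ h u v))))) (unit-* unit-ε (∂ᶠ-unit {h} hh)))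
              off
          ... | yes refl with unit+unit unit-f (unit-* unit-ε (∂ᶠ-unit {h} hh))
          ...   | inj₁ e = balanced k′ (without L p) (ℕ.suc-injective len′) partial′ cov′ zeros′
            where
            zeros′ : ∀ k → faceSum k D′ ≡ 0ℤ
            zeros′ k with k Fin.≟ f
            ... | yes refl = trans (faceSum-set D u v ε f) e
            ... | no k≢f   = off k k≢f k≢f
          ...   | inj₂ e = one-face D′ partial′ f (faceSum f D) unit-f sums
            where
            sums : ∀ k → faceSum k D′ ≡ faceSum f D * (+ 2 * δ f k)
            sums k with f Fin.≟ k
            ... | yes refl = trans (faceSum-set D u v ε f) (trans e (*-comm (+ 2) (faceSum f D)))
            ... | no f≢k   = trans (off k (f≢k ∘ sym) (f≢k ∘ sym)) (sym (*-zeroʳ (faceSum f D)))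

      opaque

        outcome : Outcome
        outcome = balanced _ allPairs refl {λ _ _ → 0ℤ}
          (record { antisym = λ _ _ → refl ; bounded = λ _ → inj₁ refl })
          (λ {p} _ → ∈-cartesianProduct⁺ (∈-allFin (proj₁ p)) (∈-allFin (proj₂ p)))
          (λ f → lsum-zero (cycPairs (face f)) λ _ → refl)
          where
          allPairs : List (Fin n × Fin n)
          allPairs = cartesianProduct (allFin n) (allFin n)

-- Odd functions with prescribed face sums, and the covering of stable sets.

module Covers where

  open import Data.Integer using (_*_; _≤_)
  open IntegerSums
  open Cycles
  open FiniteGraphs
  open Faces
  open ParityAndFloor
  open Orientations
  open TokenWalks

  -- With 0 ≤ q u - p u ≤ 1, the constraints q v - p u ≤ k u v on the edges define a
  -- polytope whose image under x = q - p lies in STAB(G); Covered says that χ is in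
  -- this image, with q = Q / (1 + T) and p = P / (1 + T).
  record Reference {n : ℕ} (G : Graph n) : Set where
    field
      k     : Fin n → Fin n → ℤ
      k-sum : ∀ {u v} → Adj G u v → k u v + k v u ≡ 1ℤ

  Covered : ∀ {n} {G : Graph n} → (Fin n → ℤ) → Reference G → Set
  Covered {n} {G} χ R = ∃ λ T → ∃₂ λ (P Q : Fin n → ℤ) →
    (∀ u → Q u ≡ P u + + suc T * χ u) ×
    (∀ {u v} → Adj G u v → Q v + - P u ≤ + suc T * Reference.k R u v)

  record StableIndicator {n : ℕ} (G : Graph n) (χ : Fin n → ℤ) : Set where
    field
      values : ∀ u → χ u ≡ 0ℤ ⊎ χ u ≡ 1ℤ
      stable : ∀ {u v} → Adj G u v → χ u ≡ 0ℤ ⊎ χ v ≡ 0ℤ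

  -- `P` carries data and need not be decidable, so the connectedness principle cannot be applied to
  -- it directly. It is applied to the decidable predicate of having been visited, while the list of
  -- unvisited indices shrinks.
  propagate : ∀ {N} {P : Fin N → Set} {R : Fin N → Fin N → Set} (R? : ∀ i j → Dec (R i j)) →
    (∀ {i j} → R i j → P i → P j) → ∀ i₀ → P i₀ →
    (∀ {T : Fin N → Set} → (∀ i → Dec (T i)) → (∀ {i j} → R i j → T i → T j) → T i₀ → ∀ i → T i) →
    ∀ i → P i
  propagate {N} {P} {R} R? step i₀ p₀ connected = go _ (allFin N) refl start
    where
    start : ∀ i → ¬ (i ∈ allFin N × i ≢ i₀) → P i
    start i ne with i Fin.≟ i₀
    ... | yes refl = p₀
    ... | no i≢i₀  = ⊥-elim (ne (∈-allFin i , i≢i₀))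
    Fresh : List (Fin N) → Fin N → Set
    Fresh L i = i ∈ L × i ≢ i₀
    Fresh? : ∀ L i → Dec (Fresh L i)
    Fresh? L i = member? Fin._≟_ i L ×-dec ¬? (i Fin.≟ i₀)
    go : ∀ k L → length L ≡ k → (∀ i → ¬ Fresh L i → P i) → ∀ i → P i
    go k L len visited with Fin.any? (λ j → Fresh? L j ×-dec Fin.any? (λ i → ¬? (Fresh? L i) ×-dec R? i j))
    ... | no closed = λ i → visited i (connected {T = λ i → ¬ Fresh L i} (λ i → ¬? (Fresh? L i))
            (λ {i} {j} r seen fresh → closed (j , fresh , i , seen , r)) (λ fresh → proj₂ fresh refl) i)
    ... | yes (j , (j∈ , j≢i₀) , i , seen , r) with k | trans (sym (length-without L j∈)) len
    ...   | suc k′ | len′ = go k′ (without L j∈) (ℕ.suc-injective len′) visited′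
      where
      visited′ : ∀ i → ¬ Fresh (without L j∈) i → P i
      visited′ i′ ¬fresh with i′ Fin.≟ j
      ... | yes refl = step r (visited i seen)
      ... | no ne    = visited i′ λ (i∈ , i≢i₀) → ¬fresh (∈-without L j∈ ne i∈ , i≢i₀)

  odd+2* : ∀ {a} b → Odd a → Odd (a + + 2 * b)
  odd+2* b (k , refl) = k + b , ring k b
    where
    ring : ∀ k b → 1ℤ + + 2 * k + + 2 * b ≡ 1ℤ + + 2 * (k + b)
    ring = solve-∀

  odd-neg : ∀ {a} → Odd a → Odd (- a)
  odd-neg (k , refl) = - 1ℤ + - k , ring k
    where
    ring : ∀ k → - (1ℤ + + 2 * k) ≡ 1ℤ + + 2 * (- 1ℤ + - k)
    ring = solve-∀

  lsum-of-odds : ∀ {A : Set} (h : A → ℤ) xs → (∀ {x} → x ∈ xs → Odd (h x)) → Even (lsum h xs + + length xs)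
  lsum-of-odds h []       o = 0ℤ , refl
  lsum-of-odds h (x ∷ xs) o = subst Even (ring (h x) (lsum h xs) (+ length xs))
    (even+even (odd+odd (o (here refl)) (0ℤ , refl)) (lsum-of-odds h xs (o ∘ there)))
    where
    ring : ∀ a b c → (a + 1ℤ) + (b + c) ≡ a + b + (1ℤ + c)
    ring = solve-∀

  even-+ˡ : ∀ {a b} → Even (a + b) → Even b → Even a
  even-+ˡ {a} {b} e e′ with parity a
  ... | inj₁ e″ = e″
  ... | inj₂ o  = ⊥-elim (even-odd e (subst Odd (+-comm b a) (even+odd e′ o)))

  even-length : ∀ {k} → 2 ∣ k → Even (+ k)
  even-length (divides q refl) = + q , trans (pos-* q 2) (*-comm (+ q) (+ 2))

  uncovered-small : ∀ {a b d} → a ≡ 0ℤ → b ≡ 0ℤ → d ≡ 0ℤ ⊎ IsUnit d → a + b + - d ≤ 1ℤ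
  uncovered-small refl refl (inj₁ refl)        = +≤+ z≤n
  uncovered-small refl refl (inj₂ (inj₁ refl)) = -≤+
  uncovered-small refl refl (inj₂ (inj₂ refl)) = ≤-refl

  covered-small : ∀ {c d} → c ≡ 1ℤ → d ≡ 0ℤ → c + - d ≤ 1ℤ
  covered-small refl refl = ≤-refl

  bounded-at-0 : ∀ {m d} → m ≡ 0ℤ → d ≡ 0ℤ ⊎ (m ≡ 1ℤ × IsUnit d) → d ≡ 0ℤ
  bounded-at-0 _    (inj₁ e)        = e
  bounded-at-0 refl (inj₂ (() , _))

  uncovered-odd : ∀ {a b d} → a ≡ 0ℤ → b ≡ 0ℤ → IsUnit d → Odd (d + (b + - a))
  uncovered-odd refl refl unit = subst Odd (sym (+-identityʳ _)) (unit-odd unit)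

  module References {n : ℕ} (G : Graph n) (E : EvenFaceEmbeddingPP G) (nb : NonBipartite G) where

    open EvenFaceEmbeddingPP E
    open Edges G
    open Embedding G E
    open FaceSums G E nb

    faceSum-even : ∀ f D → (∀ {u v} → Adj G u v → Odd (D u v)) → Even (faceSum f D)
    faceSum-even f D odd = even-+ˡ
      (lsum-of-odds (λ p → D (proj₁ p) (proj₂ p)) (cycPairs (face f)) (λ p → odd (face-adj f p)))
      (even-length (subst (2 ∣_) (sym (length-cycPairs (face f))) (face-even f)))

    -- `small` says that q = χ / 2 and p = - χ / 2 satisfy q v - p u ≤ (1 + D u v) / 2. `D` may be 0
    -- on covered edges, so the right-hand side need not be integral; what links `D` to an odd
    -- function is the equality of face sums.
    record SingleFace (χ : Fin n → ℤ) : Set where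
      field
        D       : Fin n → Fin n → ℤ
        f       : Fin F
        ε       : ℤ
        unit    : IsUnit ε
        antisym : Antisymmetric D
        sums    : ∀ k → faceSum k D ≡ ε * (+ 2 * δ f k)
        small   : ∀ {u v} → Adj G u v → χ u + χ v + - D u v ≤ 1ℤ

    module _ (χ : Fin n → ℤ) (indicator : StableIndicator G χ) where

      open StableIndicator indicator

      private
        m : Fin n → Fin n → ℤ
        m u v = 1ℤ + - (χ u + χ v)

      -- An even face loses two edges for each of its vertices in the stable set. In formulas, `m`
      -- is a coboundary plus a function with odd values, and odd values have an even sum on an even
      -- face.
      uncovered-even : ∀ f → Even (faceSum f m)
      uncovered-even f = subst Even (sym split) (even+even {faceSum f (λ u v → χ v + - χ u)}
        (subst Even (sym (faceSum-coboundary f χ)) (0ℤ , refl))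
        (faceSum-even f (λ u v → 1ℤ + + 2 * - χ v) λ {u} {v} _ → - χ v , refl))
        where
        ring : ∀ a b → 1ℤ + - (a + b) ≡ (b + - a) + (1ℤ + + 2 * - b)
        ring = solve-∀
        split : faceSum f m ≡ faceSum f (λ u v → χ v + - χ u) + faceSum f (λ u v → 1ℤ + + 2 * - χ v)
        split = trans (lsum-cong (cycPairs (face f)) λ {p} _ → ring (χ (proj₁ p)) (χ (proj₂ p)))
                      (faceSum-+ f (λ u v → χ v + - χ u) (λ u v → 1ℤ + + 2 * - χ v))

      m-cases : ∀ {u v} → Adj G u v → (m u v ≡ 1ℤ × χ u ≡ 0ℤ × χ v ≡ 0ℤ) ⊎
        (m u v ≡ 0ℤ × χ u + χ v ≡ 1ℤ × Odd (χ v + - χ u))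
      m-cases {u} {v} a with stable a | values u | values v
      ... | _ | inj₁ e | inj₁ e′ rewrite e | e′ = inj₁ (refl , refl , refl)
      ... | _ | inj₁ e | inj₂ e′ rewrite e | e′ = inj₂ (refl , refl , 0ℤ , refl)
      ... | _ | inj₂ e | inj₁ e′ rewrite e | e′ = inj₂ (refl , refl , -1ℤ , refl)
      ... | inj₁ e | inj₂ e′ | inj₂ _ = ⊥-elim (zero≢one (trans (sym e) e′))
        where
        zero≢one : 0ℤ ≡ 1ℤ → ⊥
        zero≢one ()
      ... | inj₂ e | inj₂ _ | inj₂ e′ = ⊥-elim (zero≢one (trans (sym e) e′))
        where
        zero≢one : 0ℤ ≡ 1ℤ → ⊥
        zero≢one ()

      private
        module Walk = TokenWalk m (λ u v → cong (λ s → 1ℤ + - s) (+-comm (χ v) (χ u)))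
          (λ a → [ (λ (e , _) → inj₂ e) , (λ (e , _) → inj₁ e) ]′ (m-cases a)) uncovered-even

      single-face-of : Walk.Outcome → SingleFace χ
      single-face-of (Walk.one-face D partial f ε unit sums) = record
        { D = D ; f = f ; ε = ε ; unit = unit ; antisym = antisym ; sums = sums ; small = small }
        where
        open Walk.Partial partial
        small : ∀ {u v} → Adj G u v → χ u + χ v + - D u v ≤ 1ℤ
        small {u} {v} a = [ (λ (_ , e , e′) → uncovered-small e e′ (Sum.map id proj₂ (bounded a))) ,
                            (λ (m≡0 , e , _) → covered-small e (bounded-at-0 m≡0 (bounded a))) ]′ (m-cases a)
      single-face-of (Walk.all-set D partial none zeros) = ⊥-elim (odd-not-closed D′ antisym′ odd closed)
        where
        open Walk.Partial partial
        -- The coboundary of χ keeps the face sums. It is 1 or -1 on covered edges, where `D` is 0,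
        -- and vanishes on uncovered ones, where `D` is a unit; so `D′` is odd throughout.
        D′ : Fin n → Fin n → ℤ
        D′ u v = D u v + (χ v + - χ u)
        antisym′ : Antisymmetric D′
        antisym′ u v = trans (cong (_+ (χ u + - χ v)) (antisym u v)) (ring (D u v) (χ u) (χ v))
          where
          ring : ∀ d a b → - d + (a + - b) ≡ - (d + (b + - a))
          ring = solve-∀
        closed : ∀ f → faceSum f D′ ≡ 0ℤ
        closed f = trans (faceSum-+ f D (λ u v → χ v + - χ u)) (cong₂ _+_ (zeros f) (faceSum-coboundary f χ))
        odd : ∀ {u v} → Adj G u v → Odd (D′ u v)
        odd {u} {v} a = [ (λ (m≡1 , e , e′) → uncovered-odd e e′ ([ (λ D≡0 → ⊥-elim (none (u , v) (a , m≡1 , D≡0))) , proj₂ ]′ (bounded a))) ,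
                          (λ (m≡0 , _ , o) → even+odd (0ℤ , bounded-at-0 m≡0 (bounded a)) o) ]′ (m-cases a)

      opaque

        single-face : SingleFace χ
        single-face = single-face-of Walk.outcome

    private
      -- The walk for the empty stable set exhibits a face and a function with sum 2 there, up to
      -- sign, and 0 on all other faces. It is the source of the relation that twice a face is
      -- trivial.
      seed : SingleFace (λ _ → 0ℤ)
      seed = single-face (λ _ → 0ℤ) (record { values = λ _ → inj₁ refl ; stable = λ _ → inj₁ refl })
      module Seed = SingleFace seed

    opaque

      f₀ : Fin F
      f₀ = Seed.f

      twice : Fin n → Fin n → ℤ
      twice u v = Seed.ε * Seed.D u v

      twice-antisym : Antisymmetric twice
      twice-antisym u v = trans (cong (_*_ Seed.ε) (Seed.antisym u v)) (sym (neg-distribʳ-* Seed.ε (Seed.D u v)))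

      twice-sums : ∀ k → faceSum k twice ≡ + 2 * δ f₀ k
      twice-sums k = trans (faceSum-* k Seed.ε Seed.D) (trans (cong (_*_ Seed.ε) (Seed.sums k))
        (trans (sym (*-assoc Seed.ε Seed.ε (+ 2 * δ Seed.f k)))
        (trans (cong (_* (+ 2 * δ Seed.f k)) (unit-² Seed.unit)) (*-identityˡ (+ 2 * δ Seed.f k)))))

    -- Modulo face sums of antisymmetric integer functions, all faces agree up to
    -- sign, and twice a face is zero.
    record Moved (f : Fin F) : Set where
      field
        ε       : ℤ
        z       : Fin n → Fin n → ℤ
        unit    : IsUnit ε
        antisym : Antisymmetric z
        sums    : ∀ k → faceSum k z ≡ δ f k + - (ε * δ f₀ k)

    Neighbours : Fin F → Fin F → Set
    Neighbours f g = f ≢ g × Any (λ p → U g (proj₁ p) (proj₂ p)) (cycPairs (face f))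

    -- The elementary function of a shared arc has sum 1 on `f`, a unit b on `g` and 0 elsewhere.
    -- Subtracting the function that belongs to `f` and multiplying by b expresses `g` through `f₀`,
    -- as b squared is 1.
    move : ∀ {f g} → Neighbours f g → Moved f → Moved g
    move {f} {g} (f≢g , shared) m with find shared
    ... | (u , v) , p , hg with other-face f (inj₁ p)
    ...   | g′ , _ , _ , only = record
      { ε = - (b * ε) ; z = z′ ; unit = unit-neg (unit-* unit-b unit) ; antisym = anti′ ; sums = sums′ }
      where
      open Moved m renaming (antisym to anti)
      b : ℤ
      b = ∂ᶠ g u v
      unit-b : IsUnit b
      unit-b = ∂ᶠ-unit {g} hg
      z′ : Fin n → Fin n → ℤ
      z′ i j = b * (arc u v i j + -1ℤ * z i j)
      anti′ : Antisymmetric z′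
      anti′ i j = trans (cong₂ (λ s t → b * (s + -1ℤ * t)) (arc-antisym u v i j) (anti i j)) (ring b (arc u v i j) (z i j))
        where
        ring : ∀ b s t → b * (- s + -1ℤ * - t) ≡ - (b * (s + -1ℤ * t))
        ring = solve-∀
      g≡g′ : g ≡ g′
      g≡g′ with g Fin.≟ g′
      ... | yes e = e
      ... | no ne = ⊥-elim (only g (f≢g ∘ sym) ne hg)
      ∂-values : ∀ k → ∂ᶠ k u v ≡ δ f k + b * δ g k
      ∂-values k with f Fin.≟ k | g Fin.≟ k
      ... | yes refl | yes refl = ⊥-elim (f≢g refl)
      ... | yes refl | no _     = trans (∂ᶠ-forward {f} p) (sym (cong (_+_ 1ℤ) (*-zeroʳ b)))
      ... | no _     | yes refl = sym (trans (+-identityˡ (b * 1ℤ)) (*-identityʳ b))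
      ... | no f≢k   | no g≢k   = trans (∂ᶠ-unused {k} (only k (f≢k ∘ sym) (λ e → g≢k (trans g≡g′ (sym e)))))
                                        (sym (trans (+-identityˡ (b * 0ℤ)) (*-zeroʳ b)))
      sums′ : ∀ k → faceSum k z′ ≡ δ g k + - ((- (b * ε)) * δ f₀ k)
      sums′ k = begin
        faceSum k z′
          ≡⟨ trans (faceSum-* k b (λ i j → arc u v i j + -1ℤ * z i j)) (cong (_*_ b) (trans
               (faceSum-+ k (arc u v) (λ i j → -1ℤ * z i j))
               (cong₂ _+_ (trans (faceSum-arc k u v) (∂-values k)) (trans (faceSum-* k -1ℤ z) (cong (_*_ -1ℤ) (sums k)))))) ⟩
        b * ((δ f k + b * δ g k) + -1ℤ * (δ f k + - (ε * δ f₀ k)))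
          ≡⟨ ring b (δ f k) (δ g k) ε (δ f₀ k) ⟩
        (b * b) * δ g k + - ((- (b * ε)) * δ f₀ k)
          ≡⟨ cong (λ s → s * δ g k + - ((- (b * ε)) * δ f₀ k)) (unit-² unit-b) ⟩
        1ℤ * δ g k + - ((- (b * ε)) * δ f₀ k)
          ≡⟨ cong (_+ - ((- (b * ε)) * δ f₀ k)) (*-identityˡ (δ g k)) ⟩
        δ g k + - ((- (b * ε)) * δ f₀ k) ∎
        where
        ring : ∀ b p q e r → b * ((p + b * q) + -1ℤ * (p + - (e * r))) ≡ (b * b) * q + - ((- (b * e)) * r)
        ring = solve-∀

    opaque

      moved : ∀ f → Moved f
      moved = propagate
        (λ f g → ¬? (f Fin.≟ g) ×-dec any? (λ p → Uses? (face g) (proj₁ p) (proj₂ p)) (cycPairs (face f)))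
        move f₀
        (record { ε = 1ℤ ; z = λ _ _ → 0ℤ ; unit = inj₁ refl ; antisym = λ _ _ → refl
                ; sums = λ k → trans (lsum-zero (cycPairs (face k)) λ _ → refl) (ring (δ f₀ k)) })
        connected-faces
        where
        ring : ∀ a → 0ℤ ≡ a + - (1ℤ * a)
        ring = solve-∀
        connected-faces : ∀ {T : Fin F → Set} → (∀ f → Dec (T f)) → (∀ {f g} → Neighbours f g → T f → T g) →
          T f₀ → ∀ f → T f
        connected-faces {T} T? closed t₀ = [ id , (λ none → ⊥-elim (none f₀ t₀)) ]′ (all-or-no-faces T? shared)
          where
          shared : ∀ {f g u v} → U f u v → U g u v → T f → T g
          shared {f} {g} hf hg t with f Fin.≟ g
          ... | yes refl = t
          ... | no ne    = closed (ne , [ (λ p → lose p hg) , (λ p → lose p (U-sym {g} hg)) ]′ hf) t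

    record OddWith (s : Fin F → ℤ) : Set where
      field
        D       : Fin n → Fin n → ℤ
        antisym : Antisymmetric D
        odd     : ∀ {u v} → Adj G u v → Odd (D u v)
        sums    : ∀ k → faceSum k D ≡ + 2 * s k

    opaque

      -- Adding an even function keeps all values odd, so the half sums may be altered by the face
      -- sums of any antisymmetric function.
      shift : ∀ {s} a z (r : Fin F → ℤ) → Antisymmetric z → (∀ k → faceSum k z ≡ r k) → OddWith s → OddWith (λ k → s k + a * r k)
      shift {s} a z r anti sums′ o = record
        { D       = λ u v → D u v + + 2 * (a * z u v)
        ; antisym = λ u v → trans (cong₂ (λ p q → p + + 2 * (a * q)) (antisym u v) (anti u v)) (ring₁ (D u v) a (z u v))
        ; odd     = λ {u} {v} b → odd+2* (a * z u v) (odd b)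
        ; sums    = λ k → trans (faceSum-+ k D (λ u v → + 2 * (a * z u v))) (trans (cong₂ _+_ (sums k)
            (trans (faceSum-* k (+ 2) (λ u v → a * z u v)) (cong (_*_ (+ 2)) (trans (faceSum-* k a z) (cong (_*_ a) (sums′ k))))))
            (sym (*-distribˡ-+ (+ 2) (s k) (a * r k))))
        }
        where
        open OddWith o
        ring₁ : ∀ d a z → - d + + 2 * (a * - z) ≡ - (d + + 2 * (a * z))
        ring₁ = solve-∀

    opaque

      adjust : ∀ {s s′ : Fin F → ℤ} → (∀ k → s k ≡ s′ k) → OddWith s → OddWith s′
      adjust h o = record { OddWith o ; sums = λ k → trans (OddWith.sums o k) (cong (_*_ (+ 2)) (h k)) }

    opaque

      -- Orienting each edge by the order of its ends gives values 1 and -1, a starting point whose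
      -- face sums are then redistributed.
      up-orientation : ∃ OddWith
      up-orientation = (λ k → proj₁ (faceSum-even k O odd)) ,
        record { D = O ; antisym = anti ; odd = odd ; sums = λ k → proj₂ (faceSum-even k O odd) }
        where
        O : Fin n → Fin n → ℤ
        O u v = bit (upEdge u v) + - bit (upEdge v u)
        anti : Antisymmetric O
        anti u v = ring (bit (upEdge u v)) (bit (upEdge v u))
          where
          ring : ∀ a b → b + - a ≡ - (a + - b)
          ring = solve-∀
        odd : ∀ {u v} → Adj G u v → Odd (O u v)
        odd {u} {v} a = - bit (upEdge v u) , trans (ring (bit (upEdge u v)) (bit (upEdge v u)))
          (cong (_+ + 2 * - bit (upEdge v u)) (trans (sym (adj-upEdge u v)) (cong (bit) a)))
          where
          ring : ∀ a b → a + - b ≡ (a + b) + + 2 * - b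
          ring = solve-∀

    opaque

      -- Subtracting `s f` times the function of `moved f` transports the amount at `f` to `f₀`,
      -- with the sign of that transport; M collects what arrives.
      concentrate : ∀ {s} → OddWith s → ∃ λ (M : ℤ) → OddWith (λ k → M * δ f₀ k)
      concentrate {s} o = sum (λ f → s f * ε f) , adjust total (shift {s} -1ℤ Z R anti sums o)
        where
        ε : Fin F → ℤ
        ε f = Moved.ε (moved f)
        z : Fin F → Fin n → Fin n → ℤ
        z f = Moved.z (moved f)
        Z : Fin n → Fin n → ℤ
        Z u v = sum λ f → s f * z f u v
        R : Fin F → ℤ
        R k = sum λ f → s f * (δ f k + - (ε f * δ f₀ k))
        anti : Antisymmetric Z
        anti u v = trans (sum-cong λ f → trans (cong (_*_ (s f)) (Moved.antisym (moved f) u v)) (ring₁ (s f) (z f u v)))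
          (trans (sum-*ˡ -1ℤ (λ f → s f * z f u v)) (ring₂ (Z u v)))
          where
          ring₁ : ∀ a b → a * - b ≡ -1ℤ * (a * b)
          ring₁ = solve-∀
          ring₂ : ∀ a → -1ℤ * a ≡ - a
          ring₂ = solve-∀
        sums : ∀ k → faceSum k Z ≡ R k
        sums k = trans (lsum-sum (λ f p → s f * z f (proj₁ p) (proj₂ p)) (cycPairs (face k)))
          (sum-cong λ f → trans (faceSum-* k (s f) (z f)) (cong (_*_ (s f)) (Moved.sums (moved f) k)))
        total : ∀ k → s k + -1ℤ * R k ≡ sum (λ f → s f * ε f) * δ f₀ k
        total k = trans (cong (λ r → s k + -1ℤ * r) R-value) (ring (s k) (sum (λ f → s f * ε f)) (δ f₀ k))
          where
          ring : ∀ a m d → a + -1ℤ * (a + (- d) * m) ≡ m * d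
          ring = solve-∀
          ring′ : ∀ s d e t → s * (d + - (e * t)) ≡ d * s + (- t) * (s * e)
          ring′ = solve-∀
          δ-sym : ∀ f → δ f k ≡ δ k f
          δ-sym f with f Fin.≟ k | k Fin.≟ f
          ... | yes _ | yes _ = refl
          ... | no _  | no _  = refl
          ... | yes e | no ne = ⊥-elim (ne (sym e))
          ... | no ne | yes e = ⊥-elim (ne (sym e))
          R-value : R k ≡ s k + (- δ f₀ k) * sum (λ f → s f * ε f)
          R-value = begin
            R k
              ≡⟨ sum-cong (λ f → trans (ring′ (s f) (δ f k) (ε f) (δ f₀ k)) (cong (λ d → d * s f + (- δ f₀ k) * (s f * ε f)) (δ-sym f))) ⟩
            sum (λ f → δ k f * s f + (- δ f₀ k) * (s f * ε f))
              ≡⟨ sum-+ (λ f → δ k f * s f) (λ f → (- δ f₀ k) * (s f * ε f)) ⟩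
            sum (λ f → δ k f * s f) + sum (λ f → (- δ f₀ k) * (s f * ε f))
              ≡⟨ cong₂ _+_ (sum-δ k s) (sum-*ˡ (- δ f₀ k) (λ f → s f * ε f)) ⟩
            s k + (- δ f₀ k) * sum (λ f → s f * ε f) ∎

    no-balanced : ¬ OddWith (λ _ → 0ℤ)
    no-balanced o = odd-not-closed D antisym odd sums
      where open OddWith o

    opaque

      -- `twice` changes M in steps of 2. An even M could be reduced to 0, leaving an odd function
      -- with zero face sums and hence a 2-colouring; so M is odd and reduces to 1.
      odd-at-f₀ : OddWith (δ f₀)
      odd-at-f₀ = choose (concentrate (proj₂ up-orientation))
        where
        ring-odd : ∀ h d → (1ℤ + + 2 * h) * d + (- h) * (+ 2 * d) ≡ d
        ring-odd = solve-∀
        ring-even : ∀ h d → (+ 2 * h) * d + (- h) * (+ 2 * d) ≡ 0ℤ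
        ring-even = solve-∀
        choose : (∃ λ M → OddWith (λ k → M * δ f₀ k)) → OddWith (δ f₀)
        choose (M , o) with parity M
        ... | inj₂ (h , refl) = adjust (λ k → ring-odd h (δ f₀ k)) (shift {λ k → (1ℤ + + 2 * h) * δ f₀ k} (- h) twice (λ k → + 2 * δ f₀ k) twice-antisym twice-sums o)
        ... | inj₁ (h , refl) = ⊥-elim (no-balanced (adjust (λ k → ring-even h (δ f₀ k))
                                  (shift {λ k → (+ 2 * h) * δ f₀ k} (- h) twice (λ k → + 2 * δ f₀ k) twice-antisym twice-sums o)))

    opaque

      odd-at : ∀ f → OddWith (δ f)
      odd-at f = choose unit (shift {δ f₀} 1ℤ z (λ k → δ f k + - (ε * δ f₀ k)) antisym sums odd-at-f₀)
        where
        open Moved (moved f)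
        ring-pos : ∀ a b → a + 1ℤ * (b + - (1ℤ * a)) ≡ b
        ring-pos = solve-∀
        ring-neg : ∀ a b → a + 1ℤ * (b + - (-1ℤ * a)) + -1ℤ * (+ 2 * a) ≡ b
        ring-neg = solve-∀
        choose : ∀ {ε} → IsUnit ε → OddWith (λ k → δ f₀ k + 1ℤ * (δ f k + - (ε * δ f₀ k))) → OddWith (δ f)
        choose (inj₁ refl) o = adjust (λ k → ring-pos (δ f₀ k) (δ f k)) o
        -- Here the transport yields `2 * δ f₀ + δ f`, and `twice` removes the surplus.
        choose (inj₂ refl) o = adjust (λ k → ring-neg (δ f₀ k) (δ f k))
                                 (shift {λ k → δ f₀ k + 1ℤ * (δ f k + - (-1ℤ * δ f₀ k))} -1ℤ twice (λ k → + 2 * δ f₀ k) twice-antisym twice-sums o)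

    opaque

      odd-at-neg : ∀ f → OddWith (λ k → -1ℤ * δ f k)
      odd-at-neg f = record
        { D       = λ u v → -1ℤ * D u v
        ; antisym = λ u v → trans (cong (_*_ -1ℤ) (antisym u v)) (ring₁ (D u v))
        ; odd     = λ {u} {v} a → subst Odd (ring₂ (D u v)) (odd-neg (odd a))
        ; sums    = λ k → trans (faceSum-* k -1ℤ D) (trans (cong (_*_ -1ℤ) (sums k)) (ring₃ (δ f k)))
        }
        where
        open OddWith (odd-at f)
        ring₁ : ∀ a → -1ℤ * - a ≡ - (-1ℤ * a)
        ring₁ = solve-∀
        ring₂ : ∀ a → - a ≡ -1ℤ * a
        ring₂ = solve-∀
        ring₃ : ∀ a → -1ℤ * (+ 2 * a) ≡ + 2 * (-1ℤ * a)
        ring₃ = solve-∀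

    module HalfOf {s} (o : OddWith s) where

      open OddWith o

      half : ∀ u v → ∃ λ h → Adj G u v → + 2 * h ≡ 1ℤ + D u v
      half u v with parity (1ℤ + D u v)
      ... | inj₁ (h , e) = h , λ _ → sym e
      ... | inj₂ o       = 0ℤ , λ a → ⊥-elim (even-odd (odd+odd (0ℤ , refl) (odd a)) o)

      opaque

        k : Fin n → Fin n → ℤ
        k u v = proj₁ (half u v)

        double-k : ∀ {u v} → Adj G u v → + 2 * k u v ≡ 1ℤ + D u v
        double-k {u} {v} = proj₂ (half u v)

      k-sum : ∀ {u v} → Adj G u v → k u v + k v u ≡ 1ℤ
      k-sum {u} {v} a = *-cancelˡ-≡ (+ 2) (k u v + k v u) 1ℤ (trans (*-distribˡ-+ (+ 2) (k u v) (k v u)) (trans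
        (cong₂ _+_ (double-k a) (double-k (adj-sym a)))
        (trans (cong (λ d → 1ℤ + D u v + (1ℤ + d)) (antisym u v)) (ring (D u v)))))
        where
        ring : ∀ d → 1ℤ + d + (1ℤ + - d) ≡ + 2
        ring = solve-∀

    reference : ∀ {s} → OddWith s → Reference G
    reference o = record { k = HalfOf.k o ; k-sum = HalfOf.k-sum o }

    positive-at negative-at : Fin F → Reference G
    positive-at f = reference (odd-at f)
    negative-at f = reference (odd-at-neg f)

    -- A potential of the difference of two functions with the same face sums
    -- translates the fractional solution belonging to D into one for D′.
    module Cover {χ} (S : SingleFace χ) {s : Fin F → ℤ} (o : OddWith s)
      (same-sums : ∀ k → faceSum k (SingleFace.D S) ≡ + 2 * s k) where

      open SingleFace S using (small) renaming (D to D; antisym to anti)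
      open OddWith o renaming (D to D′; antisym to anti′; sums to sums′)
      open HalfOf o using (k; double-k)

      private
        difference : Fin n → Fin n → ℤ
        difference u v = D′ u v + -1ℤ * D u v

      difference-antisym : Antisymmetric difference
      difference-antisym u v = trans (cong₂ (λ a b → a + -1ℤ * b) (anti′ u v) (anti u v)) (ring (D′ u v) (D u v))
        where
        ring : ∀ a b → - a + -1ℤ * - b ≡ - (a + -1ℤ * b)
        ring = solve-∀

      difference-closed : ∀ f → faceSum f difference ≡ 0ℤ
      difference-closed f = trans (faceSum-+ f D′ (λ u v → -1ℤ * D u v)) (trans (cong₂ _+_ (sums′ f)
          (trans (faceSum-* f -1ℤ D) (cong (_*_ -1ℤ) (same-sums f)))) (ring (s f)))
        where
        ring : ∀ d → + 2 * d + -1ℤ * (+ 2 * d) ≡ 0ℤ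
        ring = solve-∀

      from-potential : ∀ (t : ℕ) (X : Fin n → ℤ) → (∀ {u v} → Adj G u v → + suc t * difference u v ≡ X v + - X u) →
        Covered χ (reference o)
      -- The denominator `suc (t + suc t)` is 2c. After division by it, p and q are - χ / 2 and χ /
      -- 2, both shifted by X / (2c); the shift replaces the bound in terms of `D` by the one in
      -- terms of `D′`.
      from-potential t X h = t ℕ.+ suc t , (λ u → X u + - (c * χ u)) , (λ u → X u + c * χ u) ,
        (λ u → ring₃ (X u) c (χ u)) , inequality
        where
        c : ℤ
        c = + suc t
        ring₃ : ∀ x s c → x + s * c ≡ x + - (s * c) + (s + s) * c
        ring₃ = solve-∀
        ring₄ : ∀ x y s a b → x + s * b + - (y + - (s * a)) ≡ (x + - y) + s * (a + b)
        ring₄ = solve-∀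
        ring₅ : ∀ s p q c → s * (p + -1ℤ * q) + s * c ≡ s * (p + (c + - q))
        ring₅ = solve-∀
        ring₆ : ∀ s k → s * (+ 2 * k) ≡ (s + s) * k
        ring₆ = solve-∀
        inequality : ∀ {u v} → Adj G u v → X v + c * χ v + - (X u + - (c * χ u)) ≤ (c + c) * k u v
        inequality {u} {v} a = subst₂ _≤_
          (sym (trans (ring₄ (X v) (X u) c (χ u) (χ v)) (trans (cong (_+ c * (χ u + χ v)) (sym (h a)))
            (ring₅ c (D′ u v) (D u v) (χ u + χ v)))))
          (trans (cong (_*_ c) (trans (+-comm (D′ u v) 1ℤ) (sym (double-k a)))) (ring₆ c (k u v)))
          (*-monoˡ-≤-nonNeg c (+-monoʳ-≤ (D′ u v) (small a)))

      covered : Covered χ (reference o)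
      covered = from-potential (proj₁ p) (proj₁ (proj₂ p)) (proj₂ (proj₂ p))
        where p = closed⇒coboundary⁺ difference difference-antisym difference-closed

    opaque

      covered-by : ∀ χ (indicator : StableIndicator G χ) → ∃ λ f → Covered χ (positive-at f) ⊎ Covered χ (negative-at f)
      covered-by χ indicator = f , choose unit sums
        where
        S : SingleFace χ
        S = single-face χ indicator
        open SingleFace S
        ring : ∀ a → -1ℤ * (+ 2 * a) ≡ + 2 * (-1ℤ * a)
        ring = solve-∀
        choose : ∀ {ε} → IsUnit ε → (∀ k → faceSum k D ≡ ε * (+ 2 * δ f k)) → Covered χ (positive-at f) ⊎ Covered χ (negative-at f)
        choose (inj₁ refl) sums = inj₁ (Cover.covered S (odd-at f) (λ k → trans (sums k) (*-identityˡ (+ 2 * δ f k))))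
        choose (inj₂ refl) sums = inj₂ (Cover.covered S (odd-at-neg f) (λ k → trans (sums k) (ring (δ f k))))

-- Rational systems with integral coefficients, denominators cleared.

module IntegralSystems where

  open import Data.Integer using (_*_; _≤_)
  open IntegerSums
  open Cycles

  ι : ℤ → ℚ
  ι i = mkℚ i 0 (Coprime.sym (Coprime.1-coprimeTo ∣ i ∣))

  ι-+ : ∀ i j → ι (i + j) ≡ ι i ℚ.+ ι j
  ι-+ i j = ℚ.toℚᵘ-injective (ℚᵘ.≃-sym (ℚᵘ.≃-trans (ℚ.toℚᵘ-homo-+ (ι i) (ι j)) (*≡* (ring i j))))
    where
    ring : ∀ i j → (i * + 1 + j * + 1) * + 1 ≡ (i + j) * + 1
    ring = solve-∀

  ι-* : ∀ i j → ι (i * j) ≡ ι i ℚ.* ι j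
  ι-* i j = ℚ.toℚᵘ-injective (ℚᵘ.≃-sym (ℚᵘ.≃-trans (ℚ.toℚᵘ-homo-* (ι i) (ι j)) (*≡* refl)))

  ι-mono : ∀ {i j} → i ≤ j → ι i ℚ.≤ ι j
  ι-mono {i} {j} l = *≤* (subst₂ _≤_ (sym (*-identityʳ i)) (sym (*-identityʳ j)) l)

  ι-cancel : ∀ {i j} → ι i ℚ.≤ ι j → i ≤ j
  ι-cancel {i} {j} (*≤* l) = subst₂ _≤_ (*-identityʳ i) (*-identityʳ j) l

  numerator : ∀ p → p ℚ.* ι (ℚ.↧ p) ≡ ι (ℚ.↥ p)
  numerator p@(mkℚ n d _) = ℚ.toℚᵘ-injective (ℚᵘ.≃-trans (ℚ.toℚᵘ-homo-* p (ι (ℚ.↧ p)))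
    (*≡* (trans (*-identityʳ (n * + suc d)) (cong (λ k → n * + suc k) (sym (ℕ.*-identityʳ d))))))

  opaque

    recip : ℕ → ℚ
    recip N = ℚ.1/ ι (+ suc N)

    recip-inverse : ∀ N → recip N ℚ.* ι (+ suc N) ≡ 1ℚ
    recip-inverse N = ℚ.*-inverseˡ (ι (+ suc N))

    recip≥0 : ∀ N → 0ℚ ℚ.≤ recip N
    recip≥0 N = ℚ.nonNegative⁻¹ (recip N) {{ℚ.pos⇒nonNeg (recip N) {{ℚ.1/pos⇒pos (ι (+ suc N))}}}}

  Scaled : ∀ {k} → ℕ → (Fin k → ℚ) → (Fin k → ℤ) → Set
  Scaled N f X = ∀ i → f i ℚ.* ι (+ suc N) ≡ ι (X i)

  rescale : ∀ {k} (f : Fin k → ℚ) {X} N M → Scaled N f X → Scaled (M ℕ.+ N ℕ.* suc M) f (λ i → X i * + suc M)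
  rescale f {X} N M h i = begin
    f i ℚ.* ι (+ (suc N ℕ.* suc M))                ≡⟨ cong (λ z → f i ℚ.* ι z) (pos-* (suc N) (suc M)) ⟩
    f i ℚ.* ι (+ suc N * + suc M)                  ≡⟨ cong (f i ℚ.*_) (ι-* (+ suc N) (+ suc M)) ⟩
    f i ℚ.* (ι (+ suc N) ℚ.* ι (+ suc M))          ≡⟨ sym (ℚ.*-assoc (f i) (ι (+ suc N)) (ι (+ suc M))) ⟩
    (f i ℚ.* ι (+ suc N)) ℚ.* ι (+ suc M)          ≡⟨ cong (ℚ._* ι (+ suc M)) (h i) ⟩
    ι (X i) ℚ.* ι (+ suc M)                        ≡⟨ sym (ι-* (X i) (+ suc M)) ⟩
    ι (X i * + suc M)                              ∎

  common-denominator : ∀ {k} (f : Fin k → ℚ) → ∃₂ λ (N : ℕ) (X : Fin k → ℤ) → Scaled N f X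
  common-denominator {zero}  f = 0 , (λ ()) , λ ()
  common-denominator {suc k} f with common-denominator (f ∘ suc) | f zero in eq
  ... | N , X , h | p@(mkℚ n d _) = N ℕ.+ d ℕ.* suc N , Y , scaled
    where
    Y : Fin (suc k) → ℤ
    Y zero    = n * + suc N
    Y (suc i) = X i * + suc d
    swap-suc : N ℕ.+ d ℕ.* suc N ≡ d ℕ.+ N ℕ.* suc d
    swap-suc = ℕ.suc-injective (ℕ.*-comm (suc d) (suc N))
    scaled : Scaled (N ℕ.+ d ℕ.* suc N) f Y
    scaled zero    = rescale {1} (λ _ → f zero) {λ _ → n} d N (λ _ → trans (cong (ℚ._* ι (+ suc d)) eq) (numerator p)) zero
    scaled (suc i) = subst (λ M → f (suc i) ℚ.* ι (+ suc M) ≡ ι (X i * + suc d)) (sym swap-suc) (rescale (f ∘ suc) {X} N d h i)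

  Σℚ-cong : ∀ {k} {f g : Fin k → ℚ} → (∀ i → f i ≡ g i) → Σℚ f ≡ Σℚ g
  Σℚ-cong {zero}  h = refl
  Σℚ-cong {suc k} h = cong₂ ℚ._+_ (h zero) (Σℚ-cong (h ∘ suc))

  Σℚ-zero : ∀ k → Σℚ {k} (λ _ → 0ℚ) ≡ 0ℚ
  Σℚ-zero zero    = refl
  Σℚ-zero (suc k) = trans (ℚ.+-identityˡ _) (Σℚ-zero k)

  ℚ-swap : ∀ a b c d → (a ℚ.+ b) ℚ.+ (c ℚ.+ d) ≡ (a ℚ.+ c) ℚ.+ (b ℚ.+ d)
  ℚ-swap a b c d = begin
    (a ℚ.+ b) ℚ.+ (c ℚ.+ d) ≡⟨ ℚ.+-assoc a b (c ℚ.+ d) ⟩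
    a ℚ.+ (b ℚ.+ (c ℚ.+ d)) ≡⟨ cong (a ℚ.+_) (trans (sym (ℚ.+-assoc b c d)) (trans (cong (ℚ._+ d) (ℚ.+-comm b c)) (ℚ.+-assoc c b d))) ⟩
    a ℚ.+ (c ℚ.+ (b ℚ.+ d)) ≡⟨ sym (ℚ.+-assoc a c (b ℚ.+ d)) ⟩
    (a ℚ.+ c) ℚ.+ (b ℚ.+ d) ∎

  Σℚ-+ : ∀ {k} (f g : Fin k → ℚ) → Σℚ (λ i → f i ℚ.+ g i) ≡ Σℚ f ℚ.+ Σℚ g
  Σℚ-+ {zero}  f g = sym (ℚ.+-identityˡ 0ℚ)
  Σℚ-+ {suc k} f g = trans (cong ((f zero ℚ.+ g zero) ℚ.+_) (Σℚ-+ (f ∘ suc) (g ∘ suc))) (ℚ-swap (f zero) (g zero) _ _)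

  Σℚ-*ˡ : ∀ {k} a (f : Fin k → ℚ) → Σℚ (λ i → a ℚ.* f i) ≡ a ℚ.* Σℚ f
  Σℚ-*ˡ {zero}  a f = sym (ℚ.*-zeroʳ a)
  Σℚ-*ˡ {suc k} a f = trans (cong (a ℚ.* f zero ℚ.+_) (Σℚ-*ˡ a (f ∘ suc))) (sym (ℚ.*-distribˡ-+ a (f zero) _))

  Σℚ-comm : ∀ {k l} (f : Fin k → Fin l → ℚ) → Σℚ (λ i → Σℚ (f i)) ≡ Σℚ (λ j → Σℚ (λ i → f i j))
  Σℚ-comm {zero}  {l} f = sym (Σℚ-zero l)
  Σℚ-comm {suc k} f = trans (cong (Σℚ (f zero) ℚ.+_) (Σℚ-comm (f ∘ suc))) (sym (Σℚ-+ (f zero) _))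

  Σℚ-mono : ∀ {k} {f g : Fin k → ℚ} → (∀ i → f i ℚ.≤ g i) → Σℚ f ℚ.≤ Σℚ g
  Σℚ-mono {zero}  h = ℚ.≤-refl
  Σℚ-mono {suc k} h = ℚ.+-mono-≤ (h zero) (Σℚ-mono (h ∘ suc))

  dotℚ : ∀ {k} → (Fin k → ℚ) → (Fin k → ℚ) → ℚ
  dotℚ a x = Σℚ (λ i → a i ℚ.* x i)

  dot-scaled : ∀ {k} N (a : Fin k → ℤ) (x : Fin k → ℚ) X → Scaled N x X →
    dotℚ (ι ∘ a) x ℚ.* ι (+ suc N) ≡ ι (a ⊙ X)
  dot-scaled {zero}  N a x X h = ℚ.*-zeroˡ (ι (+ suc N))
  dot-scaled {suc k} N a x X h = begin
    (ι (a zero) ℚ.* x zero ℚ.+ dotℚ (ι ∘ a ∘ suc) (x ∘ suc)) ℚ.* c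
      ≡⟨ ℚ.*-distribʳ-+ c (ι (a zero) ℚ.* x zero) _ ⟩
    (ι (a zero) ℚ.* x zero) ℚ.* c ℚ.+ dotℚ (ι ∘ a ∘ suc) (x ∘ suc) ℚ.* c
      ≡⟨ cong₂ ℚ._+_ (trans (ℚ.*-assoc (ι (a zero)) (x zero) c) (trans (cong (ι (a zero) ℚ.*_) (h zero)) (sym (ι-* (a zero) (X zero)))))
                     (dot-scaled N (a ∘ suc) (x ∘ suc) (X ∘ suc) (h ∘ suc)) ⟩
    ι (a zero * X zero) ℚ.+ ι ((a ∘ suc) ⊙ (X ∘ suc))
      ≡⟨ sym (ι-+ (a zero * X zero) _) ⟩
    ι (a ⊙ X) ∎
    where
    c = ι (+ suc N)

  dot-combination : ∀ {k l} (a : Fin k → ℚ) (w : Fin l → ℚ) (X : Fin l → Fin k → ℚ) →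
    dotℚ a (λ i → Σℚ (λ j → w j ℚ.* X j i)) ≡ Σℚ (λ j → w j ℚ.* dotℚ a (X j))
  dot-combination a w X = begin
    Σℚ (λ i → a i ℚ.* Σℚ (λ j → w j ℚ.* X j i))
      ≡⟨ Σℚ-cong (λ i → trans (sym (Σℚ-*ˡ (a i) (λ j → w j ℚ.* X j i))) (Σℚ-cong λ j → exchange (a i) (w j) (X j i))) ⟩
    Σℚ (λ i → Σℚ (λ j → w j ℚ.* (a i ℚ.* X j i)))
      ≡⟨ Σℚ-comm (λ i j → w j ℚ.* (a i ℚ.* X j i)) ⟩
    Σℚ (λ j → Σℚ (λ i → w j ℚ.* (a i ℚ.* X j i)))
      ≡⟨ Σℚ-cong (λ j → Σℚ-*ˡ (w j) (λ i → a i ℚ.* X j i)) ⟩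
    Σℚ (λ j → w j ℚ.* dotℚ a (X j)) ∎
    where
    exchange : ∀ p q r → p ℚ.* (q ℚ.* r) ≡ q ℚ.* (p ℚ.* r)
    exchange p q r = trans (sym (ℚ.*-assoc p q r)) (trans (cong (ℚ._* r) (ℚ.*-comm p q)) (ℚ.*-assoc q p r))

  record Row (n d : ℕ) : Set where
    constructor row
    field
      a : Fin n → ℤ
      b : Fin d → ℤ
      c : ℤ

  Holdsℚ : ∀ {n d} → Row n d → (Fin n → ℚ) → (Fin d → ℚ) → Set
  Holdsℚ (row a b c) x y = dotℚ (ι ∘ a) x ℚ.+ dotℚ (ι ∘ b) y ℚ.≤ ι c

  -- The constraint multiplied by `suc N`, for `X` and `Y` that are numerators over `suc N`.
  HoldsAt : ∀ {n d} → ℕ → Row n d → (Fin n → ℤ) → (Fin d → ℤ) → Set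
  HoldsAt N (row a b c) X Y = a ⊙ X + b ⊙ Y ≤ c * + suc N

  module _ {n d : ℕ} (N : ℕ) (x : Fin n → ℚ) (y : Fin d → ℚ) {X Y} (hx : Scaled N x X) (hy : Scaled N y Y) where

    private
      s : ℚ
      s = ι (+ suc N)

      instance
        s>0 : ℚ.Positive s
        s>0 = ℚ.positive {s} (ℚ.*<* (+<+ (s≤s z≤n)))
        s≥0 : ℚ.NonNegative s
        s≥0 = ℚ.pos⇒nonNeg s

      scaled-lhs : ∀ (r : Row n d) → let open Row r in
        (dotℚ (ι ∘ a) x ℚ.+ dotℚ (ι ∘ b) y) ℚ.* s ≡ ι (a ⊙ X + b ⊙ Y)
      scaled-lhs (row a b c) = begin
        (dotℚ (ι ∘ a) x ℚ.+ dotℚ (ι ∘ b) y) ℚ.* s       ≡⟨ ℚ.*-distribʳ-+ s (dotℚ (ι ∘ a) x) _ ⟩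
        dotℚ (ι ∘ a) x ℚ.* s ℚ.+ dotℚ (ι ∘ b) y ℚ.* s   ≡⟨ cong₂ ℚ._+_ (dot-scaled N a x X hx) (dot-scaled N b y Y hy) ⟩
        ι (a ⊙ X) ℚ.+ ι (b ⊙ Y)                         ≡⟨ sym (ι-+ (a ⊙ X) (b ⊙ Y)) ⟩
        ι (a ⊙ X + b ⊙ Y)                               ∎

    holdsℚ⇒holdsAt : ∀ r → Holdsℚ r x y → HoldsAt N r X Y
    holdsℚ⇒holdsAt r h = ι-cancel (subst₂ ℚ._≤_ (scaled-lhs r) (sym (ι-* (Row.c r) (+ suc N)))
      (ℚ.*-monoʳ-≤-nonNeg s h))

    holdsAt⇒holdsℚ : ∀ r → HoldsAt N r X Y → Holdsℚ r x y
    holdsAt⇒holdsℚ r h = ℚ.*-cancelʳ-≤-pos s (subst₂ ℚ._≤_ (sym (scaled-lhs r)) (ι-* (Row.c r) (+ suc N)) (ι-mono h))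

  indicator : ∀ {n} → Subset n → Fin n → ℤ
  indicator S i = if Vec.lookup S i then 1ℤ else 0ℤ

  χ-ι : ∀ {n} (S : Subset n) i → χ S i ≡ ι (indicator S i)
  χ-ι S i with Vec.lookup S i
  ... | true  = refl
  ... | false = refl

  -- A criterion within the integers: stable sets lift to solutions over some denominator, and a
  -- solution over `suc N` is a sum of `suc N` stable sets. Convex combinations of lifts give one
  -- inclusion; clearing denominators and averaging the sets gives the other.
  module IntegralFormulation {n d : ℕ} (G : Graph n) (rows : List (Row n d))
    (complete : ∀ S → Stable G S → ∃₂ λ (N : ℕ) (Y : Fin d → ℤ) → All (λ r → HoldsAt N r (λ i → + suc N * indicator S i) Y) rows)
    (sound : ∀ N X Y → All (λ r → HoldsAt N r X Y) rows →
      ∃ λ L → All (Stable G) L × length L ≡ suc N × (∀ i → lsum (λ S → indicator S i) L ≡ X i))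
    where

    private
      Feasible : (Fin n → ℚ) → (Fin d → ℚ) → Set
      Feasible x y = ∀ r → Holdsℚ (lookup rows r) x y

      vertex : ∀ S → Stable G S → ∃ λ y → Feasible (χ S) y
      vertex S stable with complete S stable
      ... | N , Y , holds = y , λ r → holdsAt⇒holdsℚ N (χ S) y scaled-χ scaled-y (lookup rows r) (All.lookup holds (∈-lookup r))
        where
        y : Fin d → ℚ
        y j = ι (Y j) ℚ.* recip N
        scaled-χ : Scaled N (χ S) (λ i → + suc N * indicator S i)
        scaled-χ i = trans (cong (ℚ._* ι (+ suc N)) (χ-ι S i)) (trans (sym (ι-* (indicator S i) (+ suc N)))
                       (cong ι (*-comm (indicator S i) (+ suc N))))
        scaled-y : Scaled N y Y
        scaled-y j = trans (ℚ.*-assoc (ι (Y j)) (recip N) (ι (+ suc N)))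
                           (trans (cong (ι (Y j) ℚ.*_) (recip-inverse N)) (ℚ.*-identityʳ (ι (Y j))))

      forwards : ∀ x → InSTAB G x → ∃ λ y → Feasible x y
      forwards x (k , S , w , stable , w≥0 , Σw , x≡) = y , λ r → feasible (lookup rows r) (λ j → proj₂ (vertex (S j) (stable j)) r)
        where
        Y : Fin k → Fin d → ℚ
        Y j = proj₁ (vertex (S j) (stable j))
        y : Fin d → ℚ
        y i = Σℚ (λ j → w j ℚ.* Y j i)
        feasible : ∀ r → (∀ j → Holdsℚ r (χ (S j)) (Y j)) → Holdsℚ r x y
        feasible (row a b c) h = subst₂ ℚ._≤_ (sym lhs) rhs
          (Σℚ-mono λ j → ℚ.*-monoˡ-≤-nonNeg (w j) {{ℚ.nonNegative (w≥0 j)}} (h j))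
          where
          lhs : dotℚ (ι ∘ a) x ℚ.+ dotℚ (ι ∘ b) y ≡ Σℚ (λ j → w j ℚ.* (dotℚ (ι ∘ a) (χ (S j)) ℚ.+ dotℚ (ι ∘ b) (Y j)))
          lhs = begin
            dotℚ (ι ∘ a) x ℚ.+ dotℚ (ι ∘ b) y
              ≡⟨ cong₂ ℚ._+_ (trans (Σℚ-cong λ i → cong (ι (a i) ℚ.*_) (x≡ i)) (dot-combination (ι ∘ a) w (λ j → χ (S j))))
                             (dot-combination (ι ∘ b) w Y) ⟩
            Σℚ (λ j → w j ℚ.* dotℚ (ι ∘ a) (χ (S j))) ℚ.+ Σℚ (λ j → w j ℚ.* dotℚ (ι ∘ b) (Y j))
              ≡⟨ sym (Σℚ-+ (λ j → w j ℚ.* dotℚ (ι ∘ a) (χ (S j))) _) ⟩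
            Σℚ (λ j → w j ℚ.* dotℚ (ι ∘ a) (χ (S j)) ℚ.+ w j ℚ.* dotℚ (ι ∘ b) (Y j))
              ≡⟨ Σℚ-cong (λ j → sym (ℚ.*-distribˡ-+ (w j) (dotℚ (ι ∘ a) (χ (S j))) (dotℚ (ι ∘ b) (Y j)))) ⟩
            Σℚ (λ j → w j ℚ.* (dotℚ (ι ∘ a) (χ (S j)) ℚ.+ dotℚ (ι ∘ b) (Y j))) ∎
          rhs : Σℚ (λ j → w j ℚ.* ι c) ≡ ι c
          rhs = trans (Σℚ-cong λ j → ℚ.*-comm (w j) (ι c)) (trans (Σℚ-*ˡ (ι c) w)
                  (trans (cong (ι c ℚ.*_) Σw) (ℚ.*-identityʳ (ι c))))

      Σℚ-lookup : ∀ (L : List (Subset n)) s i →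
        Σℚ (λ j → s ℚ.* χ (lookup L j) i) ≡ s ℚ.* ι (lsum (λ S → indicator S i) L)
      Σℚ-lookup []      s i = sym (ℚ.*-zeroʳ s)
      Σℚ-lookup (S ∷ L) s i = trans (cong₂ ℚ._+_ (cong (s ℚ.*_) (χ-ι S i)) (Σℚ-lookup L s i))
        (trans (sym (ℚ.*-distribˡ-+ s (ι (indicator S i)) _)) (cong (s ℚ.*_) (sym (ι-+ (indicator S i) _))))

      Σℚ-const : ∀ k s → Σℚ {k} (λ _ → s) ≡ s ℚ.* ι (+ k)
      Σℚ-const zero    s = sym (ℚ.*-zeroʳ s)
      Σℚ-const (suc k) s = trans (cong₂ ℚ._+_ (sym (ℚ.*-identityʳ s)) (Σℚ-const k s))
        (trans (sym (ℚ.*-distribˡ-+ s 1ℚ (ι (+ k)))) (cong (s ℚ.*_) (sym (ι-+ 1ℤ (+ k)))))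

      backwards : ∀ x y → Feasible x y → InSTAB G x
      backwards x y feasible with common-denominator x | common-denominator y
      ... | N₁ , X₁ , hx | N₂ , Y₂ , hy = from-list (sound N X Y (All.tabulate λ {r} r∈ →
              holdsℚ⇒holdsAt N x y scaled-x scaled-y r (subst (λ r → Holdsℚ r x y) (sym (Any.lookup-index r∈)) (feasible (Any.index r∈)))))
        where
        -- Its successor computes to `suc N₁ * suc N₂`, a common denominator of `x` and `y`.
        N : ℕ
        N = N₂ ℕ.+ N₁ ℕ.* suc N₂
        X : Fin n → ℤ
        X i = X₁ i * + suc N₂
        Y : Fin d → ℤ
        Y j = Y₂ j * + suc N₁
        scaled-x : Scaled N x X
        scaled-x = rescale x {X₁} N₁ N₂ hx
        scaled-y : Scaled N y Y
        scaled-y j = subst (λ M → y j ℚ.* ι (+ suc M) ≡ ι (Y j)) (ℕ.suc-injective (ℕ.*-comm (suc N₂) (suc N₁)))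
                       (rescale y {Y₂} N₂ N₁ hy j)
        from-list : (∃ λ L → All (Stable G) L × length L ≡ suc N × (∀ i → lsum (λ S → indicator S i) L ≡ X i)) → InSTAB G x
        from-list (L , stable , len , sums) =
          length L , lookup L , (λ _ → recip N) ,
          (λ j → All.lookup stable (∈-lookup j)) , (λ _ → recip≥0 N) ,
          trans (Σℚ-const (length L) (recip N)) (trans (cong (λ k → recip N ℚ.* ι (+ k)) len) (recip-inverse N)) ,
          λ i → begin
            x i                                      ≡⟨ sym (ℚ.*-identityʳ (x i)) ⟩
            x i ℚ.* 1ℚ                               ≡⟨ cong (x i ℚ.*_) (trans (sym (recip-inverse N)) (ℚ.*-comm (recip N) (ι (+ suc N)))) ⟩
            x i ℚ.* (ι (+ suc N) ℚ.* recip N)        ≡⟨ sym (ℚ.*-assoc (x i) (ι (+ suc N)) (recip N)) ⟩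
            (x i ℚ.* ι (+ suc N)) ℚ.* recip N        ≡⟨ cong (ℚ._* recip N) (scaled-x i) ⟩
            ι (X i) ℚ.* recip N                      ≡⟨ ℚ.*-comm (ι (X i)) (recip N) ⟩
            recip N ℚ.* ι (X i)                      ≡⟨ cong (λ z → recip N ℚ.* ι z) (sym (sums i)) ⟩
            recip N ℚ.* ι (lsum (λ S → indicator S i) L) ≡⟨ sym (Σℚ-lookup L (recip N) i) ⟩
            Σℚ (λ j → recip N ℚ.* χ (lookup L j) i)  ∎

    formulation : ExtendedFormulation n (InSTAB G)
    formulation = record
      { m = length rows ; d = d
      ; A = λ r → ι ∘ Row.a (lookup rows r)
      ; B = λ r → ι ∘ Row.b (lookup rows r)
      ; b = λ r → ι (Row.c (lookup rows r))
      ; correct = λ x → forwards x , λ (y , feasible) → backwards x y feasible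
      }

-- Rounding to stable sets, and the disjunctive union.

module Unions where

  open import Data.Integer using (_*_; _≤_)
  open IntegerSums
  open Cycles
  open FiniteGraphs
  open ParityAndFloor
  open Covers
  open IntegralSystems

  lsum-++ : ∀ {A : Set} (f : A → ℤ) xs ys → lsum f (xs ++ ys) ≡ lsum f xs + lsum f ys
  lsum-++ f []       ys = sym (+-identityˡ (lsum f ys))
  lsum-++ f (x ∷ xs) ys = trans (cong (_+_ (f x)) (lsum-++ f xs ys)) (sym (+-assoc (f x) (lsum f xs) (lsum f ys)))

  lsum-collect : ∀ {A : Set} {k} (f : A → ℤ) (L : Fin k → List A) → lsum f (collect L) ≡ sum (λ i → lsum f (L i))
  lsum-collect {k = zero}  f L = refl
  lsum-collect {k = suc k} f L = trans (lsum-++ f (L zero) (collect (L ∘ suc))) (cong (_+_ (lsum f (L zero))) (lsum-collect f (L ∘ suc)))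

  lsum-tabulate : ∀ {A : Set} {k} (f : A → ℤ) (g : Fin k → A) → lsum f (tabulate g) ≡ sum (f ∘ g)
  lsum-tabulate {k = zero}  f g = refl
  lsum-tabulate {k = suc k} f g = cong (_+_ (f (g zero))) (lsum-tabulate f (g ∘ suc))

  Σℕ-const : ∀ k c → Σℕ {k} (λ _ → c) ≡ k ℕ.* c
  Σℕ-const zero    c = refl
  Σℕ-const (suc k) c = cong (c ℕ.+_) (Σℕ-const k c)

  sparse : ∀ {d} → List (ℤ × Fin d) → Fin d → ℤ
  sparse l j = lsum (λ (c , i) → c * δ i j) l

  eval : ∀ {d} → List (ℤ × Fin d) → (Fin d → ℤ) → ℤ
  eval l Y = lsum (λ (c , i) → c * Y i) l

  sparse-⊙ : ∀ {d} (l : List (ℤ × Fin d)) Y → sparse l ⊙ Y ≡ eval l Y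
  sparse-⊙ []            Y = sum-zero (λ j → 0ℤ * Y j) λ _ → refl
  sparse-⊙ ((c , i) ∷ l) Y = begin
    sum (λ j → (c * δ i j + sparse l j) * Y j)
      ≡⟨ sum-cong (λ j → ring c (δ i j) (sparse l j) (Y j)) ⟩
    sum (λ j → c * (δ i j * Y j) + sparse l j * Y j)
      ≡⟨ sum-+ (λ j → c * (δ i j * Y j)) (λ j → sparse l j * Y j) ⟩
    sum (λ j → c * (δ i j * Y j)) + sparse l ⊙ Y
      ≡⟨ cong₂ _+_ (trans (sum-*ˡ c (λ j → δ i j * Y j)) (cong (_*_ c) (sum-δ i Y))) (sparse-⊙ l Y) ⟩
    c * Y i + eval l Y ∎
    where
    ring : ∀ c d s y → (c * d + s) * y ≡ c * (d * y) + s * y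
    ring = solve-∀

  -- Summing over a full period of shifts turns rounding into the identity.
  module _ (t : ℕ) {{_ : ℕ.NonZero t}} where

    open Floor t

    sum-shift : ∀ k (g : ℕ → ℤ) → sum {k} (λ j → g (suc (toℕ j))) + g 0 ≡ sum {k} (λ j → g (toℕ j)) + g k
    sum-shift zero    g = refl
    sum-shift (suc k) g = trans (ring₁ (g 1) (sum {k} (λ j → g (suc (suc (toℕ j))))) (g 0))
      (trans (cong (_+ g 0) (sum-shift k (g ∘ suc))) (ring₂ (sum {k} (λ j → g (suc (toℕ j)))) (g (suc k)) (g 0)))
      where
      ring₁ : ∀ a b c → a + b + c ≡ (b + a) + c
      ring₁ = solve-∀
      ring₂ : ∀ a b c → (a + b) + c ≡ (c + a) + b
      ring₂ = solve-∀

    roundings : ℤ → ℤ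
    roundings a = sum {t} (λ j → floor (a + + toℕ j))

    -- The increment moves every shift to the next one and replaces the integer part for a by that
    -- for a + t, which is larger by 1. This is Hermite's identity up to an additive constant, which
    -- cancels in differences.
    roundings-suc : ∀ a → roundings (a + 1ℤ) ≡ roundings a + 1ℤ
    roundings-suc a = +-cancelʳ (floor (a + 0ℤ)) (trans
      (cong (_+ floor (a + 0ℤ)) (sum-cong {t} λ j → cong floor (+-assoc a 1ℤ (+ toℕ j))))
      (trans (sum-shift t (λ j → floor (a + + j)))
      (trans (cong (_+_ (roundings a)) (trans (cong floor (ring₁ a (+ t))) (floor-shift (a + 0ℤ) 1ℤ)))
             (ring₂ (roundings a) (floor (a + 0ℤ))))))
      where
      +-cancelʳ : ∀ c {a b} → a + c ≡ b + c → a ≡ b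
      +-cancelʳ c {a} {b} e = trans (ring a c) (trans (cong (_+ - c) e) (sym (ring b c)))
        where
        ring : ∀ a c → a ≡ (a + c) + - c
        ring = solve-∀
      ring₁ : ∀ a t → a + t ≡ (a + 0ℤ) + 1ℤ * t
      ring₁ = solve-∀
      ring₂ : ∀ r f → r + (f + 1ℤ) ≡ (r + 1ℤ) + f
      ring₂ = solve-∀

    roundings-+ : ∀ a m → roundings (a + + m) ≡ roundings a + + m
    roundings-+ a zero    = trans (cong roundings (+-identityʳ a)) (sym (+-identityʳ (roundings a)))
    roundings-+ a (suc m) = trans (cong roundings (ring a (+ m))) (trans (roundings-suc (a + + m))
      (trans (cong (_+ 1ℤ) (roundings-+ a m)) (sym (ring (roundings a) (+ m)))))
      where
      ring : ∀ a m → a + (1ℤ + m) ≡ (a + m) + 1ℤ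
      ring = solve-∀

    roundings-diff : ∀ {a b} → a ≤ b → roundings b + - roundings a ≡ b + - a
    roundings-diff {a} {b} l with b + - a in eq | i≤j⇒0≤j-i l
    ... | + m | _ = trans (cong (λ s → roundings s + - roundings a) (trans (ring₁ b a) (cong (_+_ a) eq)))
                          (trans (cong (_+ - roundings a) (roundings-+ a m)) (ring₂ (roundings a) (+ m)))
      where
      ring₁ : ∀ b a → b ≡ a + (b + - a)
      ring₁ = solve-∀
      ring₂ : ∀ r m → (r + m) + - r ≡ m
      ring₂ = solve-∀

    floor-step : ∀ {a b} → a ≤ b → b ≤ a + + t → floor b ≡ floor a ⊎ floor b ≡ 1ℤ + floor a
    floor-step {a} {b} l l′ with floor b ≤? floor a
    ... | yes m = inj₁ (≤-antisym m (floor-mono l))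
    ... | no ¬m = inj₂ (≤-antisym
      (≤-trans (floor-mono l′) (≤-reflexive (trans (cong floor (cong (_+_ a) (sym (*-identityˡ (+ t)))))
                                             (trans (floor-shift a 1ℤ) (+-comm (floor a) 1ℤ)))))
      (i<j⇒suc[i]≤j (≰⇒> ¬m)))

  module Rounding {n : ℕ} {G : Graph n} (R : Reference G) (t : ℕ) {{_ : ℕ.NonZero t}} (P Q : Fin n → ℤ)
    (edge : ∀ {u v} → Adj G u v → Q v + - P u ≤ Reference.k R u v * + t)
    (low : ∀ u → P u ≤ Q u) (high : ∀ u → Q u ≤ P u + + t) where

    open Reference R
    open Edges G
    open Floor t

    In : Fin t → Fin n → Set
    In j u = floor (P u + + toℕ j) < floor (Q u + + toℕ j)

    In? : ∀ j u → Dec (In j u)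
    In? j u = floor (P u + + toℕ j) <? floor (Q u + + toℕ j)

    rounded : Fin t → Subset n
    rounded j = subset {n} {In j} (In? j)

    bound : ∀ (j : Fin t) {u v} → Adj G u v → floor (Q v + + toℕ j) ≤ floor (P u + + toℕ j) + k u v
    bound j {u} {v} a = subst (floor (Q v + i) ≤_) (floor-shift (P u + i) (k u v)) (floor-mono
      (subst (_≤ P u + i + k u v * + t) (ring₁ (Q v) (P u) i) (+-monoʳ-≤ (P u + i) (edge a))))
      where
      i : ℤ
      i = + toℕ j
      ring₁ : ∀ q p i → (p + i) + (q + - p) ≡ q + i
      ring₁ = solve-∀

    -- If both ends of an edge were chosen, the two rounded constraints of the edge would add up to
    -- pu + pv + 2 ≤ pu + pv + 1, because `k u v + k v u` is 1.
    rounded-stable : ∀ j → Stable G (rounded j)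
    rounded-stable j u v u∈ v∈ with adj G u v in eq
    ... | false = refl
    ... | true  = ⊥-elim (absurd (subst₂ _≤_ (ring₁ pu pv) (trans (ring₂ pu pv (k u v) (k v u)) (cong (_+_ (pu + pv)) (k-sum eq)))
                   (+-mono-≤ (≤-trans (i<j⇒suc[i]≤j (subset⁻ {n} {In j} (In? j) v∈)) (bound j eq))
                             (≤-trans (i<j⇒suc[i]≤j (subset⁻ {n} {In j} (In? j) u∈)) (bound j (adj-sym eq))))))
      where
      pu pv : ℤ
      pu = floor (P u + + toℕ j)
      pv = floor (P v + + toℕ j)
      ring₁ : ∀ a b → (1ℤ + b) + (1ℤ + a) ≡ (a + b) + + 2
      ring₁ = solve-∀
      ring₂ : ∀ a b c d → (a + c) + (b + d) ≡ (a + b) + (c + d)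
      ring₂ = solve-∀
      absurd : ¬ (pu + pv + + 2 ≤ pu + pv + 1ℤ)
      absurd = <⇒≱ (+-monoʳ-< (pu + pv) {1ℤ} {+ 2} (+<+ (s≤s (s≤s z≤n))))

    indicator-rounded : ∀ j u → indicator (rounded j) u ≡ floor (Q u + + toℕ j) + - floor (P u + + toℕ j)
    indicator-rounded j u with Vec.lookup (rounded j) u | Vec.lookup∘tabulate (λ i → ⌊ In? j i ⌋) u
    ... | b | e with In? j u | floor-step t (+-monoˡ-≤ (+ toℕ j) (low u)) (subst (Q u + + toℕ j ≤_) (ring (P u) (+ t) (+ toℕ j)) (+-monoˡ-≤ (+ toℕ j) (high u)))
      where
      ring : ∀ p t j → (p + t) + j ≡ (p + j) + t
      ring = solve-∀
    ...   | yes l | inj₁ same = ⊥-elim (<-irrefl (sym same) l)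
    ...   | no ¬l | inj₂ up   = ⊥-elim (¬l (suc[i]≤j⇒i<j (≤-reflexive (sym up))))
    ...   | yes _ | inj₂ up rewrite e = sym (trans (cong (_+ - floor (P u + + toℕ j)) up) (ring₁ (floor (P u + + toℕ j))))
      where
      ring₁ : ∀ a → (1ℤ + a) + - a ≡ 1ℤ
      ring₁ = solve-∀
    ...   | no _  | inj₁ same rewrite e = sym (trans (cong (_+ - floor (P u + + toℕ j)) same) (+-inverseʳ (floor (P u + + toℕ j))))

    -- The t rounded sets average to the point (Q - P) / t: each indicator is a difference of
    -- integer parts, and over all shifts these differences add up to the unrounded one.
    rounded-sum : ∀ u → lsum (λ S → indicator S u) (tabulate rounded) ≡ Q u + - P u
    rounded-sum u = begin
      lsum (λ S → indicator S u) (tabulate rounded)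
        ≡⟨ lsum-tabulate (λ S → indicator S u) rounded ⟩
      sum (λ j → indicator (rounded j) u)
        ≡⟨ sum-cong {t} (λ j → trans (indicator-rounded j u) (cong (_+_ (floor (Q u + + toℕ j))) (negate (floor (P u + + toℕ j))))) ⟩
      sum {t} (λ j → floor (Q u + + toℕ j) + -1ℤ * floor (P u + + toℕ j))
        ≡⟨ sum-+ {t} (λ j → floor (Q u + + toℕ j)) (λ j → -1ℤ * floor (P u + + toℕ j)) ⟩
      roundings t (Q u) + sum {t} (λ j → -1ℤ * floor (P u + + toℕ j))
        ≡⟨ cong (_+_ (roundings t (Q u))) (trans (sum-*ˡ {t} -1ℤ (λ j → floor (P u + + toℕ j))) (sym (negate (roundings t (P u))))) ⟩
      roundings t (Q u) + - roundings t (P u)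
        ≡⟨ roundings-diff t (low u) ⟩
      Q u + - P u ∎
      where
      negate : ∀ a → - a ≡ -1ℤ * a
      negate = solve-∀

  module Union {n : ℕ} (G : Graph n) {K : ℕ} (refs : Fin K → Reference G) where

    open Edges G

    k : Fin K → Fin n → Fin n → ℤ
    k r = Reference.k (refs r)

    width : ℕ
    width = suc (n ℕ.+ n)

    d : ℕ
    d = K ℕ.* width

    Tᵛ : Fin K → Fin d
    Tᵛ r = combine r zero

    Pᵛ Qᵛ : Fin K → Fin n → Fin d
    Pᵛ r u = combine r (suc (u ↑ˡ n))
    Qᵛ r u = combine r (suc (n ↑ʳ u))

    -- Balas' disjunctive formulation, with T r the weight of the r-th polytope; when
    -- T r vanishes, P r and Q r agree, so the r-th part contributes nothing.
    record Solution (N : ℕ) (X : Fin n → ℤ) (T : Fin K → ℤ) (P Q : Fin K → Fin n → ℤ) : Set where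
      field
        edge  : ∀ r {u v} → Adj G u v → Q r v + - P r u ≤ k r u v * T r
        low   : ∀ r u → P r u ≤ Q r u
        high  : ∀ r u → Q r u ≤ P r u + T r
        T≥0   : ∀ r → 0ℤ ≤ T r
        T-sum : sum T ≡ + suc N
        X-sum : ∀ u → X u ≡ sum (λ r → Q r u + - P r u)

    -- Both directions of every edge, because q v - p u ≤ k u v is not symmetric in u and v.
    arcs : List (Fin n × Fin n)
    arcs = edges ++ map swap edges

    arcs⁺ : ∀ {u v} → Adj G u v → (u , v) ∈ arcs
    arcs⁺ a with adj-order a
    ... | inj₁ l = ∈-++⁺ˡ (edges⁺ l a)
    ... | inj₂ l = ∈-++⁺ʳ edges (∈-map⁺ swap (edges⁺ l (adj-sym a)))

    arcs⁻ : ∀ {u v} → (u , v) ∈ arcs → Adj G u v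
    arcs⁻ p with ∈-++⁻ edges p
    ... | inj₁ q = edges⁻ q
    ... | inj₂ q with ∈-map⁻ swap q
    ...   | _ , q′ , refl = adj-sym (edges⁻ q′)

    constraint : List (ℤ × Fin n) → List (ℤ × Fin d) → ℤ → Row n d
    constraint a b c = row (sparse a) (sparse b) c

    edgeRow : Fin K → Fin n × Fin n → Row n d
    edgeRow r (u , v) = constraint [] ((1ℤ , Qᵛ r v) ∷ (-1ℤ , Pᵛ r u) ∷ (- k r u v , Tᵛ r) ∷ []) 0ℤ

    lowRow highRow : Fin K → Fin n → Row n d
    lowRow r u  = constraint [] ((1ℤ , Pᵛ r u) ∷ (-1ℤ , Qᵛ r u) ∷ []) 0ℤ
    highRow r u = constraint [] ((1ℤ , Qᵛ r u) ∷ (-1ℤ , Pᵛ r u) ∷ (-1ℤ , Tᵛ r) ∷ []) 0ℤ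

    signRow : Fin K → Row n d
    signRow r = constraint [] ((-1ℤ , Tᵛ r) ∷ []) 0ℤ

    -- The rows for s = 1 and s = -1 together express an equation; likewise for `projectionRow`.
    totalRow : ℤ → Row n d
    totalRow s = constraint [] (tabulate λ r → s , Tᵛ r) s

    projectionRow : ℤ → Fin n → Row n d
    projectionRow s u = constraint ((s , u) ∷ []) (tabulate (λ r → - s , Qᵛ r u) ++ tabulate (λ r → s , Pᵛ r u)) 0ℤ

    rowsAt : Fin K → List (Row n d)
    rowsAt r = signRow r ∷ map (edgeRow r) arcs ++ (map (lowRow r) (allFin n) ++ map (highRow r) (allFin n))

    rows : List (Row n d)
    rows = totalRow 1ℤ ∷ totalRow -1ℤ ∷
      map (projectionRow 1ℤ) (allFin n) ++ (map (projectionRow -1ℤ) (allFin n) ++ collect rowsAt)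

    length-rows : length rows ≡ 2 ℕ.+ (n ℕ.+ (n ℕ.+ K ℕ.* suc (edgeCount G ℕ.+ edgeCount G ℕ.+ (n ℕ.+ n))))
    length-rows = cong (2 ℕ.+_) (trans (length-++ (map (projectionRow 1ℤ) (allFin n))) (cong₂ ℕ._+_ (vertices _)
      (trans (length-++ (map (projectionRow -1ℤ) (allFin n))) (cong₂ ℕ._+_ (vertices _)
      (trans (length-collect rowsAt) (trans (Σℕ-cong each) (Σℕ-const K _)))))))
      where
      vertices : ∀ (f : Fin n → Row n d) → length (map f (allFin n)) ≡ n
      vertices f = trans (length-map f (allFin n)) (length-tabulate id)
      length-arcs : length arcs ≡ edgeCount G ℕ.+ edgeCount G
      length-arcs = trans (length-++ edges) (cong₂ ℕ._+_ length-edges (trans (length-map swap edges) length-edges))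
      each : ∀ r → length (rowsAt r) ≡ suc (edgeCount G ℕ.+ edgeCount G ℕ.+ (n ℕ.+ n))
      each r = cong suc (trans (length-++ (map (edgeRow r) arcs)) (cong₂ ℕ._+_ (trans (length-map (edgeRow r) arcs) length-arcs)
        (trans (length-++ (map (lowRow r) (allFin n))) (cong₂ ℕ._+_ (vertices (lowRow r)) (vertices (highRow r))))))

    module _ (N : ℕ) (X : Fin n → ℤ) (Y : Fin d → ℤ) where

      private
        T : Fin K → ℤ
        T r = Y (Tᵛ r)
        P Q : Fin K → Fin n → ℤ
        P r u = Y (Pᵛ r u)
        Q r u = Y (Qᵛ r u)

        Holds : Row n d → Set
        Holds r = HoldsAt N r X Y

        lhs : ∀ a b → sparse a ⊙ X + sparse b ⊙ Y ≡ eval a X + eval b Y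
        lhs a b = cong₂ _+_ (sparse-⊙ a X) (sparse-⊙ b Y)

        homogeneous⁺ : ∀ a b {i j} → eval a X + eval b Y ≡ i + - j → i ≤ j → Holds (constraint a b 0ℤ)
        homogeneous⁺ a b {i} {j} e l = subst (_≤ 0ℤ) (sym (trans (lhs a b) e)) (i≤j⇒i-j≤0 l)

        homogeneous⁻ : ∀ a b {i j} → eval a X + eval b Y ≡ i + - j → Holds (constraint a b 0ℤ) → i ≤ j
        homogeneous⁻ a b {i} {j} e h = i-j≤0⇒i≤j (subst (_≤ 0ℤ) (trans (lhs a b) e) h)

        edge-eval : ∀ r u v → 0ℤ + (1ℤ * Q r v + (-1ℤ * P r u + (- k r u v * T r + 0ℤ))) ≡ (Q r v + - P r u) + - (k r u v * T r)
        edge-eval r u v = ring (Q r v) (P r u) (k r u v) (T r)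
          where
          ring : ∀ q p k t → 0ℤ + (1ℤ * q + (-1ℤ * p + (- k * t + 0ℤ))) ≡ (q + - p) + - (k * t)
          ring = solve-∀

        low-eval : ∀ r u → 0ℤ + (1ℤ * P r u + (-1ℤ * Q r u + 0ℤ)) ≡ P r u + - Q r u
        low-eval r u = ring (P r u) (Q r u)
          where
          ring : ∀ p q → 0ℤ + (1ℤ * p + (-1ℤ * q + 0ℤ)) ≡ p + - q
          ring = solve-∀

        high-eval : ∀ r u → 0ℤ + (1ℤ * Q r u + (-1ℤ * P r u + (-1ℤ * T r + 0ℤ))) ≡ Q r u + - (P r u + T r)
        high-eval r u = ring (P r u) (Q r u) (T r)
          where
          ring : ∀ p q t → 0ℤ + (1ℤ * q + (-1ℤ * p + (-1ℤ * t + 0ℤ))) ≡ q + - (p + t)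
          ring = solve-∀

        sign-eval : ∀ r → 0ℤ + (-1ℤ * T r + 0ℤ) ≡ 0ℤ + - T r
        sign-eval r = ring (T r)
          where
          ring : ∀ t → 0ℤ + (-1ℤ * t + 0ℤ) ≡ 0ℤ + - t
          ring = solve-∀

        total-eval : ∀ s → 0ℤ + eval (tabulate λ r → s , Tᵛ r) Y ≡ s * sum T
        total-eval s = trans (+-identityˡ _) (trans (lsum-tabulate (λ (c , i) → c * Y i) (λ r → s , Tᵛ r)) (sum-*ˡ s T))

        projection-eval : ∀ s u → (s * X u + 0ℤ) + eval (tabulate (λ r → - s , Qᵛ r u) ++ tabulate (λ r → s , Pᵛ r u)) Y
          ≡ s * X u + - (s * sum (λ r → Q r u + - P r u))
        projection-eval s u = cong₂ _+_ (+-identityʳ (s * X u)) (begin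
          eval (tabulate (λ r → - s , Qᵛ r u) ++ tabulate (λ r → s , Pᵛ r u)) Y
            ≡⟨ lsum-++ (λ (c , i) → c * Y i) (tabulate λ r → - s , Qᵛ r u) (tabulate λ r → s , Pᵛ r u) ⟩
          eval (tabulate λ r → - s , Qᵛ r u) Y + eval (tabulate λ r → s , Pᵛ r u) Y
            ≡⟨ cong₂ _+_ (lsum-tabulate (λ (c , i) → c * Y i) (λ r → - s , Qᵛ r u)) (lsum-tabulate (λ (c , i) → c * Y i) (λ r → s , Pᵛ r u)) ⟩
          sum (λ r → - s * Q r u) + sum (λ r → s * P r u)
            ≡⟨ sym (sum-+ (λ r → - s * Q r u) (λ r → s * P r u)) ⟩
          sum (λ r → - s * Q r u + s * P r u)
            ≡⟨ sum-cong (λ r → ring (Q r u) (P r u) s) ⟩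
          sum (λ r → (- s) * (Q r u + - P r u))
            ≡⟨ sum-*ˡ (- s) (λ r → Q r u + - P r u) ⟩
          (- s) * sum (λ r → Q r u + - P r u)
            ≡⟨ sym (neg-distribˡ-* s (sum (λ r → Q r u + - P r u))) ⟩
          - (s * sum (λ r → Q r u + - P r u)) ∎)
          where
          ring : ∀ q p s → - s * q + s * p ≡ (- s) * (q + - p)
          ring = solve-∀

        edgeTerms : Fin K → Fin n → Fin n → List (ℤ × Fin d)
        edgeTerms r u v = (1ℤ , Qᵛ r v) ∷ (-1ℤ , Pᵛ r u) ∷ (- k r u v , Tᵛ r) ∷ []
        lowTerms highTerms : Fin K → Fin n → List (ℤ × Fin d)
        lowTerms r u  = (1ℤ , Pᵛ r u) ∷ (-1ℤ , Qᵛ r u) ∷ []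
        highTerms r u = (1ℤ , Qᵛ r u) ∷ (-1ℤ , Pᵛ r u) ∷ (-1ℤ , Tᵛ r) ∷ []
        totalTerms : ℤ → List (ℤ × Fin d)
        totalTerms s = tabulate λ r → s , Tᵛ r
        projectionTerms : ℤ → Fin n → List (ℤ × Fin d)
        projectionTerms s u = tabulate (λ r → - s , Qᵛ r u) ++ tabulate (λ r → s , Pᵛ r u)

      holds⁺ : Solution N X T P Q → All Holds rows
      holds⁺ sol = total 1ℤ ∷ total -1ℤ ∷ All.++⁺ (over-vertices (projectionRow 1ℤ) (projection 1ℤ)) (All.++⁺ (over-vertices (projectionRow -1ℤ) (projection -1ℤ))
        (All.tabulate λ p → at (∈-collect⁻ rowsAt p)))
        where
        open Solution sol
        total : ∀ s → Holds (totalRow s)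
        total s = ≤-reflexive (trans (lhs [] (totalTerms s)) (trans (total-eval s) (cong (_*_ s) T-sum)))
        projection : ∀ s u → Holds (projectionRow s u)
        projection s u = homogeneous⁺ ((s , u) ∷ []) (projectionTerms s u) {s * X u} {s * sum (λ r → Q r u + - P r u)}
          (projection-eval s u) (≤-reflexive (cong (_*_ s) (X-sum u)))
        over-vertices : ∀ (f : Fin n → Row n d) → (∀ u → Holds (f u)) → All Holds (map f (allFin n))
        over-vertices f h = All.map⁺ (All.tabulate λ {u} _ → h u)
        along : ∀ r u v → Adj G u v → Holds (edgeRow r (u , v))
        along r u v a = homogeneous⁺ [] (edgeTerms r u v) {Q r v + - P r u} {k r u v * T r} (edge-eval r u v) (edge r a)
        rows-at : ∀ r → All Holds (rowsAt r)
        rows-at r = homogeneous⁺ [] ((-1ℤ , Tᵛ r) ∷ []) (sign-eval r) (T≥0 r) ∷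
          All.++⁺ (All.map⁺ (All.tabulate {xs = arcs} λ { {u , v} p → along r u v (arcs⁻ p) }))
          (All.++⁺ (over-vertices (lowRow r) λ u → homogeneous⁺ [] (lowTerms r u) (low-eval r u) (low r u))
                   (over-vertices (highRow r) λ u → homogeneous⁺ [] (highTerms r u) {Q r u} {P r u + T r} (high-eval r u) (high r u)))
        at : ∀ {ρ} → (∃ λ r → ρ ∈ rowsAt r) → Holds ρ
        at (r , p) = All.lookup (rows-at r) p

      holds⁻ : All Holds rows → Solution N X T P Q
      holds⁻ (h₁ ∷ h₂ ∷ hs) = record
        { edge  = λ r {u} {v} a → homogeneous⁻ [] (edgeTerms r u v) {Q r v + - P r u} {k r u v * T r} (edge-eval r u v)
                    (All.lookup (All.map⁻ (All.++⁻ˡ (map (edgeRow r) arcs) (All.tail (at r)))) (arcs⁺ a))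
        ; low   = λ r u → homogeneous⁻ [] (lowTerms r u) (low-eval r u)
                    (over-vertices (lowRow r) (All.++⁻ˡ (map (lowRow r) (allFin n)) (All.++⁻ʳ (map (edgeRow r) arcs) (All.tail (at r)))) u)
        ; high  = λ r u → homogeneous⁻ [] (highTerms r u) {Q r u} {P r u + T r} (high-eval r u)
                    (over-vertices (highRow r) (All.++⁻ʳ (map (lowRow r) (allFin n)) (All.++⁻ʳ (map (edgeRow r) arcs) (All.tail (at r)))) u)
        ; T≥0   = λ r → homogeneous⁻ [] ((-1ℤ , Tᵛ r) ∷ []) (sign-eval r) (All.head (at r))
        ; T-sum = ≤-antisym (subst₂ _≤_ (trans (total 1ℤ) (*-identityˡ (sum T))) (*-identityˡ (+ suc N)) h₁)
                    (neg-cancel-≤ (subst₂ _≤_ (trans (total -1ℤ) (-1*i≡-i (sum T))) (-1*i≡-i (+ suc N)) h₂))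
        ; X-sum = λ u → ≤-antisym
            (subst₂ _≤_ (*-identityˡ (X u)) (*-identityˡ (sum (λ r → Q r u + - P r u)))
              (projection 1ℤ u (over-vertices (projectionRow 1ℤ) (All.++⁻ˡ (map (projectionRow 1ℤ) (allFin n)) hs) u)))
            (neg-cancel-≤ (subst₂ _≤_ (-1*i≡-i (X u)) (-1*i≡-i (sum (λ r → Q r u + - P r u)))
              (projection -1ℤ u (over-vertices (projectionRow -1ℤ) (All.++⁻ˡ (map (projectionRow -1ℤ) (allFin n)) hs′) u))))
        }
        where
        hs′ : All Holds (map (projectionRow -1ℤ) (allFin n) ++ collect rowsAt)
        hs′ = All.++⁻ʳ (map (projectionRow 1ℤ) (allFin n)) hs
        at : ∀ r → All Holds (rowsAt r)
        at r = All.tabulate λ p → All.lookup (All.++⁻ʳ (map (projectionRow -1ℤ) (allFin n)) hs′) (∈-collect⁺ rowsAt r p)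
        over-vertices : ∀ (f : Fin n → Row n d) → All Holds (map f (allFin n)) → ∀ u → Holds (f u)
        over-vertices f h u = All.lookup (All.map⁻ h) (∈-allFin u)
        total : ∀ s → sparse [] ⊙ X + sparse (totalTerms s) ⊙ Y ≡ s * sum T
        total s = trans (lhs [] (totalTerms s)) (total-eval s)
        projection : ∀ s u → Holds (projectionRow s u) → s * X u ≤ s * sum (λ r → Q r u + - P r u)
        projection s u = homogeneous⁻ ((s , u) ∷ []) (projectionTerms s u) {s * X u} {s * sum (λ r → Q r u + - P r u)} (projection-eval s u)

    module Encoding (T : Fin K → ℤ) (P Q : Fin K → Fin n → ℤ) where

      value : Fin K × Fin width → ℤ
      value (r , zero)  = T r
      value (r , suc s) = [ P r , Q r ]′ (splitAt n s)

      encode : Fin d → ℤ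
      encode j = value (remQuot {K} width j)

      encode-T : ∀ r → encode (Tᵛ r) ≡ T r
      encode-T r = cong value (Fin.remQuot-combine {K} {width} r zero)

      encode-P : ∀ r u → encode (Pᵛ r u) ≡ P r u
      encode-P r u = trans (cong value (Fin.remQuot-combine {K} {width} r (suc (u ↑ˡ n))))
                           (cong [ P r , Q r ]′ (Fin.splitAt-↑ˡ n u n))

      encode-Q : ∀ r u → encode (Qᵛ r u) ≡ Q r u
      encode-Q r u = trans (cong value (Fin.remQuot-combine {K} {width} r (suc (n ↑ʳ u))))
                           (cong [ P r , Q r ]′ (Fin.splitAt-↑ʳ n n u))

    open Encoding using (encode; encode-T; encode-P; encode-Q)

    encoded : ∀ {N X T P Q} → Solution N X T P Q → let Y = encode T P Q in
      Solution N X (λ r → Y (Tᵛ r)) (λ r u → Y (Pᵛ r u)) (λ r u → Y (Qᵛ r u))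
    encoded {N} {X} {T} {P} {Q} sol = record
      { edge  = λ r {u} {v} a → subst₂ _≤_ (sym (cong₂ (λ q p → q + - p) (eQ r v) (eP r u))) (cong (_*_ (k r u v)) (sym (eT r))) (edge r a)
      ; low   = λ r u → subst₂ _≤_ (sym (eP r u)) (sym (eQ r u)) (low r u)
      ; high  = λ r u → subst₂ _≤_ (sym (eQ r u)) (sym (cong₂ _+_ (eP r u) (eT r))) (high r u)
      ; T≥0   = λ r → subst (0ℤ ≤_) (sym (eT r)) (T≥0 r)
      ; T-sum = trans (sum-cong eT) T-sum
      ; X-sum = λ u → trans (X-sum u) (sum-cong λ r → sym (cong₂ (λ q p → q + - p) (eQ r u) (eP r u)))
      }
      where
      open Solution sol
      eT = encode-T T P Q
      eP = encode-P T P Q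
      eQ = encode-Q T P Q

    -- Rounding with denominator `T r` makes the r-th part yield exactly `T r` stable sets, so the
    -- weights, with sum `suc N`, count the sets.
    stable-sets : ∀ {N X T P Q} → Solution N X T P Q →
      ∃ λ L → All (Stable G) L × length L ≡ suc N × (∀ u → lsum (λ S → indicator S u) L ≡ X u)
    stable-sets {N} {X} {T} {P} {Q} sol = collect L ,
      All.tabulate (λ p → All.lookup (proj₁ (proj₂ (part (proj₁ (∈-collect⁻ L p))))) (proj₂ (∈-collect⁻ L p))) ,
      +-injective (trans (cong +_ (length-collect L)) (trans (sym (sum-Σℕ (length ∘ L)))
        (trans (sum-cong λ r → proj₁ (proj₂ (proj₂ (part r)))) T-sum))) ,
      (λ u → trans (lsum-collect (λ S → indicator S u) L) (trans (sum-cong λ r → proj₂ (proj₂ (proj₂ (part r))) u) (sym (X-sum u))))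
      where
      open Solution sol
      Part : Fin K → Set
      Part r = ∃ λ L → All (Stable G) L × + length L ≡ T r × (∀ u → lsum (λ S → indicator S u) L ≡ Q r u + - P r u)
      part-of : ∀ r t → T r ≡ t → 0ℤ ≤ t → Part r
      part-of r (+ zero) e _ = [] , [] , sym e , λ u → sym (trans
        (cong (_+ - P r u) (≤-antisym (subst (Q r u ≤_) (trans (cong (_+_ (P r u)) e) (+-identityʳ (P r u))) (high r u)) (low r u)))
        (+-inverseʳ (P r u)))
      part-of r (+ suc t) e _ = tabulate rounded , All.tabulate⁺ rounded-stable ,
        trans (cong +_ (length-tabulate rounded)) (sym e) , rounded-sum
        where
        open Rounding (refs r) (suc t) (P r) (Q r)
          (λ {u} {v} a → subst (λ t → Q r v + - P r u ≤ k r u v * t) e (edge r a))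
          (low r) (λ u → subst (λ t → Q r u ≤ P r u + t) e (high r u))
      part : ∀ r → Part r
      part r = part-of r (T r) refl (T≥0 r)
      L : Fin K → List (Subset n)
      L r = proj₁ (part r)

    -- All weight goes to the r₀-th polytope. The other parts are homogeneous and hold at zero.
    covered-solution : ∀ (χ : Fin n → ℤ) → (∀ u → χ u ≡ 0ℤ ⊎ χ u ≡ 1ℤ) → ∀ r₀ ((T , P , Q , _) : Covered χ (refs r₀)) →
      Solution T (λ u → + suc T * χ u) (λ r → δ r₀ r * + suc T) (λ r u → δ r₀ r * P u) (λ r u → δ r₀ r * Q u)
    covered-solution χ values r₀ (T , P , Q , Q≡ , edge) = record
      { edge  = edge′
      ; low   = λ r u → δ-mono r (≤-trans (≤-reflexive (sym (+-identityʳ (P u)))) (≤-trans (+-monoʳ-≤ (P u) (gap≥0 u)) (≤-reflexive (sym (Q≡ u)))))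
      ; high  = λ r u → subst (δ r₀ r * Q u ≤_) (*-distribˡ-+ (δ r₀ r) (P u) (+ suc T))
                  (δ-mono r (≤-trans (≤-reflexive (Q≡ u)) (+-monoʳ-≤ (P u) (gap≤T u))))
      ; T≥0   = λ r → subst (_≤ δ r₀ r * + suc T) (*-zeroʳ (δ r₀ r)) (δ-mono r (+≤+ z≤n))
      ; T-sum = sum-δ r₀ (λ _ → + suc T)
      ; X-sum = λ u → sym (trans (sum-cong λ r → factor (δ r₀ r) (Q u) (P u)) (trans (sum-δ r₀ (λ _ → Q u + - P u))
                  (trans (cong (_+ - P u) (Q≡ u)) (ring (P u) (+ suc T * χ u)))))
      }
      where
      ring : ∀ p x → (p + x) + - p ≡ x
      ring = solve-∀
      factor : ∀ d q p → d * q + - (d * p) ≡ d * (q + - p)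
      factor = solve-∀
      δ-mono : ∀ r {i j} → i ≤ j → δ r₀ r * i ≤ δ r₀ r * j
      δ-mono r {i} {j} l with r₀ Fin.≟ r
      ... | yes _ = subst₂ _≤_ (sym (*-identityˡ i)) (sym (*-identityˡ j)) l
      ... | no _  = ≤-refl
      gap≥0 : ∀ u → 0ℤ ≤ + suc T * χ u
      gap≥0 u with values u
      ... | inj₁ e = ≤-reflexive (sym (trans (cong (_*_ (+ suc T)) e) (*-zeroʳ (+ suc T))))
      ... | inj₂ e = subst (0ℤ ≤_) (sym (trans (cong (_*_ (+ suc T)) e) (*-identityʳ (+ suc T)))) (+≤+ z≤n)
      gap≤T : ∀ u → + suc T * χ u ≤ + suc T
      gap≤T u with values u
      ... | inj₁ e = subst (_≤ + suc T) (sym (trans (cong (_*_ (+ suc T)) e) (*-zeroʳ (+ suc T)))) (+≤+ z≤n)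
      ... | inj₂ e = ≤-reflexive (trans (cong (_*_ (+ suc T)) e) (*-identityʳ (+ suc T)))
      edge′ : ∀ r {u v} → Adj G u v → δ r₀ r * Q v + - (δ r₀ r * P u) ≤ k r u v * (δ r₀ r * + suc T)
      edge′ r {u} {v} a with r₀ Fin.≟ r
      ... | yes refl = subst₂ _≤_ (sym (cong₂ (λ q p → q + - p) (*-identityˡ (Q v)) (*-identityˡ (P u))))
                         (trans (*-comm (+ suc T) (k r u v)) (cong (_*_ (k r u v)) (sym (*-identityˡ (+ suc T))))) (edge a)
      ... | no _     = ≤-reflexive (sym (*-zeroʳ (k r u v)))

    indicator-stable : ∀ {S} → Stable G S → StableIndicator G (indicator S)
    indicator-stable {S} stable = record { values = values ; stable = separated }
      where
      values : ∀ u → indicator S u ≡ 0ℤ ⊎ indicator S u ≡ 1ℤ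
      values u with Vec.lookup S u
      ... | true  = inj₂ refl
      ... | false = inj₁ refl
      separated : ∀ {u v} → Adj G u v → indicator S u ≡ 0ℤ ⊎ indicator S v ≡ 0ℤ
      separated {u} {v} a with Vec.lookup S u in eu | Vec.lookup S v in ev
      ... | false | _     = inj₁ refl
      ... | true  | false = inj₂ refl
      ... | true  | true  with trans (sym a) (stable u v (Vec.lookup⇒[]= u S eu) (Vec.lookup⇒[]= v S ev))
      ...   | ()

    module _ (cover : ∀ χ → StableIndicator G χ → ∃ λ r → Covered χ (refs r)) where

      private
        complete : ∀ S → Stable G S →
          ∃₂ λ (N : ℕ) (Y : Fin d → ℤ) → All (λ r → HoldsAt N r (λ i → + suc N * indicator S i) Y) rows
        complete S stable = from-cover (cover (indicator S) ind)
          where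
          ind : StableIndicator G (indicator S)
          ind = indicator-stable stable
          from-cover : (∃ λ r → Covered (indicator S) (refs r)) →
            ∃₂ λ (N : ℕ) (Y : Fin d → ℤ) → All (λ r → HoldsAt N r (λ i → + suc N * indicator S i) Y) rows
          from-cover (r₀ , c@(T , P , Q , _)) = T ,
            encode (λ r → δ r₀ r * + suc T) (λ r u → δ r₀ r * P u) (λ r u → δ r₀ r * Q u) ,
            holds⁺ T _ _ (encoded (covered-solution (indicator S) (StableIndicator.values ind) r₀ c))

      union-formulation : ExtendedFormulation n (InSTAB G)
      union-formulation = IntegralFormulation.formulation G rows complete (λ N X Y h → stable-sets (holds⁻ N X Y h))

      size-union : size union-formulation ≡ 2 ℕ.+ (n ℕ.+ (n ℕ.+ K ℕ.* suc (edgeCount G ℕ.+ edgeCount G ℕ.+ (n ℕ.+ n))))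
      size-union = length-rows

-- The bipartite case, the size bound and the assembly.

module Formulations where

  open import Data.Integer using (_*_; _≤_)
  open IntegerSums
  open Cycles using (δ)
  open FiniteGraphs
  open Faces
  open Orientations
  open Covers
  open Unions

  -- A finite search over vertex subsets makes the case distinction constructive.
  bipartition? : ∀ {n} (G : Graph n) → Dec (∃ λ (S : Subset n) → ∀ u v → Adj G u v →
    (u Subset.∈ S → ¬ (v Subset.∈ S)) × (¬ (u Subset.∈ S) → v Subset.∈ S))
  bipartition? G = Subset.anySubset? λ S → Fin.all? λ u → Fin.all? λ v → (adj G u v Bool.≟ true) →-dec
    (((u Subset.∈? S) →-dec ¬? (v Subset.∈? S)) ×-dec (¬? (u Subset.∈? S) →-dec (v Subset.∈? S)))

  module Bipartite {n : ℕ} (G : Graph n) (S : Subset n)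
    (bipartition : ∀ u v → Adj G u v → (u Subset.∈ S → ¬ (v Subset.∈ S)) × (¬ (u Subset.∈ S) → v Subset.∈ S)) where

    side : Fin n → ℤ
    side u = if ⌊ u Subset.∈? S ⌋ then 1ℤ else 0ℤ

    opposite-sides : ∀ {u v} → Adj G u v → (side u ≡ 1ℤ × side v ≡ 0ℤ) ⊎ (side u ≡ 0ℤ × side v ≡ 1ℤ)
    opposite-sides {u} {v} a with u Subset.∈? S | v Subset.∈? S | bipartition u v a
    ... | yes _ | no _  | _     = inj₁ (refl , refl)
    ... | no _  | yes _ | _     = inj₂ (refl , refl)
    ... | yes p | yes q | h , _ = ⊥-elim (h p q)
    ... | no p  | no q  | _ , h = ⊥-elim (q (h p))

    reference : Reference G
    reference = record { k = λ u _ → side u ; k-sum = λ a →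
      [ (λ (e , e′) → cong₂ _+_ e e′) , (λ (e , e′) → cong₂ _+_ e e′) ]′ (opposite-sides a) }

    cover-value : ∀ {s s′ c c′} → (s ≡ 1ℤ × s′ ≡ 0ℤ) ⊎ (s ≡ 0ℤ × s′ ≡ 1ℤ) → c ≡ 0ℤ ⊎ c ≡ 1ℤ → c′ ≡ 0ℤ ⊎ c′ ≡ 1ℤ →
      c ≡ 0ℤ ⊎ c′ ≡ 0ℤ → - (s′ * c′) + 1ℤ * c′ + - (- (s * c)) ≤ 1ℤ * s
    cover-value (inj₁ (refl , refl)) (inj₁ refl) (inj₁ refl) _ = +≤+ z≤n
    cover-value (inj₁ (refl , refl)) (inj₁ refl) (inj₂ refl) _ = ≤-refl
    cover-value (inj₁ (refl , refl)) (inj₂ refl) (inj₁ refl) _ = ≤-refl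
    cover-value (inj₁ (refl , refl)) (inj₂ refl) (inj₂ refl) (inj₁ ())
    cover-value (inj₁ (refl , refl)) (inj₂ refl) (inj₂ refl) (inj₂ ())
    cover-value (inj₂ (refl , refl)) (inj₁ refl) (inj₁ refl) _ = ≤-refl
    cover-value (inj₂ (refl , refl)) (inj₁ refl) (inj₂ refl) _ = ≤-refl
    cover-value (inj₂ (refl , refl)) (inj₂ refl) (inj₁ refl) _ = ≤-refl
    cover-value (inj₂ (refl , refl)) (inj₂ refl) (inj₂ refl) (inj₁ ())
    cover-value (inj₂ (refl , refl)) (inj₂ refl) (inj₂ refl) (inj₂ ())

    -- Here p is - χ on `S` and 0 elsewhere, and q = p + χ. An edge directed out of `S` then asks
    -- for χ u + χ v ≤ 1, and in the other direction both sides are 0.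
    covered : ∀ χ → StableIndicator G χ → Covered χ reference
    covered χ indicator = 0 , (λ u → - (side u * χ u)) , (λ u → - (side u * χ u) + 1ℤ * χ u) , (λ _ → refl) ,
      λ {u} {v} a → cover-value (opposite-sides a) (values u) (values v) (stable a)
      where open StableIndicator indicator

  -- Each polytope takes at most n + 4n + 2n = 7n rows, so 2n of them take 14n²; the remaining 2 +
  -- 2n rows are at most 4n².
  size-bound : ∀ {n e K} → 0 ℕ.< n → e ℕ.≤ 2 ℕ.* n → K ℕ.≤ 2 ℕ.* n →
    2 ℕ.+ (n ℕ.+ (n ℕ.+ K ℕ.* suc (e ℕ.+ e ℕ.+ (n ℕ.+ n)))) ℕ.≤ 18 ℕ.* (n ℕ.* n)
  size-bound {n} {e} {K} n>0 e≤ K≤ = ℕ.≤-trans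
    (ℕ.+-mono-≤ (ℕ.*-monoʳ-≤ 2 (ℕ.*-mono-≤ n>0 n>0)) (ℕ.+-mono-≤ n≤n² (ℕ.+-mono-≤ n≤n²
      (ℕ.*-mono-≤ K≤ (ℕ.+-mono-≤ n>0 (ℕ.+-monoˡ-≤ (n ℕ.+ n) (ℕ.+-mono-≤ e≤ e≤)))))))
    (ℕ.≤-reflexive (ring n))
    where
    n≤n² : n ℕ.≤ n ℕ.* n
    n≤n² = ℕ.≤-trans (ℕ.≤-reflexive (sym (ℕ.*-identityˡ n))) (ℕ.*-monoˡ-≤ n n>0)
    ring : ∀ n → 2 ℕ.* (n ℕ.* n) ℕ.+ (n ℕ.* n ℕ.+ (n ℕ.* n ℕ.+ (2 ℕ.* n) ℕ.* (n ℕ.+ (2 ℕ.* n ℕ.+ 2 ℕ.* n ℕ.+ (n ℕ.+ n))))) ≡ 18 ℕ.* (n ℕ.* n)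
    ring = ℕ-Solver.solve-∀

  module _ {n : ℕ} (G : Graph n) (E : EvenFaceEmbeddingPP G) where

    open Embedding G E
    open EvenFaceEmbeddingPP E

    -- For n = 0 Euler's formula would demand a face, against |F| ≤ n. Positivity lets the constant
    -- and linear terms be absorbed into n².
    n>0 : 0 ℕ.< n
    n>0 with n ℕ.≟ 0
    ... | no ne = ℕ.n≢0⇒n>0 ne
    ... | yes e = ⊥-elim (ℕ.<⇒≱ (ℕ.≤-trans (ℕ.m≤n+m 1 (edgeCount G)) (ℕ.≤-reflexive (sym euler)))
                    (ℕ.≤-trans (ℕ.+-monoʳ-≤ n F≤n) (ℕ.≤-reflexive (cong₂ ℕ._+_ e e))))

    from-references : ∀ {K} (refs : Fin K → Reference G) → K ℕ.≤ 2 ℕ.* n →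
      (∀ χ → StableIndicator G χ → ∃ λ r → Covered χ (refs r)) →
      ∃ λ (Q : ExtendedFormulation n (InSTAB G)) → size Q ℕ.≤ 18 ℕ.* (n ℕ.* n)
    from-references refs K≤2n cover = Union.union-formulation G refs cover ,
      ℕ.≤-trans (ℕ.≤-reflexive (Union.size-union G refs cover)) (size-bound n>0 E≤2n K≤2n)

    nonbipartite-formulation : NonBipartite G → ∃ λ (Q : ExtendedFormulation n (InSTAB G)) → size Q ℕ.≤ 18 ℕ.* (n ℕ.* n)
    nonbipartite-formulation nb = from-references refs
      (ℕ.≤-trans (ℕ.+-mono-≤ F≤n F≤n) (ℕ.≤-reflexive (cong (n ℕ.+_) (sym (ℕ.+-identityʳ n)))))
      (λ χ indicator → locate χ (covered-by χ indicator))
      where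
      open References G E nb using (positive-at; negative-at; covered-by)
      refs : Fin (F ℕ.+ F) → Reference G
      refs r = [ positive-at , negative-at ]′ (splitAt F r)
      locate : ∀ χ → (∃ λ f → Covered χ (positive-at f) ⊎ Covered χ (negative-at f)) → ∃ λ r → Covered χ (refs r)
      locate χ (f , inj₁ c) = f ↑ˡ F , subst (λ s → Covered χ ([ positive-at , negative-at ]′ s)) (sym (Fin.splitAt-↑ˡ F f F)) c
      locate χ (f , inj₂ c) = F ↑ʳ f , subst (λ s → Covered χ ([ positive-at , negative-at ]′ s)) (sym (Fin.splitAt-↑ʳ F F f)) c

    formulation : ∃ λ (Q : ExtendedFormulation n (InSTAB G)) → size Q ℕ.≤ 18 ℕ.* (n ℕ.* n)
    formulation with bipartition? G
    ... | yes (S , bipartition) = from-references {1} (λ _ → reference) (ℕ.≤-trans n>0 (ℕ.m≤m+n n (n ℕ.+ 0)))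
            (λ χ indicator → zero , covered χ indicator)
      where open Bipartite G S bipartition
    ... | no none = nonbipartite-formulation λ P? bip → none (subset P? , λ u v a →
            (λ u∈ v∈ → proj₁ (bip a) (subset⁻ P? u∈) (subset⁻ P? v∈)) ,
            (λ u∉ → subset⁺ P? (proj₂ (bip a) (λ p → u∉ (subset⁺ P? p)))))

open import Data.Nat using (_*_; _≤_)

theorem5 : Σ ℕ λ C → ∀ (n : ℕ) (G : Graph n) → HasEvenFaceEmbeddingPP G →
    Σ (ExtendedFormulation n (InSTAB G)) λ E → size E ≤ C * (n * n)
theorem5 = 18 , λ n G E → Formulations.formulation G E
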